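{- Fix integers $d\ge 2$ and $0\le k<d$. Then there exists an integer $N$ such that for all integers $n>N$: there exists a simple $d$-dimensional convex polytope with exactly $n$ faces of dimension $k$ if and only if $n\equiv 0\pmod{G(d,k)}$.
   Context: Binomial coefficients satisfy $\binom{a}{b}=0$ when $0\le a<b$. Let $\delta=\lfloor d/2\rfloor$ and define, for $0\le i\le\delta$ and $0\le k\le d-1$, $m_{i,k}=\binom{d+1-i}{k+1}-\binom{i}{k+1}$. Define $G(d,k)=\gcd(m_{1,k},m_{2,k},\dots,m_{\delta,k})$. A $d$-polytope is simple if every vertex lies in exactly $d$ facets.
   Formalization: The convex polytopes are taken with rational coordinates (convex hulls of finitely many points of ℚ^d, with faces cut out by rational functionals) instead of real ones. -}

module Defs where

open import Data.Nat using (ℕ; zero; suc; _∸_; ⌊_/2⌋)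
open import Data.Nat.Combinatorics using (_C_)
open import Data.Nat.GCD using (gcd)
open import Data.List using (List; []; _∷_; foldr; map)
open import Data.Rational using (ℚ; 0ℚ; _+_; _*_; _≤_)
open import Data.Fin using (Fin)
open import Data.Fin.Subset using (Subset; _∈_; ⊤; _⊆_)
open import Data.Product using (Σ; ∃; _×_)
open import Function using (_∘_; _⇔_)
open import Function.Definitions using (Injective)
open import Relation.Binary.PropositionalEquality using (_≡_)
open import Relation.Nullary using (¬_)

-- m_{i,k} = C(d+1-i, k+1) - C(i, k+1); for 1 ≤ i ≤ ⌊d/2⌋ we have
-- i ≤ d+1-i, so the difference is a natural number (truncated ∸ is exact).
mik : ℕ → ℕ → ℕ → ℕ
mik d i k = (suc d ∸ i) C (suc k) ∸ (i C (suc k))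

oneTo : ℕ → List ℕ
oneTo zero    = []
oneTo (suc n) = suc n ∷ oneTo n

G : ℕ → ℕ → ℕ
G d k = foldr gcd 0 (map (λ i → mik d i k) (oneTo ⌊ d /2⌋))

Point : ℕ → Set
Point d = Fin d → ℚ

Σℚ : ∀ {n} → (Fin n → ℚ) → ℚ
Σℚ {zero}  f = 0ℚ
Σℚ {suc n} f = f Fin.zero + Σℚ (f ∘ Fin.suc)

dot : ∀ {d} → Point d → Point d → ℚ
dot x y = Σℚ (λ j → x j * y j)

AffIndep : ∀ {d r} → (Fin r → Point d) → Set
AffIndep {d} {r} w =
  (λ' : Fin r → ℚ) → Σℚ λ' ≡ 0ℚ →
  (∀ (j : Fin d) → Σℚ (λ i → λ' i * w i j) ≡ 0ℚ) →
  ∀ i → λ' i ≡ 0ℚ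

-- The vertex configuration V : Fin m → Point d describes the polytope
-- P = conv {V i}.  A subset S of the indices describes the point set
-- conv {V i | i ∈ S}.

HasIndep : ∀ {d m} → (Fin m → Point d) → Subset m → ℕ → Set
HasIndep {d} {m} V S r =
  Σ (Fin r → Fin m) λ f → (∀ i → f i ∈ S) × AffIndep (V ∘ f)

HasDim : ∀ {d m} → (Fin m → Point d) → Subset m → ℕ → Set
HasDim V S k = HasIndep V S (suc k) × ¬ HasIndep V S (suc (suc k))

-- S is (the vertex-index set of) a face of P = conv V: S consists exactly
-- of the V i on which some linear functional c attains its maximum b over P.
-- (Every face of a polytope is exposed, and a face is the convex hull of
-- the points of V it contains, so faces ↔ such subsets S.)
IsFace : ∀ {d m} → (Fin m → Point d) → Subset m → Set
IsFace {d} {m} V S =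
  Σ (Point d) λ c → Σ ℚ λ b →
    (∀ i → dot c (V i) ≤ b) × (∀ i → (i ∈ S) ⇔ (dot c (V i) ≡ b))

KFace : ∀ {d m} → (Fin m → Point d) → ℕ → Subset m → Set
KFace V k S = IsFace V S × HasDim V S k

HasExactly : ∀ {m} → ℕ → (Subset m → Set) → Set
HasExactly {m} n P =
  Σ (Fin n → Subset m) λ F → Injective _≡_ _≡_ F × (∀ S → P S ⇔ ∃ λ i → F i ≡ S)

IsDPolytope : ∀ {d m} → (Fin m → Point d) → Set
IsDPolytope {d} V = HasDim V ⊤ d

IsSimpleDPolytope : ∀ {d m} → (Fin m → Point d) → Set
IsSimpleDPolytope {d} {m} V =
  IsDPolytope V ×
  (∀ (v : Subset m) → KFace V 0 v →
     HasExactly d (λ F → KFace V (d ∸ 1) F × v ⊆ F))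

SimpleWithKFaces : ℕ → ℕ → ℕ → Set
SimpleWithKFaces d k n =
  Σ ℕ λ m → Σ (Fin m → Point d) λ V →
    IsSimpleDPolytope V × HasExactly n (KFace V k)

{-# OPTIONS --safe #-}

-- Necessity.  At a vertex of a simple polytope the d facet normals form a basis and generate the
-- normal cone, so the faces through the vertex correspond to the subsets of its d edges.  Every face
-- has a unique highest vertex for a generic linear functional, hence f_j = Σ_u C(r_u, j) for all j,
-- with r_u the number of edges descending from u.  The negative functional replaces r_u by d − r_u,
-- so the r_u are distributed symmetrically.  With P(i) = C(i, k+1), G divides P(d+1−i) − P(i) for
-- 1 ≤ i ≤ d by definition and for i = 0 by polynomial extrapolation; differences of these congruences
-- give G ∣ C(i,k) + C(d−i,k) and thereby G ∣ f_k.
--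
-- Sufficiency.  Replacing a vertex by a product of simplices of dimensions α and β = d − α with one
-- vertex removed (two new facets near the vertex) adds Δ_α = m_1 + (m_1 + … + m_α) to f_k.  The facet
-- labels of the polytope are kept together with a partition of its dual complex into intervals, from
-- which f_k is read off.  As gcd(Δ_0, …, Δ_δ) = G, starting from the simplex all large multiples of G
-- are reached.
module Submission where

-- The definition of simplicity only counts facets at a vertex. That their normals generate the
-- normal cone and are independent has to be derived; `Corner` records the outcome, d inequalities
-- and d points whose slacks form a diagonal matrix, and both directions count faces through it. The
-- geometry needs one dimension argument, `nonzero-solution`, and two rational substitutes for
-- limits, `large-multiple` and `ratio-test`. Two obstacles shape the necessity proof. `V` may
-- repeat points and list nonvertices, so vertices are handled through representatives of classes of
-- indices. Being a vertex quantifies over functionals, so it is decided only under a double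
-- negation, which is harmless because divisibility is decidable. For sufficiency, a `Cert` carries
-- points, inequalities and incidences together, so no convex hull is ever computed. The replacement
-- is a connected sum: the polytope and the product of simplices lose one vertex each, and the edges
-- at these vertices are joined. The gcd claim holds because Δ_0 is m_1 and consecutive Δ differ by
-- one m_i.

open import Defs
open import Data.Product using (Σ; ∃; _×_; _,_; proj₁; proj₂)
open import Data.Sum as Sum using (_⊎_; inj₁; inj₂)
open import Function using (_∘_; _⇔_; mk⇔; Equivalence)
open import Relation.Binary.Definitions using (tri<; tri≈; tri>)
open import Relation.Binary.PropositionalEquality
open import Relation.Nullary using (¬_; Dec; yes; no; ¬?; does; contradiction)
open import Relation.Nullary.Decidable using (decidable-stable; dec-true; _→-dec_; _×-dec_)
open import Relation.Unary using (Decidable)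

-- Rational arithmetic, linear systems and extremal choices.

module LinAlg where

  open import Data.Nat.Base as ℕ using (ℕ; zero; suc; s≤s)
  open import Data.Fin.Base using (Fin; zero; suc; punchIn; punchOut)
  open import Data.Fin.Properties as Fin using (any?; punchIn-punchOut; punchInᵢ≢i)
  open import Data.Vec.Functional using (_∷_)
  open import Data.Maybe.Base using (Maybe; just; nothing)
  open import Data.Rational
  open import Data.Rational.Properties
  open import Level using (0ℓ)
  open import Tactic.RingSolver using (solve-∀)
  open import Tactic.RingSolver.Core.AlmostCommutativeRing using (AlmostCommutativeRing; fromCommutativeRing)

  ℚ-ring : AlmostCommutativeRing 0ℓ 0ℓ
  ℚ-ring = fromCommutativeRing +-*-commutativeRing isZero
    where
    isZero : (x : ℚ) → Maybe (0ℚ ≡ x)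
    isZero x with 0ℚ ≟ x
    ... | yes p = just p
    ... | no _  = nothing

  infixl 6 _∙+_
  _∙+_ : ∀ {p q} → 0ℚ ≤ p → 0ℚ ≤ q → 0ℚ ≤ p + q
  _∙+_ {p} {q} a b = subst (_≤ p + q) (+-identityˡ 0ℚ) (+-mono-≤ a b)

  0≤* : ∀ {p q} → 0ℚ ≤ p → 0ℚ ≤ q → 0ℚ ≤ p * q
  0≤* {p} {q} a b = nonNegative⁻¹ _ {{nonNeg*nonNeg⇒nonNeg p {{nonNegative a}} q {{nonNegative b}}}}

  0<* : ∀ {p q} → 0ℚ < p → 0ℚ < q → 0ℚ < p * q
  0<* {p} {q} a b = positive⁻¹ _ {{pos*pos⇒pos p {{positive a}} q {{positive b}}}}

  0<+ : ∀ {p q} → 0ℚ < p → 0ℚ ≤ q → 0ℚ < p + q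
  0<+ {p} {q} a b = subst (_< p + q) (+-identityˡ 0ℚ) (+-mono-<-≤ a b)

  ≤⇒0≤ : ∀ {p q} → p ≤ q → 0ℚ ≤ q - p
  ≤⇒0≤ {p} {q} a = subst (_≤ q - p) (+-inverseʳ p) (+-monoˡ-≤ (- p) a)

  0≤⇒≤ : ∀ {p q} → 0ℚ ≤ q - p → p ≤ q
  0≤⇒≤ {p} {q} a = subst₂ _≤_ (+-identityˡ p) (lem q p) (+-monoˡ-≤ p a)
    where
    lem : ∀ q p → q - p + p ≡ q
    lem = solve-∀ ℚ-ring

  <⇒0< : ∀ {p q} → p < q → 0ℚ < q - p
  <⇒0< {p} {q} a = subst (_< q - p) (+-inverseʳ p) (+-monoˡ-< (- p) a)

  0<⇒< : ∀ {p q} → 0ℚ < q - p → p < q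
  0<⇒< {p} {q} a = subst₂ _<_ (+-identityˡ p) (lem q p) (+-monoˡ-< p a)
    where
    lem : ∀ q p → q - p + p ≡ q
    lem = solve-∀ ℚ-ring

  0<- : ∀ {p} → p < 0ℚ → 0ℚ < - p
  0<- {p} a = subst (0ℚ <_) (+-identityˡ (- p)) (<⇒0< a)

  0≤- : ∀ {p} → p ≤ 0ℚ → 0ℚ ≤ - p
  0≤- {p} a = subst (0ℚ ≤_) (+-identityˡ (- p)) (≤⇒0≤ a)

  -≡0 : ∀ {p q} → p - q ≡ 0ℚ → p ≡ q
  -≡0 {p} {q} e = trans (lem p q) (trans (cong (_+ q) e) (+-identityˡ q))
    where
    lem : ∀ p q → p ≡ p - q + q
    lem = solve-∀ ℚ-ring

  -self : ∀ {p q} → p ≡ q → p - q ≡ 0ℚ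
  -self {p} refl = +-inverseʳ p

  ≤∧≢⇒< : ∀ {p q} → p ≤ q → p ≢ q → p < q
  ≤∧≢⇒< {p} {q} a ne with p <? q
  ... | yes l = l
  ... | no ¬l = contradiction (≤-antisym a (≮⇒≥ ¬l)) ne

  -- Totalised by the value 0 at 0, so that quotients can be written without carrying a proof that
  -- the denominator is nonzero.
  inv : ℚ → ℚ
  inv q with q ≟ 0ℚ
  ... | yes _  = 0ℚ
  ... | no q≢0 = 1/_ q {{≢-nonZero q≢0}}

  *-inv : ∀ {q} → q ≢ 0ℚ → q * inv q ≡ 1ℚ
  *-inv {q} q≢0 with q ≟ 0ℚ
  ... | yes e   = contradiction e q≢0
  ... | no q≢0′ = *-inverseʳ q {{≢-nonZero q≢0′}}

  0<inv : ∀ {q} → 0ℚ < q → 0ℚ < inv q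
  0<inv {q} 0<q with q ≟ 0ℚ
  ... | yes e   = contradiction (sym e) (<⇒≢ 0<q)
  ... | no q≢0′ = positive⁻¹ _ {{1/pos⇒pos q {{positive 0<q}}}}

  >⇒≢ : ∀ {q} → 0ℚ < q → q ≢ 0ℚ
  >⇒≢ 0<q e = <⇒≢ 0<q (sym e)

  *-cancel-0 : ∀ {p q} → p ≢ 0ℚ → p * q ≡ 0ℚ → q ≡ 0ℚ
  *-cancel-0 {p} {q} p≢0 e = begin
    q               ≡⟨ *-identityˡ q ⟨
    1ℚ * q          ≡⟨ cong (_* q) (*-inv p≢0) ⟨
    p * inv p * q   ≡⟨ lem p (inv p) q ⟩
    inv p * (p * q) ≡⟨ cong (inv p *_) e ⟩
    inv p * 0ℚ      ≡⟨ *-zeroʳ (inv p) ⟩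
    0ℚ              ∎
    where
    open ≡-Reasoning
    lem : ∀ p i q → p * i * q ≡ i * (p * q)
    lem = solve-∀ ℚ-ring

  Σ-cong : ∀ {n} {f g : Fin n → ℚ} → (∀ i → f i ≡ g i) → Σℚ f ≡ Σℚ g
  Σ-cong {zero}  e = refl
  Σ-cong {suc n} e = cong₂ _+_ (e zero) (Σ-cong (e ∘ suc))

  Σ-0 : ∀ {n} {f : Fin n → ℚ} → (∀ i → f i ≡ 0ℚ) → Σℚ f ≡ 0ℚ
  Σ-0 {zero}  e = refl
  Σ-0 {suc n} e = trans (cong₂ _+_ (e zero) (Σ-0 (e ∘ suc))) (+-identityˡ 0ℚ)

  Σ-+ : ∀ {n} (f g : Fin n → ℚ) → Σℚ (λ i → f i + g i) ≡ Σℚ f + Σℚ g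
  Σ-+ {zero}  f g = refl
  Σ-+ {suc n} f g = trans (cong (f zero + g zero +_) (Σ-+ (f ∘ suc) (g ∘ suc))) (lem (f zero) (g zero) (Σℚ (f ∘ suc)) (Σℚ (g ∘ suc)))
    where
    lem : ∀ a b c d → a + b + (c + d) ≡ a + c + (b + d)
    lem = solve-∀ ℚ-ring

  Σ-* : ∀ {n} a (f : Fin n → ℚ) → Σℚ (λ i → a * f i) ≡ a * Σℚ f
  Σ-* {zero}  a f = sym (*-zeroʳ a)
  Σ-* {suc n} a f = trans (cong (a * f zero +_) (Σ-* a (f ∘ suc))) (sym (*-distribˡ-+ a (f zero) (Σℚ (f ∘ suc))))

  Σ-swap : ∀ {m n} (f : Fin m → Fin n → ℚ) →
           Σℚ (λ i → Σℚ (f i)) ≡ Σℚ (λ j → Σℚ (λ i → f i j))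
  Σ-swap {zero}  {n} f = sym (Σ-0 {n} λ _ → refl)
  Σ-swap {suc m} f = trans (cong (Σℚ (f zero) +_) (Σ-swap (f ∘ suc))) (sym (Σ-+ (f zero) (λ j → Σℚ (λ i → f (suc i) j))))

  Σ-nonNeg : ∀ {n} {f : Fin n → ℚ} → (∀ i → 0ℚ ≤ f i) → 0ℚ ≤ Σℚ f
  Σ-nonNeg {zero}  p = ≤-refl
  Σ-nonNeg {suc n} p = p zero ∙+ Σ-nonNeg (p ∘ suc)

  Σ-punchIn : ∀ {n} i (f : Fin (suc n) → ℚ) → Σℚ f ≡ f i + Σℚ (f ∘ punchIn i)
  Σ-punchIn zero f = refl
  Σ-punchIn {suc n} (suc i) f =
    trans (cong (f zero +_) (Σ-punchIn i (f ∘ suc))) (lem (f zero) (f (suc i)) (Σℚ (f ∘ suc ∘ punchIn i)))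
    where
    lem : ∀ a b c → a + (b + c) ≡ b + (a + c)
    lem = solve-∀ ℚ-ring

  Σ-single : ∀ {n} i {f : Fin n → ℚ} → (∀ j → j ≢ i → f j ≡ 0ℚ) → Σℚ f ≡ f i
  Σ-single {suc n} i {f} z = begin
    Σℚ f                       ≡⟨ Σ-punchIn i f ⟩
    f i + Σℚ (f ∘ punchIn i)   ≡⟨ cong (f i +_) (Σ-0 λ j → z _ (punchInᵢ≢i i j)) ⟩
    f i + 0ℚ                   ≡⟨ +-identityʳ (f i) ⟩
    f i                        ∎
    where open ≡-Reasoning

  Σ-≥ : ∀ {n} {f : Fin n → ℚ} → (∀ i → 0ℚ ≤ f i) → ∀ i → f i ≤ Σℚ f
  Σ-≥ {suc n} {f} p i = subst₂ _≤_ (+-identityʳ (f i)) (sym (Σ-punchIn i f))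
    (+-monoʳ-≤ (f i) (Σ-nonNeg (p ∘ punchIn i)))

  Σ≡0⇒ : ∀ {n} {f : Fin n → ℚ} → (∀ i → 0ℚ ≤ f i) → Σℚ f ≡ 0ℚ → ∀ i → f i ≡ 0ℚ
  Σ≡0⇒ p e i = ≤-antisym (subst (_ ≤_) e (Σ-≥ p i)) (p i)

  0<Σ : ∀ {n} {f : Fin n → ℚ} → (∀ i → 0ℚ ≤ f i) → ∀ i → 0ℚ < f i → 0ℚ < Σℚ f
  0<Σ p i q = <-≤-trans q (Σ-≥ p i)

  dot-comm : ∀ {n} (x y : Point n) → dot x y ≡ dot y x
  dot-comm x y = Σ-cong λ j → *-comm (x j) (y j)

  dot-0ʳ : ∀ {n} (c : Point n) → dot c (λ _ → 0ℚ) ≡ 0ℚ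
  dot-0ʳ c = Σ-0 λ j → *-zeroʳ (c j)

  dot-linʳ : ∀ {n} (c x y : Point n) a b →
             dot c (λ j → a * x j + b * y j) ≡ a * dot c x + b * dot c y
  dot-linʳ c x y a b = begin
    dot c (λ j → a * x j + b * y j)
      ≡⟨ Σ-cong (λ j → lem (c j) (x j) (y j) a b) ⟩
    Σℚ (λ j → a * (c j * x j) + b * (c j * y j))
      ≡⟨ Σ-+ (λ j → a * (c j * x j)) (λ j → b * (c j * y j)) ⟩
    Σℚ (λ j → a * (c j * x j)) + Σℚ (λ j → b * (c j * y j))
      ≡⟨ cong₂ _+_ (Σ-* a (λ j → c j * x j)) (Σ-* b (λ j → c j * y j)) ⟩
    a * dot c x + b * dot c y ∎
    where
    open ≡-Reasoning
    lem : ∀ c x y a b → c * (a * x + b * y) ≡ a * (c * x) + b * (c * y)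
    lem = solve-∀ ℚ-ring

  dot-linˡ : ∀ {n} (c d x : Point n) a b →
             dot (λ j → a * c j + b * d j) x ≡ a * dot c x + b * dot d x
  dot-linˡ c d x a b = begin
    dot (λ j → a * c j + b * d j) x ≡⟨ dot-comm (λ j → a * c j + b * d j) x ⟩
    dot x (λ j → a * c j + b * d j) ≡⟨ dot-linʳ x c d a b ⟩
    a * dot x c + b * dot x d       ≡⟨ cong₂ (λ u v → a * u + b * v) (dot-comm x c) (dot-comm x d) ⟩
    a * dot c x + b * dot d x       ∎
    where open ≡-Reasoning

  dot-Σʳ : ∀ {n r} (c : Point n) (a : Fin r → ℚ) (x : Fin r → Point n) →
           dot c (λ j → Σℚ (λ i → a i * x i j)) ≡ Σℚ (λ i → a i * dot c (x i))
  dot-Σʳ c a x = begin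
    Σℚ (λ j → c j * Σℚ (λ i → a i * x i j))   ≡⟨ Σ-cong (λ j → sym (Σ-* (c j) (λ i → a i * x i j))) ⟩
    Σℚ (λ j → Σℚ (λ i → c j * (a i * x i j))) ≡⟨ Σ-swap (λ j i → c j * (a i * x i j)) ⟩
    Σℚ (λ i → Σℚ (λ j → c j * (a i * x i j)))
      ≡⟨ Σ-cong (λ i → trans (Σ-cong λ j → lem (c j) (a i) (x i j)) (Σ-* (a i) (λ j → c j * x i j))) ⟩
    Σℚ (λ i → a i * dot c (x i)) ∎
    where
    open ≡-Reasoning
    lem : ∀ c a x → c * (a * x) ≡ a * (c * x)
    lem = solve-∀ ℚ-ring

  dot-Σˡ : ∀ {n r} (a : Fin r → ℚ) (c : Fin r → Point n) (x : Point n) →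
           dot (λ j → Σℚ (λ i → a i * c i j)) x ≡ Σℚ (λ i → a i * dot (c i) x)
  dot-Σˡ a c x = begin
    dot (λ j → Σℚ (λ i → a i * c i j)) x ≡⟨ dot-comm (λ j → Σℚ (λ i → a i * c i j)) x ⟩
    dot x (λ j → Σℚ (λ i → a i * c i j)) ≡⟨ dot-Σʳ x a c ⟩
    Σℚ (λ i → a i * dot x (c i))         ≡⟨ Σ-cong (λ i → cong (a i *_) (dot-comm x (c i))) ⟩
    Σℚ (λ i → a i * dot (c i) x)         ∎
    where open ≡-Reasoning

  square-≥0 : ∀ q → 0ℚ ≤ q * q
  square-≥0 q with ≤-total 0ℚ q
  ... | inj₁ p = 0≤* p p
  ... | inj₂ p = subst (0ℚ ≤_) (lem q) (0≤* (0≤- p) (0≤- p))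
    where
    lem : ∀ q → - q * - q ≡ q * q
    lem = solve-∀ ℚ-ring

  dot-self≡0 : ∀ {n} (e : Point n) → dot e e ≡ 0ℚ → ∀ j → e j ≡ 0ℚ
  dot-self≡0 e z j with e j ≟ 0ℚ
  ... | yes p = p
  ... | no p  = *-cancel-0 p (Σ≡0⇒ (λ j → square-≥0 (e j)) z j)

  NonZeroVec : ∀ {n} → Point n → Set
  NonZeroVec e = ∃ λ j → e j ≢ 0ℚ

  -- Gaussian elimination on the first unknown. Every dimension argument below is phrased as such a
  -- system.
  nonzero-solution : ∀ {r n} (y : Fin r → Point n) → r ℕ.< n →
                     ∃ λ e → NonZeroVec e × (∀ k → dot (y k) e ≡ 0ℚ)
  nonzero-solution {zero}  {suc n} y _ = (λ _ → 1ℚ) , (zero , 1≢0) , λ ()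
  nonzero-solution {suc r} {suc n} y (s≤s r<n) with any? (λ k → ¬? (y k zero ≟ 0ℚ))
  ... | no all0 = (1ℚ ∷ λ _ → 0ℚ) , (zero , 1≢0) , λ k →
        trans (cong₂ _+_ (trans (*-identityʳ (y k zero)) (yk0 k)) (dot-0ʳ (y k ∘ suc))) (+-identityˡ 0ℚ)
    where
    yk0 : ∀ k → y k zero ≡ 0ℚ
    yk0 k with y k zero ≟ 0ℚ
    ... | yes p = p
    ... | no p  = contradiction (k , p) all0
  ... | yes (i , yi≢0) with nonzero-solution y′ r<n
    where
    y′ : Fin r → Point n
    y′ k j = 1ℚ * y (punchIn i k) (suc j) + - (y (punchIn i k) zero * inv (y i zero)) * y i (suc j)
  ... | e′ , (j , e′j≢0) , sol = (e₀ ∷ e′) , (suc j , e′j≢0) , eqn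
    where
    open ≡-Reasoning
    tail·e′ : Fin (suc r) → ℚ
    tail·e′ k = dot (y k ∘ suc) e′
    e₀ : ℚ
    -- Back substitution: the value that the pivot equation i forces on the first unknown.
    e₀ = - (tail·e′ i * inv (y i zero))
    lem₁ : ∀ t p v → p * - (t * v) + t ≡ t * (1ℚ - p * v)
    lem₁ = solve-∀ ℚ-ring
    lem₂ : ∀ p t v u → p * - (t * v) + u ≡ 1ℚ * u + - (p * v) * t
    lem₂ = solve-∀ ℚ-ring
    eqn : ∀ k → dot (y k) (e₀ ∷ e′) ≡ 0ℚ
    eqn k with i Fin.≟ k
    ... | yes refl = begin
      y i zero * e₀ + tail·e′ i                       ≡⟨ lem₁ (tail·e′ i) (y i zero) (inv (y i zero)) ⟩
      tail·e′ i * (1ℚ - y i zero * inv (y i zero))    ≡⟨ cong (λ z → tail·e′ i * (1ℚ - z)) (*-inv yi≢0) ⟩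
      tail·e′ i * 0ℚ                                  ≡⟨ *-zeroʳ (tail·e′ i) ⟩
      0ℚ                                              ∎
    ... | no i≢k = subst (λ k → y k zero * e₀ + tail·e′ k ≡ 0ℚ) (punchIn-punchOut i≢k) (begin
      y k′ zero * e₀ + tail·e′ k′
        ≡⟨ lem₂ (y k′ zero) (tail·e′ i) (inv (y i zero)) (tail·e′ k′) ⟩
      1ℚ * tail·e′ k′ + - (y k′ zero * inv (y i zero)) * tail·e′ i
        ≡⟨ dot-linˡ (y k′ ∘ suc) (y i ∘ suc) e′ 1ℚ (- (y k′ zero * inv (y i zero))) ⟨
      dot (λ j → 1ℚ * y k′ (suc j) + - (y k′ zero * inv (y i zero)) * y i (suc j)) e′
        ≡⟨ sol (punchOut i≢k) ⟩
      0ℚ ∎)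
      where
      k′ = punchIn i (punchOut i≢k)

  argmax : ∀ {m} {P : Fin m → Set} → Decidable P → (g : Fin m → ℚ) → ∃ P →
           ∃ λ i → P i × (∀ k → P k → g k ≤ g i)
  argmax {suc m} {P} P? g (i , pi) with any? (P? ∘ suc) | P? zero
  ... | no none | yes p₀ = zero , p₀ , λ where
        zero    _ → ≤-refl
        (suc k) p → contradiction (k , p) none
  ... | no none | no ¬p₀ = contradiction pi (¬P i)
    where
    ¬P : ∀ i → ¬ P i
    ¬P zero    = ¬p₀
    ¬P (suc k) p = none (k , p)
  ... | yes some | no ¬p₀ with argmax (P? ∘ suc) (g ∘ suc) some
  ...   | k , pk , mx = suc k , pk , λ where
        zero    p → contradiction p ¬p₀
        (suc l) p → mx l p
  argmax {suc m} {P} P? g _ | yes some | yes p₀ with argmax (P? ∘ suc) (g ∘ suc) some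
  ... | k , pk , mx with ≤-total (g zero) (g (suc k))
  ...   | inj₁ le = suc k , pk , λ where
        zero    p → le
        (suc l) p → mx l p
  ...   | inj₂ ge = zero , p₀ , λ where
        zero    p → ≤-refl
        (suc l) p → ≤-trans (mx l p) ge

  -- Replaces perturbation by a small amount: one multiple of a dominates b at all indices where a
  -- is negative, and nothing is claimed at the others.
  large-multiple : ∀ {m} (a b : Fin m → ℚ) →
                   ∃ λ N → 0ℚ < N × (∀ i → a i < 0ℚ → N * a i + b i < 0ℚ)
  large-multiple {zero}  a b = 1ℚ , positive⁻¹ 1ℚ , λ ()
  large-multiple {suc m} a b with large-multiple (a ∘ suc) (b ∘ suc)
  ... | N , 0<N , small = N + N₀ , <-≤-trans 0<N N≤ , bound
    where
    N₀ : ℚ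
    -- With |b| / (-a) the value N₀ a + b is at most 0, and N > 0 supplies strictness. The maximum
    -- with 0 protects the bounds already obtained when `a zero` is not negative.
    N₀ = ∣ b zero ∣ * inv (- a zero) ⊔ 0ℚ
    0≤N₀ : 0ℚ ≤ N₀
    0≤N₀ = p≤q⊔p (∣ b zero ∣ * inv (- a zero)) 0ℚ
    N≤ : N ≤ N + N₀
    N≤ = subst (_≤ N + N₀) (+-identityʳ N) (+-monoʳ-≤ N 0≤N₀)
    b≤∣b∣ : ∀ b → b ≤ ∣ b ∣
    b≤∣b∣ b with ≤-total 0ℚ b
    ... | inj₁ p = ≤-reflexive (sym (0≤p⇒∣p∣≡p p))
    ... | inj₂ p = ≤-trans p (0≤∣p∣ b)
    lem₀ : ∀ N N₀ a b i → 0ℚ - ((N + N₀) * a + b) ≡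
           N * - a + ((N₀ - b * i) * - a + b * (i * - a - 1ℚ))
    lem₀ = solve-∀ ℚ-ring
    lem₁ : ∀ N N₀ a b → 0ℚ - ((N + N₀) * a + b) ≡ (0ℚ - (N * a + b)) + N₀ * - a
    lem₁ = solve-∀ ℚ-ring
    bound : ∀ i → a i < 0ℚ → (N + N₀) * a i + b i < 0ℚ
    bound zero a<0 = 0<⇒< (subst (0ℚ <_) (sym (lem₀ N N₀ (a zero) (b zero) (inv (- a zero))))
      (0<+ (0<* 0<N 0<-a)
        (subst (0ℚ ≤_) (sym (trans (cong ((N₀ - b zero * inv (- a zero)) * - a zero +_) z) (+-identityʳ ((N₀ - b zero * inv (- a zero)) * - a zero))))
          (0≤* (≤⇒0≤ (≤-trans (*-monoʳ-≤-nonNeg (inv (- a zero)) {{nonNegative (<⇒≤ (0<inv 0<-a))}} (b≤∣b∣ (b zero)))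
                              (p≤p⊔q (∣ b zero ∣ * inv (- a zero)) 0ℚ))) (<⇒≤ 0<-a)))))
      where
      0<-a = 0<- a<0
      z : b zero * (inv (- a zero) * - a zero - 1ℚ) ≡ 0ℚ
      z = trans (cong (b zero *_) (-self (trans (*-comm (inv (- a zero)) _) (*-inv (>⇒≢ 0<-a))))) (*-zeroʳ (b zero))
    bound (suc i) a<0 = 0<⇒< (subst (0ℚ <_) (sym (lem₁ N N₀ (a (suc i)) (b (suc i))))
      (0<+ (<⇒0< (small i a<0)) (0≤* 0≤N₀ (<⇒≤ (0<- a<0)))))

  -- The ratio test of the simplex method: as t grows, the first index to reach 0 maximises a i / b
  -- i among those with b i > 0. Indices with b i ≤ 0 never become positive.
  ratio-test : ∀ {m} (a b : Fin m → ℚ) → (∀ i → a i ≤ 0ℚ) → (∃ λ i → 0ℚ < b i) →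
               ∃ λ t → 0ℚ ≤ t × (∀ i → a i + t * b i ≤ 0ℚ) × (∃ λ i → 0ℚ < b i × a i + t * b i ≡ 0ℚ)
  ratio-test a b a≤0 some with argmax (λ i → 0ℚ <? b i) (λ i → a i * inv (b i)) some
  ... | k , 0<bk , mx = t , 0≤t , bound , k , 0<bk , tight
    where
    t : ℚ
    t = - (a k * inv (b k))
    lem₁ : ∀ a i → - a * i ≡ - (a * i)
    lem₁ = solve-∀ ℚ-ring
    0≤t : 0ℚ ≤ t
    0≤t = subst (0ℚ ≤_) (lem₁ (a k) (inv (b k))) (0≤* (0≤- (a≤0 k)) (<⇒≤ (0<inv 0<bk)))
    lem₂ : ∀ a b i → a + - (a * i) * b ≡ a * (1ℚ - b * i)
    lem₂ = solve-∀ ℚ-ring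
    tight : a k + t * b k ≡ 0ℚ
    tight = trans (lem₂ (a k) (b k) (inv (b k)))
                  (trans (cong (λ z → a k * (1ℚ - z)) (*-inv (>⇒≢ 0<bk))) (*-zeroʳ (a k)))
    lem₃ : ∀ a b i r → 0ℚ - (a + - r * b) ≡ (r - a * i) * b + a * (b * i - 1ℚ)
    lem₃ = solve-∀ ℚ-ring
    lem₄ : ∀ a t b → 0ℚ - (a + t * b) ≡ - a + t * - b
    lem₄ = solve-∀ ℚ-ring
    bound : ∀ i → a i + t * b i ≤ 0ℚ
    bound i with 0ℚ <? b i
    ... | yes 0<b = 0≤⇒≤ (subst (0ℚ ≤_)
      (sym (trans (lem₃ (a i) (b i) (inv (b i)) (a k * inv (b k)))
        (trans (cong ((a k * inv (b k) - a i * inv (b i)) * b i +_)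
          (trans (cong (a i *_) (-self (*-inv (>⇒≢ 0<b)))) (*-zeroʳ (a i)))) (+-identityʳ ((a k * inv (b k) - a i * inv (b i)) * b i)))))
      (0≤* (≤⇒0≤ (mx i 0<b)) (<⇒≤ 0<b)))
    ... | no ¬0<b = 0≤⇒≤ (subst (0ℚ ≤_) (sym (lem₄ (a i) t (b i)))
      (0≤- (a≤0 i) ∙+ 0≤* 0≤t (0≤- (≮⇒≥ ¬0<b))))

-- Finite sets, subsets of given size, and exact counting.

module FinSets where

  open import Data.Bool.Base using (true; false)
  open import Data.Nat.Base using (ℕ; zero; suc; _+_)
  open import Data.Nat.Properties using (≤-antisym; suc-injective; +-comm)
  open import Data.Nat.Combinatorics using (_C_; nCk+nC[k+1]≡[n+1]C[k+1])
  open import Data.Fin.Base using (Fin; zero; suc)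
  open import Data.Fin.Properties using (injective⇒≤)
  open import Data.Fin.Subset using (Subset; _∈_; _⊆_; ∣_∣)
  open import Data.Fin.Subset.Properties using (drop-∷-⊆; out⊆; in⊆in)
  open import Data.List.Base using (List; []; _∷_; _++_; map; concat; tabulate; length; lookup)
  open import Data.List.Properties using (length-map; length-++)
  open import Data.List.Membership.Propositional using () renaming (_∈_ to _∈ˡ_)
  open import Data.List.Membership.Propositional.Properties using (∈-lookup; ∈-map⁺; ∈-map⁻; ∈-++⁺ˡ; ∈-++⁺ʳ; ∈-++⁻; ∈-concat⁺′; ∈-concat⁻′; ∈-tabulate⁺; ∈-tabulate⁻)
  open import Data.List.Relation.Unary.All as All using ([]; _∷_)
  import Data.List.Relation.Unary.All.Properties as All
  open import Data.List.Relation.Unary.AllPairs using ([]; _∷_)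
  import Data.List.Relation.Unary.AllPairs.Properties as AllPairs
  open import Data.List.Relation.Unary.Any using (here; there; index)
  open import Data.List.Relation.Unary.Any.Properties using (lookup-index)
  open import Data.List.Relation.Unary.Unique.Propositional using (Unique)
  import Data.List.Relation.Unary.Unique.Propositional.Properties as Unique
  open import Data.Vec.Base as Vec using ([]; _∷_; here; there)
  open import Data.Vec.Properties using (lookup∘tabulate; []=⇒lookup; lookup⇒[]=; ∷-injectiveʳ)

  Σℕ : ∀ {n} → (Fin n → ℕ) → ℕ
  Σℕ {zero}  f = 0
  Σℕ {suc n} f = f zero + Σℕ (f ∘ suc)

  Σℕ-cong : ∀ {n} {f g : Fin n → ℕ} → (∀ i → f i ≡ g i) → Σℕ f ≡ Σℕ g
  Σℕ-cong {zero}  e = refl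
  Σℕ-cong {suc n} e = cong₂ _+_ (e zero) (Σℕ-cong (e ∘ suc))

  module _ {m} {P : Fin m → Set} (P? : Decidable P) where

    ⟨⟩ : Subset m
    ⟨⟩ = Vec.tabulate (does ∘ P?)

    ∈⟨⟩⁺ : ∀ {i} → P i → i ∈ ⟨⟩
    ∈⟨⟩⁺ {i} p = lookup⇒[]= i _ (trans (lookup∘tabulate _ i) (dec-true (P? i) p))

    ∈⟨⟩⁻ : ∀ {i} → i ∈ ⟨⟩ → P i
    ∈⟨⟩⁻ {i} i∈ with P? i | trans (sym (lookup∘tabulate (does ∘ P?) i)) ([]=⇒lookup i∈)
    ... | yes p | _  = p
    ... | no _  | ()

  elems : ∀ {n} (s : Subset n) → Fin ∣ s ∣ → Fin n
  elems (true  ∷ s) zero    = zero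
  elems (true  ∷ s) (suc i) = suc (elems s i)
  elems (false ∷ s) i       = suc (elems s i)

  elems-∈ : ∀ {n} (s : Subset n) i → elems s i ∈ s
  elems-∈ (true  ∷ s) zero    = here
  elems-∈ (true  ∷ s) (suc i) = there (elems-∈ s i)
  elems-∈ (false ∷ s) i       = there (elems-∈ s i)

  elems-injective : ∀ {n} (s : Subset n) {i j} → elems s i ≡ elems s j → i ≡ j
  elems-injective (true  ∷ s) {zero}  {zero}  e = refl
  elems-injective (true  ∷ s) {suc i} {suc j} e =
    cong suc (elems-injective s (Data.Fin.Properties.suc-injective e))
  elems-injective (false ∷ s) e = elems-injective s (Data.Fin.Properties.suc-injective e)

  elems-surjective : ∀ {n} (s : Subset n) {p} → p ∈ s → ∃ λ i → elems s i ≡ p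
  elems-surjective (true ∷ s)  here      = zero , refl
  elems-surjective (true ∷ s)  (there q) with elems-surjective s q
  ... | i , e = suc i , cong suc e
  elems-surjective (false ∷ s) (there q) with elems-surjective s q
  ... | i , e = i , cong suc e

  subsetsOf : ∀ {n} → Subset n → ℕ → List (Subset n)
  subsetsOf []          zero    = [] ∷ []
  subsetsOf []          (suc k) = []
  subsetsOf (false ∷ T) k       = map (false ∷_) (subsetsOf T k)
  subsetsOf (true ∷ T)  zero    = map (false ∷_) (subsetsOf T zero)
  subsetsOf (true ∷ T)  (suc k) =
    map (false ∷_) (subsetsOf T (suc k)) ++ map (true ∷_) (subsetsOf T k)

  subsetsOf⁺ : ∀ {n} (T B : Subset n) {k} → B ⊆ T → ∣ B ∣ ≡ k → B ∈ˡ subsetsOf T k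
  subsetsOf⁺ []          []          B⊆T refl = here refl
  subsetsOf⁺ (false ∷ T) (false ∷ B) B⊆T e    = ∈-map⁺ (false ∷_) (subsetsOf⁺ T B (drop-∷-⊆ B⊆T) e)
  subsetsOf⁺ (false ∷ T) (true ∷ B)  B⊆T e with B⊆T here
  ... | ()
  subsetsOf⁺ (true ∷ T)  (false ∷ B) {zero}  B⊆T e = ∈-map⁺ (false ∷_) (subsetsOf⁺ T B (drop-∷-⊆ B⊆T) e)
  subsetsOf⁺ (true ∷ T)  (false ∷ B) {suc k} B⊆T e =
    ∈-++⁺ˡ (∈-map⁺ (false ∷_) (subsetsOf⁺ T B (drop-∷-⊆ B⊆T) e))
  subsetsOf⁺ (true ∷ T)  (true ∷ B)  {suc k} B⊆T e =
    ∈-++⁺ʳ (map (false ∷_) (subsetsOf T (suc k))) (∈-map⁺ (true ∷_) (subsetsOf⁺ T B (drop-∷-⊆ B⊆T) (suc-injective e)))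

  subsetsOf⁻ : ∀ {n} (T : Subset n) {B : Subset n} k → B ∈ˡ subsetsOf T k → B ⊆ T × ∣ B ∣ ≡ k
  subsetsOf⁻ []          zero    (here refl) = (λ ()) , refl
  subsetsOf⁻ (false ∷ T) k       B∈ with ∈-map⁻ (false ∷_) B∈
  ... | _ , B′∈ , refl with subsetsOf⁻ T k B′∈
  ... | B⊆T , e = out⊆ B⊆T , e
  subsetsOf⁻ (true ∷ T)  zero    B∈ with ∈-map⁻ (false ∷_) B∈
  ... | _ , B′∈ , refl with subsetsOf⁻ T zero B′∈
  ... | B⊆T , e = out⊆ B⊆T , e
  subsetsOf⁻ (true ∷ T)  (suc k) B∈ with ∈-++⁻ (map (false ∷_) (subsetsOf T (suc k))) B∈
  ... | inj₁ B∈₁ with ∈-map⁻ (false ∷_) B∈₁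
  ...   | _ , B′∈ , refl with subsetsOf⁻ T (suc k) B′∈
  ...     | B⊆T , e = out⊆ B⊆T , e
  subsetsOf⁻ (true ∷ T)  (suc k) B∈ | inj₂ B∈₂ with ∈-map⁻ (true ∷_) B∈₂
  ...   | _ , B′∈ , refl with subsetsOf⁻ T k B′∈
  ...     | B⊆T , e = in⊆in B⊆T , cong suc e

  subsetsOf-unique : ∀ {n} (T : Subset n) k → Unique (subsetsOf T k)
  subsetsOf-unique []          zero    = [] ∷ []
  subsetsOf-unique []          (suc k) = []
  subsetsOf-unique (false ∷ T) k       = Unique.map⁺ ∷-injectiveʳ (subsetsOf-unique T k)
  subsetsOf-unique (true ∷ T)  zero    = Unique.map⁺ ∷-injectiveʳ (subsetsOf-unique T zero)
  subsetsOf-unique (true ∷ T)  (suc k) =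
    Unique.++⁺ (Unique.map⁺ ∷-injectiveʳ (subsetsOf-unique T (suc k)))
               (Unique.map⁺ ∷-injectiveʳ (subsetsOf-unique T k)) disjoint
    where
    disjoint : ∀ {B} → ¬ (B ∈ˡ map (false ∷_) (subsetsOf T (suc k)) × B ∈ˡ map (true ∷_) (subsetsOf T k))
    disjoint (B∈₁ , B∈₂) with ∈-map⁻ (false ∷_) B∈₁ | ∈-map⁻ (true ∷_) B∈₂
    ... | _ , _ , refl | _ , _ , ()

  nC0≡1 : ∀ n → n C 0 ≡ 1
  nC0≡1 zero    = refl
  nC0≡1 (suc n) = refl

  length-subsetsOf : ∀ {n} (T : Subset n) k → length (subsetsOf T k) ≡ ∣ T ∣ C k
  length-subsetsOf []          zero    = refl
  length-subsetsOf []          (suc k) = refl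
  length-subsetsOf (false ∷ T) k       = trans (length-map (false ∷_) (subsetsOf T k)) (length-subsetsOf T k)
  length-subsetsOf (true ∷ T)  zero    = trans (length-map (false ∷_) (subsetsOf T zero))
    (trans (length-subsetsOf T zero) (trans (nC0≡1 ∣ T ∣) (sym (nC0≡1 (suc ∣ T ∣)))))
  length-subsetsOf (true ∷ T)  (suc k) = begin
    length (map (false ∷_) (subsetsOf T (suc k)) ++ map (true ∷_) (subsetsOf T k))
      ≡⟨ length-++ (map (false ∷_) (subsetsOf T (suc k))) ⟩
    length (map (false ∷_) (subsetsOf T (suc k))) + length (map (true ∷_) (subsetsOf T k))
      ≡⟨ cong₂ _+_ (trans (length-map (false ∷_) (subsetsOf T (suc k))) (length-subsetsOf T (suc k)))
                   (trans (length-map (true ∷_) (subsetsOf T k)) (length-subsetsOf T k)) ⟩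
    ∣ T ∣ C suc k + ∣ T ∣ C k
      ≡⟨ +-comm (∣ T ∣ C suc k) (∣ T ∣ C k) ⟩
    ∣ T ∣ C k + ∣ T ∣ C suc k
      ≡⟨ nCk+nC[k+1]≡[n+1]C[k+1] ∣ T ∣ k ⟩
    suc ∣ T ∣ C suc k ∎
    where open ≡-Reasoning

  lookup-injective : ∀ {A : Set} {xs : List A} → Unique xs → ∀ {i j} → lookup xs i ≡ lookup xs j → i ≡ j
  lookup-injective (px ∷ u) {zero}  {zero}  e = refl
  lookup-injective {xs = _ ∷ xs} (px ∷ u) {zero}  {suc j} e = contradiction e (All.lookup px (∈-lookup j))
  lookup-injective {xs = _ ∷ xs} (px ∷ u) {suc i} {zero}  e = contradiction (sym e) (All.lookup px (∈-lookup i))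
  lookup-injective (px ∷ u) {suc i} {suc j} e = cong suc (lookup-injective u e)

  module _ {m} {P : Subset m → Set} where

    HasExactly-list : (L : List (Subset m)) → Unique L → (∀ S → P S ⇔ S ∈ˡ L) → HasExactly (length L) P
    HasExactly-list L u iff = lookup L , lookup-injective u , λ S → mk⇔
      (λ p → let S∈ = Equivalence.to (iff S) p in index S∈ , sym (lookup-index S∈))
      (λ { (i , refl) → Equivalence.from (iff S) (∈-lookup i) })

    length-concat-tabulate : ∀ {M} (h : Fin M → List (Subset m)) →
      length (concat (tabulate h)) ≡ Σℕ (length ∘ h)
    length-concat-tabulate {zero}  h = refl
    length-concat-tabulate {suc M} h =
      trans (length-++ (h zero)) (cong (length (h zero) +_) (length-concat-tabulate (h ∘ suc)))

    HasExactly-concat : ∀ {M} (h : Fin M → List (Subset m)) → (∀ u → Unique (h u)) →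
      (∀ {u v S} → S ∈ˡ h u → S ∈ˡ h v → u ≡ v) → (∀ S → P S ⇔ ∃ λ u → S ∈ˡ h u) →
      HasExactly (Σℕ (length ∘ h)) P
    HasExactly-concat h uniq disj iff = subst (λ n → HasExactly n P) (length-concat-tabulate h)
      (HasExactly-list (concat (tabulate h))
        (Unique.concat⁺ (All.tabulate⁺ uniq) (AllPairs.tabulate⁺ λ u≢v (p , q) → u≢v (disj p q)))
        λ S → mk⇔
          (λ p → let u , S∈ = Equivalence.to (iff S) p in ∈-concat⁺′ S∈ (∈-tabulate⁺ u))
          (λ q → Equivalence.from (iff S) (back q)))
      where
      back : ∀ {S} → S ∈ˡ concat (tabulate h) → ∃ λ u → S ∈ˡ h u
      back q with ∈-concat⁻′ (tabulate h) q
      ... | xs , S∈ , xs∈ with ∈-tabulate⁻ xs∈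
      ... | u , refl = u , S∈

    HasExactly-≤ : ∀ {n n′} → HasExactly n P → HasExactly n′ P → n Data.Nat.Base.≤ n′
    HasExactly-≤ (F , inj , F⇔) (F′ , _ , F′⇔) = injective⇒≤ {f = g} λ {i} {j} e →
      inj (trans (sym (g-F i)) (trans (cong F′ e) (g-F j)))
      where
      P-F : ∀ i → P (F i)
      P-F i = Equivalence.from (F⇔ (F i)) (i , refl)
      g : _ → _
      g i = proj₁ (Equivalence.to (F′⇔ (F i)) (P-F i))
      g-F : ∀ i → F′ (g i) ≡ F i
      g-F i = proj₂ (Equivalence.to (F′⇔ (F i)) (P-F i))

    -- Turns two counts of the same faces into an equality of numbers, both for comparing a
    -- functional with its negative and for reading off n.
    HasExactly-functional : ∀ {n n′} → HasExactly n P → HasExactly n′ P → n ≡ n′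
    HasExactly-functional H H′ = ≤-antisym (HasExactly-≤ H H′) (HasExactly-≤ H′ H)

-- Faces through a vertex as subsets of its edges.

module Corners where

  open LinAlg
  open FinSets
  open import Data.Nat.Base as ℕ using (ℕ; zero; suc)
  import Data.Nat.Properties as ℕ
  open import Data.Nat.Combinatorics using (_C_)
  open import Data.Fin.Base using (Fin; zero; suc)
  open import Data.Fin.Properties as Fin using (all?)
  open import Data.Fin.Subset using (Subset; _∈_; _∉_; _⊆_; ∣_∣)
  open import Data.Fin.Subset.Properties using (_∈?_; ⊆-antisym)
  open import Data.List.Base using (map; length)
  open import Data.List.Properties using (length-map)
  open import Data.List.Membership.Propositional.Properties using (∈-map⁺; ∈-map⁻)
  import Data.List.Relation.Unary.Unique.Propositional.Properties as Unique
  open import Data.Vec.Functional using (_∷_)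
  open import Data.Rational hiding (∣_∣)
  open import Data.Rational.Properties
  open import Tactic.RingSolver using (solve-∀)

  dot-diff : ∀ {n} (c x y : Point n) → dot c (λ j → x j - y j) ≡ dot c x - dot c y
  dot-diff c x y = begin
    dot c (λ j → x j - y j)                 ≡⟨ Σ-cong (λ j → cong (c j *_) (lem (x j) (y j))) ⟩
    dot c (λ j → 1ℚ * x j + - 1ℚ * y j)     ≡⟨ dot-linʳ c x y 1ℚ (- 1ℚ) ⟩
    1ℚ * dot c x + - 1ℚ * dot c y           ≡⟨ lem (dot c x) (dot c y) ⟨
    dot c x - dot c y                       ∎
    where
    open ≡-Reasoning
    lem : ∀ x y → x - y ≡ 1ℚ * x + - 1ℚ * y
    lem = solve-∀ ℚ-ring

  aff-eval : ∀ {d r} (w : Fin r → Point d) (a : Fin r → ℚ) → Σℚ a ≡ 0ℚ →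
             (∀ j → Σℚ (λ i → a i * w i j) ≡ 0ℚ) →
             ∀ c b → Σℚ (λ i → a i * (b - dot c (w i))) ≡ 0ℚ
  aff-eval w a Σa≡0 Σaw≡0 c b = begin
    Σℚ (λ i → a i * (b - dot c (w i)))                   ≡⟨ Σ-cong (λ i → lem (a i) b (dot c (w i))) ⟩
    Σℚ (λ i → b * a i + - 1ℚ * (a i * dot c (w i)))      ≡⟨ Σ-+ (λ i → b * a i) (λ i → - 1ℚ * (a i * dot c (w i))) ⟩
    Σℚ (λ i → b * a i) + Σℚ (λ i → - 1ℚ * (a i * dot c (w i)))
      ≡⟨ cong₂ _+_ (Σ-* b a) (Σ-* (- 1ℚ) (λ i → a i * dot c (w i))) ⟩
    b * Σℚ a + - 1ℚ * Σℚ (λ i → a i * dot c (w i))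
      ≡⟨ cong₂ (λ u v → b * u + - 1ℚ * v) Σa≡0 (sym (dot-Σʳ c a w)) ⟩
    b * 0ℚ + - 1ℚ * dot c (λ j → Σℚ (λ i → a i * w i j))
      ≡⟨ cong (λ v → b * 0ℚ + - 1ℚ * v) (trans (Σ-cong λ j → cong (c j *_) (Σaw≡0 j)) (dot-0ʳ c)) ⟩
    b * 0ℚ + - 1ℚ * 0ℚ ≡⟨ lem₂ b ⟩
    0ℚ ∎
    where
    open ≡-Reasoning
    lem : ∀ a b x → a * (b - x) ≡ b * a + - 1ℚ * (a * x)
    lem = solve-∀ ℚ-ring
    lem₂ : ∀ b → b * 0ℚ + - 1ℚ * 0ℚ ≡ 0ℚ
    lem₂ = solve-∀ ℚ-ring

  module _ {d m} {V : Fin m → Point d} {S : Subset m} where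

    HasIndep-pred : ∀ {r} → HasIndep V S (suc r) → HasIndep V S r
    HasIndep-pred (f , f∈ , ind) = f ∘ suc , f∈ ∘ suc , λ a Σa Σaw i →
      ind (0ℚ ∷ a) (trans (+-identityˡ (Σℚ a)) Σa)
          (λ j → trans (cong (_+ Σℚ (λ i → a i * V (f (suc i)) j)) (*-zeroˡ (V (f zero) j)))
                       (trans (+-identityˡ (Σℚ (λ i → a i * V (f (suc i)) j))) (Σaw j)))
          (suc i)

    HasIndep-≤ : ∀ {r s} → r ℕ.≤ s → HasIndep V S s → HasIndep V S r
    HasIndep-≤ r≤s h = go (ℕ.≤⇒≤′ r≤s) h
      where
      go : ∀ {r s} → r ℕ.≤′ s → HasIndep V S s → HasIndep V S r
      go (ℕ.≤′-reflexive refl) h = h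
      go (ℕ.≤′-step p) h = go p (HasIndep-pred h)

    HasDim-functional : ∀ {k l} → HasDim V S k → HasDim V S l → k ≡ l
    HasDim-functional {k} {l} (hk , ¬hk) (hl , ¬hl) with ℕ.<-cmp k l
    ... | tri< k<l _ _ = contradiction (HasIndep-≤ (ℕ.s≤s k<l) hl) ¬hk
    ... | tri≈ _ e _   = e
    ... | tri> _ _ l<k = contradiction (HasIndep-≤ (ℕ.s≤s l<k) hk) ¬hl

    HasDim-nonempty : ∀ {k} → HasDim V S k → ∃ λ i → i ∈ S
    HasDim-nonempty ((f , f∈ , _) , _) = f zero , f∈ zero

  -- nb p is a further point on the p-th edge at V o, and c p · x ≤ b p is the facet inequality
  -- at V o which is strict along that edge.
  record Corner {d m} (V : Fin m → Point d) (o : Fin m) : Set where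
    field
      c  : Fin d → Point d
      b  : Fin d → ℚ
      nb : Fin d → Fin m

    e : Fin d → Fin m → ℚ
    e p i = b p - dot (c p) (V i)

    field
      e≥0    : ∀ p i → 0ℚ ≤ e p i
      e-o    : ∀ p → e p o ≡ 0ℚ
      e-nb   : ∀ p q → q ≢ p → e q (nb p) ≡ 0ℚ
      e-nb>0 : ∀ p → 0ℚ < e p (nb p)

    -- The coordinates of `V i` with respect to the edge vectors at `V o`; `coords` proves this.
    κ : Fin d → Fin m → ℚ
    κ p i = e p i * inv (e p (nb p))

    private
      e-diff : ∀ q x → dot (c q) (λ j → V x j - V o j) ≡ - e q x
      e-diff q x = begin
        dot (c q) (λ j → V x j - V o j)            ≡⟨ dot-diff (c q) (V x) (V o) ⟩
        dot (c q) (V x) - dot (c q) (V o)          ≡⟨ lem (dot (c q) (V x)) (dot (c q) (V o)) (b q) ⟩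
        - e q x + e q o                            ≡⟨ cong (- e q x +_) (e-o q) ⟩
        - e q x + 0ℚ                               ≡⟨ +-identityʳ (- e q x) ⟩
        - e q x                                    ∎
        where
        open ≡-Reasoning
        lem : ∀ x y b → x - y ≡ - (b - x) + (b - y)
        lem = solve-∀ ℚ-ring

    -- A linear relation between V i − V o and the d edge vectors exists for dimension
    -- reasons; evaluating the functionals c q on it determines its coefficients.
    coords : ∀ i j → V i j - V o j ≡ Σℚ (λ p → κ p i * (V (nb p) j - V o j))
    coords i j with nonzero-solution (λ j → (V i j - V o j) ∷ λ p → V (nb p) j - V o j) ℕ.≤-refl
    ... | a , (t , at≢0) , sol = -≡0 (*-cancel-0 a₀≢0 (begin
        a zero * (W zero j - Σℚ (λ p → κ p i * W (suc p) j))
          ≡⟨ lem₁ (a zero) (W zero j) (Σℚ (λ p → κ p i * W (suc p) j)) ⟩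
        a zero * W zero j + - a zero * Σℚ (λ p → κ p i * W (suc p) j)
          ≡⟨ cong (a zero * W zero j +_) (trans (sym (Σ-* (- a zero) (λ p → κ p i * W (suc p) j)))
               (Σ-cong λ p → trans (sym (*-assoc (- a zero) (κ p i) (W (suc p) j)))
                                   (cong (_* W (suc p) j) (sym (coeff p))))) ⟩
        Σℚ (λ t → a t * W t j)
          ≡⟨ rel j ⟩
        0ℚ ∎))
      where
      open ≡-Reasoning
      W : Fin (suc d) → Point d
      W zero    j = V i j - V o j
      W (suc p) j = V (nb p) j - V o j
      rel : ∀ j → Σℚ (λ t → a t * W t j) ≡ 0ℚ
      rel j = trans (cong₂ _+_ (*-comm (a zero) (V i j - V o j))
                       (Σ-cong λ p → *-comm (a (suc p)) (V (nb p) j - V o j))) (sol j)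
      lem₁ : ∀ a w s → a * (w - s) ≡ a * w + - a * s
      lem₁ = solve-∀ ℚ-ring
      lem₂ : ∀ a x b y → a * x + b * y ≡ - (a * - x + b * - y)
      lem₂ = solve-∀ ℚ-ring
      rel-e : ∀ q → a zero * e q i + a (suc q) * e q (nb q) ≡ 0ℚ
      rel-e q = begin
        a zero * e q i + a (suc q) * e q (nb q)
          ≡⟨ lem₂ (a zero) (e q i) (a (suc q)) (e q (nb q)) ⟩
        - (a zero * - e q i + a (suc q) * - e q (nb q))
          ≡⟨ cong (λ z → - (a zero * - e q i + z)) (Σ-single q λ p p≢q →
               trans (cong (λ z → a (suc p) * - z) (e-nb p q (p≢q ∘ sym))) (*-zeroʳ (a (suc p)))) ⟨
        - (a zero * - e q i + Σℚ (λ p → a (suc p) * - e q (nb p)))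
          ≡⟨ cong -_ (cong₂ _+_ (cong (a zero *_) (e-diff q i)) (Σ-cong λ p → cong (a (suc p) *_) (e-diff q (nb p)))) ⟨
        - Σℚ (λ t → a t * dot (c q) (W t))
          ≡⟨ cong -_ (dot-Σʳ (c q) a W) ⟨
        - dot (c q) (λ j → Σℚ (λ t → a t * W t j))
          ≡⟨ cong -_ (trans (Σ-cong λ j → cong (c q j *_) (rel j)) (dot-0ʳ (c q))) ⟩
        0ℚ ∎
      coeff : ∀ p → a (suc p) ≡ - a zero * κ p i
      coeff p = -≡0 (begin
        a (suc p) - - a zero * κ p i
          ≡⟨ lem (a (suc p)) (a zero) (e p i) (inv (e p (nb p))) (e p (nb p)) ⟩
        (a zero * e p i + a (suc p) * e p (nb p)) * inv (e p (nb p)) + a (suc p) * (1ℚ - e p (nb p) * inv (e p (nb p)))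
          ≡⟨ cong₂ (λ u v → u * inv (e p (nb p)) + a (suc p) * (1ℚ - v)) (rel-e p) (*-inv (>⇒≢ (e-nb>0 p))) ⟩
        0ℚ * inv (e p (nb p)) + a (suc p) * 0ℚ
          ≡⟨ lem₀ (inv (e p (nb p))) (a (suc p)) ⟩
        0ℚ ∎)
        where
        lem : ∀ s z x i y → s - - z * (x * i) ≡ (z * x + s * y) * i + s * (1ℚ - y * i)
        lem = solve-∀ ℚ-ring
        lem₀ : ∀ i s → 0ℚ * i + s * 0ℚ ≡ 0ℚ
        lem₀ = solve-∀ ℚ-ring
      a₀≢0 : a zero ≢ 0ℚ
      a₀≢0 a₀≡0 = at≢0 (all0 t)
        where
        all0 : ∀ t → a t ≡ 0ℚ
        all0 zero    = a₀≡0
        all0 (suc p) = trans (coeff p) (trans (cong (λ z → - z * κ p i) a₀≡0) (*-zeroˡ (κ p i)))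

    dot-coords : ∀ (φ : Point d) i →
                 dot φ (V i) - dot φ (V o) ≡ Σℚ (λ p → κ p i * (dot φ (V (nb p)) - dot φ (V o)))
    dot-coords φ i = begin
      dot φ (V i) - dot φ (V o)       ≡⟨ dot-diff φ (V i) (V o) ⟨
      dot φ (λ j → V i j - V o j)     ≡⟨ Σ-cong (λ j → cong (φ j *_) (coords i j)) ⟩
      dot φ (λ j → Σℚ (λ p → κ p i * (V (nb p) j - V o j)))
        ≡⟨ dot-Σʳ φ (λ p → κ p i) (λ p j → V (nb p) j - V o j) ⟩
      Σℚ (λ p → κ p i * dot φ (λ j → V (nb p) j - V o j))
        ≡⟨ Σ-cong (λ p → cong (κ p i *_) (dot-diff φ (V (nb p)) (V o))) ⟩
      Σℚ (λ p → κ p i * (dot φ (V (nb p)) - dot φ (V o))) ∎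
      where open ≡-Reasoning

    κ≥0 : ∀ p i → 0ℚ ≤ κ p i
    κ≥0 p i = 0≤* (e≥0 p i) (<⇒≤ (0<inv (e-nb>0 p)))

    κ≡0 : ∀ {p i} → e p i ≡ 0ℚ → κ p i ≡ 0ℚ
    κ≡0 {p} z = trans (cong (_* inv (e p (nb p))) z) (*-zeroˡ (inv (e p (nb p))))

    -- B is the set of edges at V o which lie in the face.
    OnFace : Subset d → Fin m → Set
    OnFace B i = ∀ p → p ∉ B → e p i ≡ 0ℚ

    OnFace? : ∀ B → Decidable (OnFace B)
    OnFace? B i = all? (λ p → ¬? (p ∈? B) →-dec (e p i ≟ 0ℚ))

    face : Subset d → Subset m
    face B = ⟨⟩ (OnFace? B)

    trace : Subset m → Subset d
    trace S = ⟨⟩ (λ p → nb p ∈? S)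

    o∈face : ∀ B → o ∈ face B
    o∈face B = ∈⟨⟩⁺ (OnFace? B) (λ p _ → e-o p)

    nb∈face⁺ : ∀ {B p} → p ∈ B → nb p ∈ face B
    nb∈face⁺ {B} {p} p∈B = ∈⟨⟩⁺ (OnFace? B) λ q q∉B → e-nb p q λ { refl → q∉B p∈B }

    nb∈face⁻ : ∀ {B p} → nb p ∈ face B → p ∈ B
    nb∈face⁻ {B} {p} nb∈ with p ∈? B
    ... | yes p∈B = p∈B
    ... | no p∉B  = contradiction (∈⟨⟩⁻ (OnFace? B) nb∈ p p∉B) (>⇒≢ (e-nb>0 p))

    trace-face : ∀ B → trace (face B) ≡ B
    trace-face B = ⊆-antisym (λ p∈ → nb∈face⁻ (∈⟨⟩⁻ (λ p → nb p ∈? face B) p∈))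
                             (λ p∈ → ∈⟨⟩⁺ (λ p → nb p ∈? face B) (nb∈face⁺ p∈))

    -- Adding the corner inequalities of the edges outside B gives a functional whose slack is a sum
    -- of nonnegative terms, hence zero exactly where all of them vanish.
    face-isFace : ∀ B → IsFace V (face B)
    face-isFace B = c′ , b′ , (λ i → 0≤⇒≤ (subst (0ℚ ≤_) (sym (gap i)) (Σ-nonNeg (term≥0 i)))) , λ i → mk⇔
      (λ i∈ → sym (-≡0 (trans (gap i) (Σ-0 λ p → term≡0 p i (∈⟨⟩⁻ (OnFace? B) i∈ p)))))
      (λ eq → ∈⟨⟩⁺ (OnFace? B) λ p p∉B → on p i p∉B
        (Σ≡0⇒ (term≥0 i) (trans (sym (gap i)) (-self (sym eq))) p))
      where
      open ≡-Reasoning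
      a : Fin d → ℚ
      a p with p ∈? B
      ... | yes _ = 0ℚ
      ... | no _  = 1ℚ
      c′ : Point d
      c′ j = Σℚ (λ p → a p * c p j)
      b′ : ℚ
      b′ = Σℚ (λ p → a p * b p)
      lem : ∀ a b x → a * (b - x) ≡ a * b + - 1ℚ * (a * x)
      lem = solve-∀ ℚ-ring
      lem₂ : ∀ x → - 1ℚ * x ≡ - x
      lem₂ = solve-∀ ℚ-ring
      gap : ∀ i → b′ - dot c′ (V i) ≡ Σℚ (λ p → a p * e p i)
      gap i = sym (begin
        Σℚ (λ p → a p * e p i)
          ≡⟨ Σ-cong (λ p → lem (a p) (b p) (dot (c p) (V i))) ⟩
        Σℚ (λ p → a p * b p + - 1ℚ * (a p * dot (c p) (V i)))
          ≡⟨ Σ-+ (λ p → a p * b p) (λ p → - 1ℚ * (a p * dot (c p) (V i))) ⟩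
        b′ + Σℚ (λ p → - 1ℚ * (a p * dot (c p) (V i)))
          ≡⟨ cong (b′ +_) (trans (Σ-* (- 1ℚ) (λ p → a p * dot (c p) (V i))) (lem₂ _)) ⟩
        b′ - Σℚ (λ p → a p * dot (c p) (V i))
          ≡⟨ cong (λ z → b′ - z) (dot-Σˡ a c (V i)) ⟨
        b′ - dot c′ (V i) ∎)
      term≥0 : ∀ i p → 0ℚ ≤ a p * e p i
      term≥0 i p with p ∈? B
      ... | yes _ = ≤-reflexive (sym (*-zeroˡ (e p i)))
      ... | no _  = subst (0ℚ ≤_) (sym (*-identityˡ (e p i))) (e≥0 p i)
      term≡0 : ∀ p i → (p ∉ B → e p i ≡ 0ℚ) → a p * e p i ≡ 0ℚ
      term≡0 p i z with p ∈? B
      ... | yes _   = *-zeroˡ (e p i)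
      ... | no p∉B  = trans (*-identityˡ (e p i)) (z p∉B)
      on : ∀ p i → p ∉ B → a p * e p i ≡ 0ℚ → e p i ≡ 0ℚ
      on p i p∉B z with p ∈? B
      ... | yes p∈B = contradiction p∈B p∉B
      ... | no _    = trans (sym (*-identityˡ (e p i))) z

    -- The slack at i of a functional exposing S is the sum of the slacks at the `nb p` with weights
    -- κ p i ≥ 0. It vanishes exactly when κ p i = 0 for every edge p that leaves S.
    face-trace : ∀ {S} → IsFace V S → o ∈ S → face (trace S) ≡ S
    face-trace {S} (c′ , b′ , le , iff) o∈S = ⊆-antisym fwd bwd
      where
      open ≡-Reasoning
      g : Fin m → ℚ
      g i = dot c′ (V o) - dot c′ (V i)
      b′≡ : dot c′ (V o) ≡ b′
      b′≡ = Equivalence.to (iff o) o∈S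
      g≥0 : ∀ i → 0ℚ ≤ g i
      g≥0 i = ≤⇒0≤ (subst (dot c′ (V i) ≤_) (sym b′≡) (le i))
      g≡0⇒ : ∀ {i} → g i ≡ 0ℚ → i ∈ S
      g≡0⇒ {i} z = Equivalence.from (iff i) (trans (sym (-≡0 z)) b′≡)
      ⇒g≡0 : ∀ {i} → i ∈ S → g i ≡ 0ℚ
      ⇒g≡0 {i} i∈S = -self (trans b′≡ (sym (Equivalence.to (iff i) i∈S)))
      lem : ∀ x y → y - x ≡ - (x - y)
      lem = solve-∀ ℚ-ring
      lem₂ : ∀ k x y → k * (x - y) ≡ - 1ℚ * (k * (y - x))
      lem₂ = solve-∀ ℚ-ring
      lem₃ : ∀ x → - (- 1ℚ * x) ≡ x
      lem₃ = solve-∀ ℚ-ring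
      g-sum : ∀ i → g i ≡ Σℚ (λ p → κ p i * g (nb p))
      g-sum i = begin
        g i ≡⟨ lem (dot c′ (V i)) (dot c′ (V o)) ⟩
        - (dot c′ (V i) - dot c′ (V o)) ≡⟨ cong -_ (dot-coords c′ i) ⟩
        - Σℚ (λ p → κ p i * (dot c′ (V (nb p)) - dot c′ (V o)))
          ≡⟨ cong -_ (trans (Σ-cong λ p → lem₂ (κ p i) (dot c′ (V (nb p))) (dot c′ (V o))) (Σ-* (- 1ℚ) (λ p → κ p i * g (nb p)))) ⟩
        - (- 1ℚ * Σℚ (λ p → κ p i * g (nb p))) ≡⟨ lem₃ _ ⟩
        Σℚ (λ p → κ p i * g (nb p)) ∎
      fwd : face (trace S) ⊆ S
      fwd {i} i∈ = g≡0⇒ (trans (g-sum i) (Σ-0 term))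
        where
        term : ∀ p → κ p i * g (nb p) ≡ 0ℚ
        term p with nb p ∈? S
        ... | yes nb∈S = trans (cong (κ p i *_) (⇒g≡0 nb∈S)) (*-zeroʳ (κ p i))
        ... | no nb∉S  = trans (cong (_* g (nb p)) (κ≡0 (∈⟨⟩⁻ (OnFace? (trace S)) i∈ p
                           λ p∈ → nb∉S (∈⟨⟩⁻ (λ p → nb p ∈? S) p∈)))) (*-zeroˡ (g (nb p)))
      bwd : S ⊆ face (trace S)
      bwd {i} i∈ = ∈⟨⟩⁺ (OnFace? (trace S)) λ p p∉ →
        *-cancel-0 (>⇒≢ (0<inv (e-nb>0 p))) (trans (*-comm (inv (e p (nb p))) (e p i))
          (*-cancel-0 (λ z → p∉ (∈⟨⟩⁺ (λ p → nb p ∈? S) (g≡0⇒ z)))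
            (trans (*-comm (g (nb p)) (κ p i))
              (Σ≡0⇒ (λ p → 0≤* (κ≥0 p i) (g≥0 (nb p))) (trans (sym (g-sum i)) (⇒g≡0 i∈)) p))))

    -- The point `V o` and the neighbours along B are independent because the matrix of values e q
    -- (nb p) is diagonal.
    face-dim : ∀ B → HasDim V (face B) ∣ B ∣
    face-dim B = (f , f∈ , indep) , dependent
      where
      open ≡-Reasoning
      f : Fin (suc ∣ B ∣) → Fin m
      f zero    = o
      f (suc t) = nb (elems B t)
      f∈ : ∀ i → f i ∈ face B
      f∈ zero    = o∈face B
      f∈ (suc t) = nb∈face⁺ (elems-∈ B t)
      indep : AffIndep (V ∘ f)
      indep a Σa Σaw = λ where
          zero    → trans (sym (trans (cong (a zero +_) (Σ-0 a-suc)) (+-identityʳ (a zero)))) Σa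
          (suc t) → a-suc t
        where
        a-suc : ∀ t → a (suc t) ≡ 0ℚ
        a-suc t = *-cancel-0 (>⇒≢ (e-nb>0 p)) (trans (*-comm (e p (nb p)) (a (suc t))) (begin
          a (suc t) * e p (nb p)
            ≡⟨ Σ-single t (λ s s≢t → trans (cong (a (suc s) *_) (e-nb (elems B s) p
                 λ eq → s≢t (sym (elems-injective B eq)))) (*-zeroʳ (a (suc s)))) ⟨
          Σℚ (λ s → a (suc s) * e p (nb (elems B s)))
            ≡⟨ +-identityˡ _ ⟨
          0ℚ + Σℚ (λ s → a (suc s) * e p (nb (elems B s)))
            ≡⟨ cong (_+ Σℚ (λ s → a (suc s) * e p (nb (elems B s)))) (trans (cong (a zero *_) (e-o p)) (*-zeroʳ (a zero))) ⟨
          Σℚ (λ i → a i * e p (f i))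
            ≡⟨ aff-eval (V ∘ f) a Σa Σaw (c p) (b p) ⟩
          0ℚ ∎))
          where p = elems B t
      -- There are |B| + 1 equations for |B| + 2 unknowns: the coefficient sum, and e p for p in B.
      -- The other e p vanish on the face, so by `coords` the solution is an affine dependence.
      dependent : ¬ HasIndep V (face B) (suc (suc ∣ B ∣))
      dependent (h , h∈ , ind)
        with nonzero-solution ((λ _ → 1ℚ) ∷ λ t i → e (elems B t) (h i)) ℕ.≤-refl
      ... | a , (t , at≢0) , sol = at≢0 (ind a Σa Σaw t)
        where
        Σa : Σℚ a ≡ 0ℚ
        Σa = trans (Σ-cong λ i → sym (*-identityˡ (a i))) (sol zero)
        Σe : ∀ p → Σℚ (λ i → e p (h i) * a i) ≡ 0ℚ
        Σe p with p ∈? B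
        ... | no p∉B = Σ-0 λ i → trans (cong (_* a i) (∈⟨⟩⁻ (OnFace? B) (h∈ i) p p∉B)) (*-zeroˡ (a i))
        ... | yes p∈B with elems-surjective B p∈B
        ...   | s , refl = sol (suc s)
        lem : ∀ a x y → a * x ≡ y * a + a * (x - y)
        lem = solve-∀ ℚ-ring
        lem₂ : ∀ a e i D → a * (e * i * D) ≡ i * D * (e * a)
        lem₂ = solve-∀ ℚ-ring
        Σaw : ∀ j → Σℚ (λ i → a i * V (h i) j) ≡ 0ℚ
        Σaw j = begin
          Σℚ (λ i → a i * V (h i) j)
            ≡⟨ Σ-cong (λ i → lem (a i) (V (h i) j) (V o j)) ⟩
          Σℚ (λ i → V o j * a i + a i * (V (h i) j - V o j))
            ≡⟨ Σ-+ (λ i → V o j * a i) (λ i → a i * (V (h i) j - V o j)) ⟩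
          Σℚ (λ i → V o j * a i) + Σℚ (λ i → a i * (V (h i) j - V o j))
            ≡⟨ cong₂ _+_ (trans (Σ-* (V o j) a) (trans (cong (V o j *_) Σa) (*-zeroʳ (V o j)))) second ⟩
          0ℚ + 0ℚ ≡⟨ +-identityˡ 0ℚ ⟩
          0ℚ ∎
          where
          D : Fin d → ℚ
          D p = V (nb p) j - V o j
          r : Fin d → ℚ
          r p = inv (e p (nb p))
          second : Σℚ (λ i → a i * (V (h i) j - V o j)) ≡ 0ℚ
          second = begin
            Σℚ (λ i → a i * (V (h i) j - V o j))
              ≡⟨ Σ-cong (λ i → trans (cong (a i *_) (coords (h i) j))
                   (trans (sym (Σ-* (a i) (λ p → κ p (h i) * D p))) (Σ-cong λ p → lem₂ (a i) (e p (h i)) (r p) (D p)))) ⟩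
            Σℚ (λ i → Σℚ (λ p → r p * D p * (e p (h i) * a i)))
              ≡⟨ Σ-swap (λ i p → r p * D p * (e p (h i) * a i)) ⟩
            Σℚ (λ p → Σℚ (λ i → r p * D p * (e p (h i) * a i)))
              ≡⟨ Σ-0 (λ p → trans (Σ-* (r p * D p) (λ i → e p (h i) * a i))
                   (trans (cong (r p * D p *_) (Σe p)) (*-zeroʳ (r p * D p)))) ⟩
            0ℚ ∎

    face-KFace : ∀ B → KFace V ∣ B ∣ (face B)
    face-KFace B = face-isFace B , face-dim B

    dim-trace : ∀ {S k} → KFace V k S → o ∈ S → ∣ trace S ∣ ≡ k
    dim-trace {S} (isF , dim) o∈S = HasDim-functional {V = V}
      (subst (λ z → HasDim V z ∣ trace S ∣) (face-trace isF o∈S) (face-dim (trace S))) dim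

  -- For T u the edges descending from vt u with respect to a generic functional, own and unique
  -- say that each face has exactly one highest vertex.
  record Shelled {d m} (V : Fin m → Point d) : Set where
    field
      M      : ℕ
      vt     : Fin M → Fin m
      corner : ∀ u → Corner V (vt u)
      T      : Fin M → Subset d
    open module C u = Corner (corner u) using (face; trace; face-trace; trace-face; o∈face; face-isFace; face-KFace; dim-trace)

    field
      own    : ∀ {S i} → IsFace V S → i ∈ S → ∃ λ u → vt u ∈ S × trace u S ⊆ T u
      unique : ∀ {S u v} → IsFace V S → vt u ∈ S → trace u S ⊆ T u → vt v ∈ S → trace v S ⊆ T v → u ≡ v

    -- Each face is charged to its owner u, where it becomes a subset of T u whose size is the
    -- dimension.
    count-faces : ∀ k → HasExactly (Σℕ (λ u → ∣ T u ∣ C k)) (KFace V k)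
    count-faces k = subst (λ n → HasExactly n (KFace V k)) (Σℕ-cong len)
      (HasExactly-concat h
        (λ u → Unique.map⁺ (λ {B} {B′} eq → trans (sym (trace-face u B)) (trans (cong (trace u) eq) (trace-face u B′)))
                 (subsetsOf-unique (T u) k))
        (λ p q → let isF , o∈ , ⊆T , _ = inside p ; _ , o∈′ , ⊆T′ , _ = inside q in
                 unique isF o∈ ⊆T o∈′ ⊆T′)
        λ S → mk⇔ (λ kf → fwd kf) (λ (u , S∈) → proj₂ (proj₂ (proj₂ (inside S∈)))))
      where
      h : ∀ u → _
      h u = map (face u) (subsetsOf (T u) k)
      len : ∀ u → length (h u) ≡ ∣ T u ∣ C k
      len u = trans (length-map (face u) (subsetsOf (T u) k)) (length-subsetsOf (T u) k)
      open import Data.List.Membership.Propositional using () renaming (_∈_ to _∈ˡ_)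
      inside : ∀ {u S} → S ∈ˡ h u → IsFace V S × vt u ∈ S × trace u S ⊆ T u × KFace V k S
      inside {u} S∈ with ∈-map⁻ (face u) S∈
      ... | B , B∈ , refl with subsetsOf⁻ (T u) k B∈
      ... | B⊆T , refl = face-isFace u B , o∈face u B , subst (_⊆ T u) (sym (trace-face u B)) B⊆T , face-KFace u B
      fwd : ∀ {S} → KFace V k S → ∃ λ u → S ∈ˡ h u
      fwd {S} kf@(isF , dim) with own isF (proj₂ (HasDim-nonempty {V = V} dim))
      ... | u , o∈ , ⊆T = u , subst (_∈ˡ h u) (face-trace u isF o∈)
        (∈-map⁺ (face u) (subsetsOf⁺ (T u) (trace u S) ⊆T (dim-trace u kf o∈)))

-- The normal cone at a vertex, and corners from simplicity.

module VertexCones where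

  open LinAlg
  open FinSets
  open Corners
  open import Data.Nat.Base as ℕ using (ℕ; zero; suc; s≤s)
  import Data.Nat.Properties as ℕ
  open import Data.Fin.Base using (Fin; zero; suc; punchIn; punchOut)
  open import Data.Fin.Properties as Fin using (any?; all?; punchIn-punchOut)
  open import Data.Fin.Subset using (Subset; _∈_; _⊆_; ∣_∣; ⊤)
  open import Data.Fin.Subset.Properties using (∣p∣≤n; p⊂q⇒∣p∣<∣q∣)
  open import Data.Vec.Functional using (_∷_)
  open import Data.Rational hiding (∣_∣)
  open import Data.Rational.Properties
  open import Tactic.RingSolver using (solve-∀)

  ¬∃≢0⇒≡0 : ∀ {m} {f : Fin m → ℚ} → ¬ (∃ λ i → f i ≢ 0ℚ) → ∀ i → f i ≡ 0ℚ
  ¬∃≢0⇒≡0 {f = f} none i = decidable-stable (f i ≟ 0ℚ) λ ne → none (i , ne)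

  -- If e j were nonzero, the coefficient sum and the coordinates other than j would give d
  -- equations for d + 1 unknowns. Applying e to a solution annihilates coordinate j as well,
  -- against independence.
  constant⇒zero : ∀ {d} (w : Fin (suc d) → Point d) → AffIndep w →
                  ∀ (e : Point d) β → (∀ i → dot e (w i) ≡ β) → ∀ j → e j ≡ 0ℚ
  constant⇒zero {suc d} w ind e β const j with e j ≟ 0ℚ
  ... | yes p = p
  ... | no ej≢0 with nonzero-solution ((λ _ → 1ℚ) ∷ λ l i → w i (punchIn j l)) ℕ.≤-refl
  ...   | a , (t , at≢0) , sol = contradiction (ind a Σa X≡0 t) at≢0
    where
    open ≡-Reasoning
    Σa : Σℚ a ≡ 0ℚ
    Σa = trans (Σ-cong λ i → sym (*-identityˡ (a i))) (sol zero)
    X : Fin (suc d) → ℚ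
    X l = Σℚ (λ i → a i * w i l)
    X-other : ∀ l → l ≢ j → X l ≡ 0ℚ
    X-other l l≢j = subst (λ l → X l ≡ 0ℚ) (punchIn-punchOut (l≢j ∘ sym))
      (trans (Σ-cong λ i → *-comm (a i) (w i (punchIn j (punchOut (l≢j ∘ sym))))) (sol (suc (punchOut (l≢j ∘ sym)))))
    X≡0 : ∀ l → X l ≡ 0ℚ
    X≡0 l with l Fin.≟ j
    ... | no l≢j   = X-other l l≢j
    ... | yes refl = *-cancel-0 ej≢0 (begin
      e l * X l                      ≡⟨ Σ-single l (λ q q≢l → trans (cong (e q *_) (X-other q q≢l)) (*-zeroʳ (e q))) ⟨
      dot e X                        ≡⟨ dot-Σʳ e a w ⟩
      Σℚ (λ i → a i * dot e (w i))   ≡⟨ Σ-cong (λ i → trans (cong (a i *_) (const i)) (*-comm (a i) β)) ⟩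
      Σℚ (λ i → β * a i)             ≡⟨ Σ-* β a ⟩
      β * Σℚ a                       ≡⟨ cong (β *_) Σa ⟩
      β * 0ℚ                         ≡⟨ *-zeroʳ β ⟩
      0ℚ                             ∎)

  module Cone {n m} (V : Fin m → Point (suc n)) (full : HasIndep V ⊤ (suc (suc n))) (o : Fin m) where

    g : Point (suc n) → Fin m → ℚ
    g c i = dot c (V i) - dot c (V o)

    g-o : ∀ c → g c o ≡ 0ℚ
    g-o c = +-inverseʳ (dot c (V o))

    g≡0⇒ : ∀ c i → g c i ≡ 0ℚ → dot c (V i) ≡ dot c (V o)
    g≡0⇒ c i = -≡0 {dot c (V i)} {dot c (V o)}

    ⇒g≡0 : ∀ c i → dot c (V i) ≡ dot c (V o) → g c i ≡ 0ℚ
    ⇒g≡0 c i = -self {dot c (V i)} {dot c (V o)}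

    orth⇒g≡0 : ∀ c i → dot (λ j → V i j - V o j) c ≡ 0ℚ → g c i ≡ 0ℚ
    orth⇒g≡0 c i z = trans (sym (dot-diff c (V i) (V o))) (trans (dot-comm c (λ j → V i j - V o j)) z)

    lin : ℚ → Point (suc n) → ℚ → Point (suc n) → Point (suc n)
    lin a c b d j = a * c j + b * d j

    g-lin : ∀ a c b d i → g (lin a c b d) i ≡ a * g c i + b * g d i
    g-lin a c b d i = trans (cong₂ _-_ (dot-linˡ c d (V i) a b) (dot-linˡ c d (V o) a b))
      (lem a b (dot c (V i)) (dot d (V i)) (dot c (V o)) (dot d (V o)))
      where
      lem : ∀ a b x y z w → a * x + b * y - (a * z + b * w) ≡ a * (x - z) + b * (y - w)
      lem = solve-∀ ℚ-ring

    g≡0⇒zero : ∀ e → (∀ i → g e i ≡ 0ℚ) → ∀ j → e j ≡ 0ℚ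
    g≡0⇒zero e z = constant⇒zero (V ∘ proj₁ full) (proj₂ (proj₂ full)) e (dot e (V o)) λ i → g≡0⇒ e (proj₁ full i) (z (proj₁ full i))

    Normal : Point (suc n) → Set
    Normal c = ∀ i → g c i ≤ 0ℚ

    Zero? : ∀ c → Decidable (λ i → g c i ≡ 0ℚ)
    Zero? c i = g c i ≟ 0ℚ

    Z : Point (suc n) → Subset m
    Z c = ⟨⟩ (Zero? c)

    o∈Z : ∀ c → o ∈ Z c
    o∈Z c = ∈⟨⟩⁺ (Zero? c) (g-o c)

    Z-isFace : ∀ c → Normal c → IsFace V (Z c)
    Z-isFace c nc = c , dot c (V o) , (λ i → 0≤⇒≤ (subst (0ℚ ≤_) (lem (dot c (V i)) (dot c (V o))) (0≤- (nc i)))) ,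
      λ i → mk⇔ (λ i∈ → g≡0⇒ c i (∈⟨⟩⁻ (Zero? c) i∈)) (λ e → ∈⟨⟩⁺ (Zero? c) (⇒g≡0 c i e))
      where
      lem : ∀ x y → - (x - y) ≡ y - x
      lem = solve-∀ ℚ-ring

    -- The termination measure of the cone arguments: a zero set has at most m elements, and `fuel`
    -- bounds what it can still gain.
    Z-grows : ∀ c c′ → (∀ i → g c i ≡ 0ℚ → g c′ i ≡ 0ℚ) → (∃ λ k → g c k ≢ 0ℚ × g c′ k ≡ 0ℚ) → ∣ Z c ∣ ℕ.< ∣ Z c′ ∣
    Z-grows c c′ sub (k , k∉ , k∈) = p⊂q⇒∣p∣<∣q∣
      ( (λ i∈ → ∈⟨⟩⁺ (Zero? c′) (sub _ (∈⟨⟩⁻ (Zero? c) i∈)))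
      , k , ∈⟨⟩⁺ (Zero? c′) k∈ , λ k∈Z → k∉ (∈⟨⟩⁻ (Zero? c) k∈Z))

    Z-full : ∀ c → m ℕ.≤ ∣ Z c ∣ → ∀ i → g c i ≡ 0ℚ
    Z-full c m≤ i = ∈⟨⟩⁻ (Zero? c) (subst (i ∈_) (sym (∣p∣≡n⇒p≡⊤ (ℕ.≤-antisym (∣p∣≤n (Z c)) m≤))) ∈⊤)
      where open import Data.Fin.Subset.Properties using (∣p∣≡n⇒p≡⊤; ∈⊤)

    -- Grow an affinely independent family in Z c; as long as it is too small, some nonzero
    -- functional vanishes on it and at i₀, and either vanishes on all of Z c or extends the family.
    annihilator-or-indep : ∀ c i₀ r → suc r ℕ.≤ suc n →
      (∃ λ e → NonZeroVec e × g e i₀ ≡ 0ℚ × (∀ i → g c i ≡ 0ℚ → g e i ≡ 0ℚ)) ⊎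
      (∃ λ (f : Fin r → Fin m) → (∀ k → g c (f k) ≡ 0ℚ) × AffIndep (V ∘ (o ∷ f)))
    annihilator-or-indep c i₀ zero _ = inj₂ ((λ ()) , (λ ()) , λ where
      a Σa _ zero → trans (sym (+-identityʳ (a zero))) Σa)
    annihilator-or-indep c i₀ (suc r) (s≤s r<n) with annihilator-or-indep c i₀ r (ℕ.≤-trans r<n (ℕ.n≤1+n n))
    ... | inj₁ found = inj₁ found
    ... | inj₂ (f , f∈ , ind) with nonzero-solution (λ k j → V ((i₀ ∷ f) k) j - V o j) (s≤s r<n)
    ...   | e , e≢0 , sol with any? (λ i → (g c i ≟ 0ℚ) ×-dec ¬? (g e i ≟ 0ℚ))
    ...     | no none = inj₁ (e , e≢0 , orth⇒g≡0 e i₀ (sol zero) , λ i ci → decidable-stable (g e i ≟ 0ℚ) λ ne → none (i , ci , ne))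
    ...     | yes (i , ci , gei≢0) = inj₂ (i ∷ f , (λ { zero → ci ; (suc k) → f∈ k }) , ind′)
      where
      open ≡-Reasoning
      ind′ : AffIndep (V ∘ (o ∷ i ∷ f))
      ind′ a Σa Σaw = λ where
          zero          → rest zero
          (suc zero)    → a₁≡0
          (suc (suc k)) → rest (suc k)
        where
        lem : ∀ a x y → a * (x - y) ≡ - (a * (y - x))
        lem = solve-∀ ℚ-ring
        lem₂ : ∀ x y z → x + (y + z) ≡ y + (x + z)
        lem₂ = solve-∀ ℚ-ring
        h : Fin (suc (suc r)) → Fin m
        h = o ∷ i ∷ f
        term : ∀ k → k ≢ suc zero → a k * (dot e (V o) - dot e (V (h k))) ≡ 0ℚ
        term k k≢1 = trans (lem (a k) (dot e (V o)) (dot e (V (h k))))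
          (cong -_ (trans (cong (a k *_) (gz k k≢1)) (*-zeroʳ (a k))))
          where
          gz : ∀ k → k ≢ suc zero → g e (h k) ≡ 0ℚ
          gz zero          _   = g-o e
          gz (suc zero)    k≢1 = contradiction refl k≢1
          gz (suc (suc k)) _   = orth⇒g≡0 e (f k) (sol (suc k))
        a₁≡0 : a (suc zero) ≡ 0ℚ
        a₁≡0 = *-cancel-0 (λ z → gei≢0 (trans (lem₃ (dot e (V i)) (dot e (V o))) (cong -_ z)))
          (trans (*-comm (dot e (V o) - dot e (V i)) (a (suc zero)))
            (trans (sym (Σ-single (suc zero) term)) (aff-eval (V ∘ h) a Σa Σaw e (dot e (V o)))))
          where
          lem₃ : ∀ x y → x - y ≡ - (y - x)
          lem₃ = solve-∀ ℚ-ring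
        a′ : Fin (suc r) → ℚ
        a′ = a zero ∷ λ k → a (suc (suc k))
        drop₁ : ∀ (x : Fin (suc (suc r)) → ℚ) → x (suc zero) ≡ 0ℚ →
                x zero + Σℚ (λ k → x (suc (suc k))) ≡ Σℚ x
        drop₁ x z = trans (sym (+-identityˡ (x zero + Σℚ (λ k → x (suc (suc k))))))
          (trans (cong (_+ (x zero + Σℚ (λ k → x (suc (suc k))))) (sym z))
                 (lem₂ (x (suc zero)) (x zero) (Σℚ (λ k → x (suc (suc k))))))
        rest : ∀ k → a′ k ≡ 0ℚ
        rest = ind a′ (trans (drop₁ a a₁≡0) Σa) λ j →
          trans (drop₁ (λ k → a k * V (h k) j) (trans (cong (_* V i j) a₁≡0) (*-zeroˡ (V i j)))) (Σaw j)

    nonzero-sign : ∀ e → NonZeroVec e → ∃ λ s → ∃ λ i → 0ℚ < s * g e i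
    nonzero-sign e (j , ej≢0) with any? (λ i → ¬? (g e i ≟ 0ℚ))
    ... | no none = contradiction (g≡0⇒zero e (¬∃≢0⇒≡0 none) j) ej≢0
    ... | yes (i , ge≢0) = g e i , i , ≤∧≢⇒< (square-≥0 (g e i)) λ z → ge≢0 (*-cancel-0 ge≢0 (sym z))

    -- Since e has zero slack on Z c and at i₀, moving c along a suitable sign of e changes nothing
    -- there. The ratio test stops at the first inequality that becomes newly tight.
    tilt : ∀ c e i₀ → Normal c → NonZeroVec e → g e i₀ ≡ 0ℚ → (∀ i → g c i ≡ 0ℚ → g e i ≡ 0ℚ) →
      ∃ λ c′ → Normal c′ × g c′ i₀ ≡ g c i₀ × (∀ i → g c i ≡ 0ℚ → g c′ i ≡ 0ℚ) × ∃ λ k → g c k ≢ 0ℚ × g c′ k ≡ 0ℚ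
    tilt c e i₀ nc e≢0 e-i₀ e-Z =
        c′ , (λ i → subst (_≤ 0ℚ) (sym (g-c′ i)) (bound i)) , g-same i₀ e-i₀ ,
        (λ i z → trans (g-same i (e-Z i z)) z) , k , k∉ , trans (g-c′ k) tight
      where
      sign = nonzero-sign e e≢0
      s = proj₁ sign
      test = ratio-test (g c) (λ i → s * g e i) nc (proj₂ sign)
      t = proj₁ test
      bound = proj₁ (proj₂ (proj₂ test))
      k = proj₁ (proj₂ (proj₂ (proj₂ test)))
      0<bk = proj₁ (proj₂ (proj₂ (proj₂ (proj₂ test))))
      tight = proj₂ (proj₂ (proj₂ (proj₂ (proj₂ test))))
      c′ : Point (suc n)
      c′ = lin 1ℚ c (t * s) e
      lem : ∀ x t s y → 1ℚ * x + t * s * y ≡ x + t * (s * y)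
      lem = solve-∀ ℚ-ring
      g-c′ : ∀ i → g c′ i ≡ g c i + t * (s * g e i)
      g-c′ i = trans (g-lin 1ℚ c (t * s) e i) (lem (g c i) t s (g e i))
      lem₀ : ∀ x t s → x + t * (s * 0ℚ) ≡ x
      lem₀ = solve-∀ ℚ-ring
      g-same : ∀ i → g e i ≡ 0ℚ → g c′ i ≡ g c i
      g-same i z = trans (g-c′ i) (trans (cong (λ y → g c i + t * (s * y)) z) (lem₀ (g c i) t s))
      k∉ : g c k ≢ 0ℚ
      k∉ z = >⇒≢ 0<bk (trans (cong (s *_) (e-Z k z)) (*-zeroʳ s))

    less-fuel : ∀ {fuel} c c′ → m ℕ.≤ suc fuel ℕ.+ ∣ Z c ∣ → ∣ Z c ∣ ℕ.< ∣ Z c′ ∣ → m ℕ.≤ fuel ℕ.+ ∣ Z c′ ∣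
    less-fuel {fuel} c c′ m≤ grows = ℕ.≤-trans m≤
      (ℕ.≤-trans (ℕ.≤-reflexive (sym (ℕ.+-suc fuel ∣ Z c ∣))) (ℕ.+-monoʳ-≤ fuel grows))

    -- The normal of a facet that contains the face exposed by c and avoids `V i₀`.
    ExtremeRay : Point (suc n) → Fin m → Set
    ExtremeRay c i₀ = ∃ λ c′ → Normal c′ × g c′ i₀ < 0ℚ × (∀ i → g c i ≡ 0ℚ → g c′ i ≡ 0ℚ) × HasIndep V (Z c′) (suc n)

    -- Tilt c along an annihilator of its zero set until a further inequality becomes tight.
    extreme-ray : ∀ fuel c i₀ → m ℕ.≤ fuel ℕ.+ ∣ Z c ∣ → Normal c → g c i₀ < 0ℚ → ExtremeRay c i₀
    extreme-ray zero c i₀ m≤ nc c<0 = contradiction (Z-full c m≤ i₀) (<⇒≢ c<0)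
    extreme-ray (suc fuel) c i₀ m≤ nc c<0 with annihilator-or-indep c i₀ n ℕ.≤-refl
    ... | inj₂ (f , f∈ , ind) = c , nc , c<0 , (λ _ z → z) , o ∷ f ,
          (λ { zero → o∈Z c ; (suc k) → ∈⟨⟩⁺ (Zero? c) (f∈ k) }) , ind
    ... | inj₁ (e , e≢0 , e-i₀ , e-Z) =
      let c″ , nc″ , same , sub , grow = tilt c e i₀ nc e≢0 e-i₀ e-Z
          c′ , nc′ , c′<0 , sub′ , h = extreme-ray fuel c″ i₀ (less-fuel c c″ m≤ (Z-grows c c″ sub grow))
                                         nc″ (subst (_< 0ℚ) (sym same) c<0)
      in c′ , nc′ , c′<0 , (λ i z → sub′ i (sub i z)) , h

    module Facets (nrm : Fin (suc n) → Point (suc n)) (nrm-normal : ∀ p → Normal (nrm p))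
                  (complete : ∀ c → Normal c → HasDim V (Z c) n → ∃ λ p → ∀ i → (g c i ≡ 0ℚ) ⇔ (g (nrm p) i ≡ 0ℚ)) where

      InCone : Point (suc n) → Set
      InCone c = ∃ λ (a : Fin (suc n) → ℚ) → (∀ p → 0ℚ ≤ a p) × (∀ j → c j ≡ Σℚ (λ p → a p * nrm p j))

      InCone-dot : ∀ {c} ((a , _) : InCone c) e → dot c e ≡ Σℚ (λ p → a p * dot (nrm p) e)
      InCone-dot (a , _ , eq) e = trans (Σ-cong λ j → cong (_* e j) (eq j)) (dot-Σˡ a nrm e)

      InCone-+ : ∀ {c} p t → 0ℚ ≤ t → InCone (lin 1ℚ c (- t) (nrm p)) → InCone c
      InCone-+ {c} p t 0≤t (a , a≥0 , eq) = (λ q → a q + δ q) , (λ q → a≥0 q ∙+ δ≥0 q) , λ j → begin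
        c j
          ≡⟨ lem (c j) t (nrm p j) ⟩
        (1ℚ * c j + - t * nrm p j) + t * nrm p j
          ≡⟨ cong₂ _+_ (eq j) (cong (_* nrm p j) (sym δp)) ⟩
        Σℚ (λ q → a q * nrm q j) + δ p * nrm p j
          ≡⟨ cong (Σℚ (λ q → a q * nrm q j) +_) (Σ-single p λ q q≢p → trans (cong (_* nrm q j) (δ≢ q q≢p)) (*-zeroˡ (nrm q j))) ⟨
        Σℚ (λ q → a q * nrm q j) + Σℚ (λ q → δ q * nrm q j)
          ≡⟨ Σ-+ (λ q → a q * nrm q j) (λ q → δ q * nrm q j) ⟨
        Σℚ (λ q → a q * nrm q j + δ q * nrm q j)
          ≡⟨ Σ-cong (λ q → sym (*-distribʳ-+ (nrm q j) (a q) (δ q))) ⟩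
        Σℚ (λ q → (a q + δ q) * nrm q j) ∎
        where
        open ≡-Reasoning
        lem : ∀ c t x → c ≡ (1ℚ * c + - t * x) + t * x
        lem = solve-∀ ℚ-ring
        δ : Fin (suc n) → ℚ
        δ q with q Fin.≟ p
        ... | yes _ = t
        ... | no _  = 0ℚ
        δ≥0 : ∀ q → 0ℚ ≤ δ q
        δ≥0 q with q Fin.≟ p
        ... | yes _ = 0≤t
        ... | no _  = ≤-refl
        δp : δ p ≡ t
        δp with p Fin.≟ p
        ... | yes _  = refl
        ... | no p≢p = contradiction refl p≢p
        δ≢ : ∀ q → q ≢ p → δ q ≡ 0ℚ
        δ≢ q q≢p with q Fin.≟ p
        ... | yes q≡p = contradiction q≡p q≢p
        ... | no _    = refl

      -- Take t as large as normality permits, so that a further inequality becomes tight. The old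
      -- ones stay tight because Z c lies in the facet p.
      subtract-facet : ∀ c p i₀ → Normal c → (∀ i → g c i ≡ 0ℚ → g (nrm p) i ≡ 0ℚ) → g (nrm p) i₀ ≢ 0ℚ →
        ∃ λ t → 0ℚ ≤ t × Normal (lin 1ℚ c (- t) (nrm p)) × ∣ Z c ∣ ℕ.< ∣ Z (lin 1ℚ c (- t) (nrm p)) ∣
      subtract-facet c p i₀ nc Zp gp≢0 =
          t , proj₁ (proj₂ test) , (λ i → subst (_≤ 0ℚ) (sym (g-c₁ i)) (bound i)) ,
          Z-grows c c₁ sub (k , (λ z → >⇒≢ 0<bk (cong -_ (Zp k z))) , trans (g-c₁ k) tight)
        where
        test = ratio-test (g c) (λ i → - g (nrm p) i) nc (i₀ , 0<- (≤∧≢⇒< (nrm-normal p i₀) gp≢0))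
        t = proj₁ test
        bound = proj₁ (proj₂ (proj₂ test))
        k = proj₁ (proj₂ (proj₂ (proj₂ test)))
        0<bk = proj₁ (proj₂ (proj₂ (proj₂ (proj₂ test))))
        tight = proj₂ (proj₂ (proj₂ (proj₂ (proj₂ test))))
        c₁ : Point (suc n)
        c₁ = lin 1ℚ c (- t) (nrm p)
        lem : ∀ x t y → 1ℚ * x + - t * y ≡ x + t * - y
        lem = solve-∀ ℚ-ring
        g-c₁ : ∀ i → g c₁ i ≡ g c i + t * - g (nrm p) i
        g-c₁ i = trans (g-lin 1ℚ c (- t) (nrm p) i) (lem (g c i) t (g (nrm p) i))
        lem₀ : ∀ t → 0ℚ + t * - 0ℚ ≡ 0ℚ
        lem₀ = solve-∀ ℚ-ring
        sub : ∀ i → g c i ≡ 0ℚ → g c₁ i ≡ 0ℚ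
        sub i z = trans (g-c₁ i) (trans (cong₂ (λ x y → x + t * - y) z (Zp i z)) (lem₀ t))

      Z-dim : ∀ c i₀ → g c i₀ < 0ℚ → HasIndep V (Z c) (suc n) → HasDim V (Z c) n
      Z-dim c i₀ c<0 indep = indep , λ (f , f∈ , ind) →
        let c≡0 = constant⇒zero (V ∘ f) ind c (dot c (V o)) (λ i → g≡0⇒ c (f i) (∈⟨⟩⁻ (Zero? c) (f∈ i))) in
        <⇒≢ c<0 (⇒g≡0 c i₀ (trans (zero-dot c≡0 (V i₀)) (sym (zero-dot c≡0 (V o)))))
        where
        zero-dot : (∀ j → c j ≡ 0ℚ) → ∀ x → dot c x ≡ 0ℚ
        zero-dot z x = Σ-0 λ j → trans (cong (_* x j) (z j)) (*-zeroˡ (x j))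

      -- Some facet contains the face Z c; removing the largest multiple of its normal leaves a
      -- normal with a larger zero set. Once all slacks vanish, full dimension forces c = 0.
      cone : ∀ fuel c → m ℕ.≤ fuel ℕ.+ ∣ Z c ∣ → Normal c → InCone c
      cone fuel c m≤ nc with any? (λ i → ¬? (g c i ≟ 0ℚ))
      cone fuel c m≤ nc | no none = (λ _ → 0ℚ) , (λ _ → ≤-refl) , λ j →
        trans (g≡0⇒zero c (¬∃≢0⇒≡0 none) j) (sym (Σ-0 λ p → *-zeroˡ (nrm p j)))
      cone zero c m≤ nc | yes (i₀ , gc≢0) = contradiction (Z-full c m≤ i₀) gc≢0
      cone (suc fuel) c m≤ nc | yes (i₀ , gc≢0) =
        let c′ , nc′ , c′<0 , sub′ , indep = extreme-ray (suc fuel) c i₀ m≤ nc (≤∧≢⇒< (nc i₀) gc≢0)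
            p , iff = complete c′ nc′ (Z-dim c′ i₀ c′<0 indep)
            t , 0≤t , nc₁ , grows = subtract-facet c p i₀ nc (λ i z → Equivalence.to (iff i) (sub′ i z))
                                      (λ z → <⇒≢ c′<0 (Equivalence.from (iff i₀) z))
        in InCone-+ p t 0≤t (cone fuel (lin 1ℚ c (- t) (nrm p)) (less-fuel c (lin 1ℚ c (- t) (nrm p)) m≤ grows) nc₁)

      normal⇒InCone : ∀ c → Normal c → InCone c
      normal⇒InCone c = cone m c (ℕ.m≤m+n m ∣ Z c ∣)

      module Apex (c₀ : Point (suc n)) (nc₀ : Normal c₀) (c₀-strict : ∀ i → g c₀ i ≡ 0ℚ → ∀ j → V i j ≡ V o j) where

        -- As c₀ is tight only at copies of o, N c₀ + e is still a normal for large N. It and c₀ are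
        -- both combinations of the `nrm p`, hence orthogonal to e; therefore e is orthogonal to
        -- itself.
        normals-span : ∀ e → (∀ p → dot (nrm p) e ≡ 0ℚ) → ∀ j → e j ≡ 0ℚ
        normals-span e orth with large-multiple (g c₀) (g e)
        ... | N , 0<N , small = dot-self≡0 e (begin
            dot e e                                ≡⟨ lem N (dot c₀ e) (dot e e) ⟩
            (N * dot c₀ e + 1ℚ * dot e e) + - N * dot c₀ e
              ≡⟨ cong₂ (λ x y → x + - N * y) (sym (dot-linˡ c₀ e e N 1ℚ)) (vanish (normal⇒InCone c₀ nc₀)) ⟩
            dot (lin N c₀ 1ℚ e) e + - N * 0ℚ      ≡⟨ cong (_+ - N * 0ℚ) (vanish (normal⇒InCone (lin N c₀ 1ℚ e) nc)) ⟩
            0ℚ + - N * 0ℚ                          ≡⟨ lem₀ N ⟩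
            0ℚ ∎)
          where
          open ≡-Reasoning
          lem : ∀ N x y → y ≡ (N * x + 1ℚ * y) + - N * x
          lem = solve-∀ ℚ-ring
          lem₀ : ∀ N → 0ℚ + - N * 0ℚ ≡ 0ℚ
          lem₀ = solve-∀ ℚ-ring
          lem₁ : ∀ x N y → N * x + y ≡ N * x + 1ℚ * y
          lem₁ = solve-∀ ℚ-ring
          lem₂ : ∀ N → N * 0ℚ + 1ℚ * 0ℚ ≡ 0ℚ
          lem₂ = solve-∀ ℚ-ring
          nc : Normal (lin N c₀ 1ℚ e)
          nc i with g c₀ i ≟ 0ℚ
          ... | no ne = subst (_≤ 0ℚ) (trans (lem₁ (g c₀ i) N (g e i)) (sym (g-lin N c₀ 1ℚ e i)))
                          (<⇒≤ (small i (≤∧≢⇒< (nc₀ i) ne)))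
          ... | yes z = ≤-reflexive (trans (g-lin N c₀ 1ℚ e i) (trans (cong₂ (λ x y → N * x + 1ℚ * y) z
                          (⇒g≡0 e i (Σ-cong λ j → cong (e j *_) (c₀-strict i z j)))) (lem₂ N)))
          vanish : ∀ {c} → InCone c → dot c e ≡ 0ℚ
          vanish ic = trans (InCone-dot ic e) (Σ-0 λ p → trans (cong (proj₁ ic p *_) (orth p)) (*-zeroʳ (proj₁ ic p)))

        IsEdge : Fin (suc n) → Fin m → Set
        IsEdge p i = g (nrm p) i ≢ 0ℚ × (∀ q → q ≢ p → g (nrm q) i ≡ 0ℚ)

        IsEdge? : ∀ p → Decidable (IsEdge p)
        IsEdge? p i = ¬? (g (nrm p) i ≟ 0ℚ) ×-dec all? (λ q → ¬? (q Fin.≟ p) →-dec (g (nrm q) i ≟ 0ℚ))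

        others : Fin (suc n) → Point (suc n)
        others p j = Σℚ (λ q → 1ℚ * nrm (punchIn p q) j)

        others-e : ∀ p e → dot (others p) e ≡ Σℚ (λ q → dot (nrm (punchIn p q)) e)
        others-e p e = trans (dot-Σˡ (λ _ → 1ℚ) (nrm ∘ punchIn p) e)
          (Σ-cong λ q → *-identityˡ (dot (nrm (punchIn p q)) e))

        -g-others : ∀ p i → - g (others p) i ≡ Σℚ (λ q → - g (nrm (punchIn p q)) i)
        -g-others p i = begin
          - g (others p) i
            ≡⟨ cong -_ (cong₂ _-_ (others-e p (V i)) (others-e p (V o))) ⟩
          - (Σℚ A - Σℚ B)
            ≡⟨ lem (Σℚ A) (Σℚ B) ⟩
          Σℚ B + - 1ℚ * Σℚ A
            ≡⟨ cong (Σℚ B +_) (Σ-* (- 1ℚ) A) ⟨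
          Σℚ B + Σℚ (λ q → - 1ℚ * A q)
            ≡⟨ Σ-+ B (λ q → - 1ℚ * A q) ⟨
          Σℚ (λ q → B q + - 1ℚ * A q)
            ≡⟨ Σ-cong (λ q → sym (lem (A q) (B q))) ⟩
          Σℚ (λ q → - g (nrm (punchIn p q)) i) ∎
          where
          open ≡-Reasoning
          A B : Fin n → ℚ
          A q = dot (nrm (punchIn p q)) (V i)
          B q = dot (nrm (punchIn p q)) (V o)
          lem : ∀ a b → - (a - b) ≡ b + - 1ℚ * a
          lem = solve-∀ ℚ-ring

        -g≥0 : ∀ p i → 0ℚ ≤ - g (nrm p) i
        -g≥0 p i = 0≤- (nrm-normal p i)

        g-others≡0⇒ : ∀ p i → g (others p) i ≡ 0ℚ → ∀ q → q ≢ p → g (nrm q) i ≡ 0ℚ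
        g-others≡0⇒ p i z q q≢p = subst (λ q → g (nrm q) i ≡ 0ℚ) (punchIn-punchOut (q≢p ∘ sym))
          (neg-injective (Σ≡0⇒ (λ q → -g≥0 (punchIn p q) i) (trans (sym (-g-others p i)) (cong -_ z)) (punchOut (q≢p ∘ sym))))

        others-normal : ∀ p → Normal (others p)
        others-normal p i = subst (_≤ 0ℚ) (lem (g (others p) i))
          (neg-antimono-≤ (subst (0ℚ ≤_) (sym (-g-others p i)) (Σ-nonNeg λ q → -g≥0 (punchIn p q) i)))
          where
          lem : ∀ x → - - x ≡ x
          lem = solve-∀ ℚ-ring

        no-edge⇒normal : ∀ p → ¬ ∃ (IsEdge p) → ∃ λ N → Normal (lin N (others p) (- 1ℚ) (nrm p))
        no-edge⇒normal p none = let N , _ , small = large-multiple (g (others p)) (λ i → - 1ℚ * g (nrm p) i) in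
          N , λ i → subst (_≤ 0ℚ) (sym (g-lin N (others p) (- 1ℚ) (nrm p) i)) (bound N i (small i))
          where
          lem : ∀ N → N * 0ℚ + - 1ℚ * 0ℚ ≡ 0ℚ
          lem = solve-∀ ℚ-ring
          bound : ∀ N i → (g (others p) i < 0ℚ → N * g (others p) i + - 1ℚ * g (nrm p) i < 0ℚ) →
                  N * g (others p) i + - 1ℚ * g (nrm p) i ≤ 0ℚ
          bound N i small with g (others p) i ≟ 0ℚ
          ... | no ne = <⇒≤ (small (≤∧≢⇒< (others-normal p i) ne))
          ... | yes z = ≤-reflexive (trans (cong₂ (λ x y → N * x + - 1ℚ * y) z
            (decidable-stable (g (nrm p) i ≟ 0ℚ) λ ne → none (i , ne , g-others≡0⇒ p i z))) (lem N))

        -- Pair N times the sum of the other normals minus nrm p, written as a combination with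
        -- coefficients a ≥ 0, with e. What survives is (1 + a p)(nrm p · e) = 0, and 1 + a p > 0.
        orth-others⇒orth : ∀ p N e → InCone (lin N (others p) (- 1ℚ) (nrm p)) →
          (∀ q → dot (nrm (punchIn p q)) e ≡ 0ℚ) → ∀ q → dot (nrm q) e ≡ 0ℚ
        orth-others⇒orth p N e ic@(a , a≥0 , _) orth q with q Fin.≟ p
        ... | no q≢p   = subst (λ q → dot (nrm q) e ≡ 0ℚ) (punchIn-punchOut (q≢p ∘ sym)) (orth (punchOut (q≢p ∘ sym)))
        ... | yes refl = *-cancel-0 (>⇒≢ (0<+ (positive⁻¹ 1ℚ) (a≥0 p))) (begin
            (1ℚ + a p) * x
              ≡⟨ lem (a p) x N ⟩
            a p * x - (N * 0ℚ + - 1ℚ * x)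
              ≡⟨ -self (begin
                   a p * x                                     ≡⟨ +-identityʳ (a p * x) ⟨
                   a p * x + 0ℚ                                ≡⟨ cong (a p * x +_) (Σ-0 λ q → trans (cong (a (punchIn p q) *_) (orth q)) (*-zeroʳ (a (punchIn p q)))) ⟨
                   a p * x + Σℚ (λ q → a (punchIn p q) * dot (nrm (punchIn p q)) e) ≡⟨ Σ-punchIn p (λ q → a q * dot (nrm q) e) ⟨
                   Σℚ (λ q → a q * dot (nrm q) e)              ≡⟨ InCone-dot ic e ⟨
                   dot (lin N (others p) (- 1ℚ) (nrm p)) e     ≡⟨ dot-linˡ (others p) (nrm p) e N (- 1ℚ) ⟩
                   N * dot (others p) e + - 1ℚ * x             ≡⟨ cong (λ y → N * y + - 1ℚ * x) (trans (others-e p e) (Σ-0 orth)) ⟩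
                   N * 0ℚ + - 1ℚ * x                           ∎) ⟩
            0ℚ ∎)
          where
          open ≡-Reasoning
          x = dot (nrm p) e
          lem : ∀ a x N → (1ℚ + a) * x ≡ a * x - (N * 0ℚ + - 1ℚ * x)
          lem = solve-∀ ℚ-ring

        -- If there were no edge opposite to facet p, then N ∑_{q≠p} nrm q − nrm p would be
        -- a normal for large N, so that nrm p would be in the span of the n other normals.
        edge : ∀ p → ∃ (IsEdge p)
        edge p with any? (IsEdge? p)
        ... | yes found = found
        ... | no none =
          let e , (j , ej≢0) , orth = nonzero-solution (nrm ∘ punchIn p) ℕ.≤-refl
              N , nc = no-edge⇒normal p none
          in contradiction (normals-span e (orth-others⇒orth p N e (normal⇒InCone _ nc) orth) j) ej≢0

        edges⇒corner : (nb : Fin (suc n) → Fin m) → (∀ p → IsEdge p (nb p)) → Corner V o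
        edges⇒corner nb isEdge = record
          { c      = nrm
          ; b      = λ p → dot (nrm p) (V o)
          ; nb     = nb
          ; e≥0    = λ p i → subst (0ℚ ≤_) (lem (dot (nrm p) (V i)) (dot (nrm p) (V o))) (0≤- (nrm-normal p i))
          ; e-o    = λ p → +-inverseʳ (dot (nrm p) (V o))
          ; e-nb   = λ p q q≢p → -self {dot (nrm q) (V o)} {dot (nrm q) (V (nb p))} (sym (g≡0⇒ (nrm q) (nb p) (proj₂ (isEdge p) q q≢p)))
          ; e-nb>0 = λ p → subst (0ℚ <_) (lem (dot (nrm p) (V (nb p))) (dot (nrm p) (V o)))
                       (0<- (≤∧≢⇒< (nrm-normal p (nb p)) (proj₁ (isEdge p))))
          }
          where
          lem : ∀ x y → - (x - y) ≡ y - x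
          lem = solve-∀ ℚ-ring

        corner : Corner V o
        corner = edges⇒corner (λ p → proj₁ (edge p)) (λ p → proj₂ (edge p))

  module _ {d m} (V : Fin m → Point d) where

    Same? : ∀ o → Decidable (λ i → ∀ j → V i j ≡ V o j)
    Same? o i = all? (λ j → V i j ≟ V o j)

    -- `V` may list a point several times, and a face contains all copies of a point or none, so
    -- this set of indices is what a vertex looks like.
    copies : Fin m → Subset m
    copies o = ⟨⟩ (Same? o)

    IsVertex : Fin m → Set
    IsVertex o = KFace V 0 (copies o)

    face-closed : ∀ {S i o} → IsFace V S → (∀ j → V i j ≡ V o j) → o ∈ S → i ∈ S
    face-closed {i = i} {o} (c , b , _ , iff) same o∈S = Equivalence.from (iff i)
      (trans (Σ-cong λ j → cong (c j *_) (same j)) (Equivalence.to (iff o) o∈S))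

  module _ {n m} (V : Fin m → Point (suc n)) where

    facets⇒corner : HasIndep V ⊤ (suc (suc n)) → ∀ o →
      (c₀ : Point (suc n)) → (∀ i → dot c₀ (V i) ≤ dot c₀ (V o)) →
      (∀ i → dot c₀ (V i) ≡ dot c₀ (V o) → ∀ j → V i j ≡ V o j) →
      (F : Fin (suc n) → Subset m) (nrm : Fin (suc n) → Point (suc n)) →
      (∀ p i → dot (nrm p) (V i) ≤ dot (nrm p) (V o)) →
      (∀ p i → (i ∈ F p) ⇔ (dot (nrm p) (V i) ≡ dot (nrm p) (V o))) →
      (∀ S → KFace V n S → o ∈ S → ∃ λ p → F p ≡ S) → Corner V o
    facets⇒corner full o c₀ c₀≤ c₀-iff F nrm nrm≤ F-iff complete =
      Facets.Apex.corner nrm (λ p i → ≤⇒g≤0 (nrm p) i (nrm≤ p i)) complete′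
        c₀ (λ i → ≤⇒g≤0 c₀ i (c₀≤ i)) (λ i z → c₀-iff i (g≡0⇒ c₀ i z))
      where
      open Cone V full o
      ≤⇒g≤0 : ∀ c i → dot c (V i) ≤ dot c (V o) → g c i ≤ 0ℚ
      ≤⇒g≤0 c i p = subst (g c i ≤_) (g-o c) (+-monoˡ-≤ (- dot c (V o)) p)
      complete′ : ∀ c → Normal c → HasDim V (Z c) n → ∃ λ p → ∀ i → (g c i ≡ 0ℚ) ⇔ (g (nrm p) i ≡ 0ℚ)
      complete′ c nc dim = let p , F≡Z = complete (Z c) (Z-isFace c nc , dim) (o∈Z c) in p , λ i → mk⇔
        (λ z → ⇒g≡0 (nrm p) i (Equivalence.to (F-iff p i) (subst (i ∈_) (sym F≡Z) (∈⟨⟩⁺ (Zero? c) z))))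
        (λ z → ∈⟨⟩⁻ (Zero? c) (subst (i ∈_) F≡Z (Equivalence.from (F-iff p i) (g≡0⇒ (nrm p) i z))))

    -- Here simplicity enters: its enumeration of the d facets through the vertex supplies the
    -- normals, and the completeness of that enumeration makes them generate the normal cone.
    vertex-corner : IsSimpleDPolytope V → ∀ o → IsVertex V o → Corner V o
    vertex-corner ((full , _) , simple) o vtx@((c₀ , b₀ , c₀≤ , c₀-iff) , _) =
      facets⇒corner full o c₀ (λ i → subst (dot c₀ (V i) ≤_) (sym c₀-o) (c₀≤ i))
        (λ i z → ∈⟨⟩⁻ (Same? V o) (Equivalence.from (c₀-iff i) (trans z c₀-o)))
        F nrm (λ p i → subst (dot (nrm p) (V i) ≤_) (sym (nrm-o p)) (proj₁ (proj₂ (proj₂ (isFace p))) i))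
        (λ p i → mk⇔ (λ i∈ → trans (Equivalence.to (iff p i) i∈) (sym (nrm-o p)))
                     (λ z → Equivalence.from (iff p i) (trans z (nrm-o p))))
        λ S kf o∈S → Equivalence.to (F⇔ S) (kf , λ i∈ → face-closed V (proj₁ kf) (∈⟨⟩⁻ (Same? V o) i∈) o∈S)
      where
      o∈copies : o ∈ copies V o
      o∈copies = ∈⟨⟩⁺ (Same? V o) λ _ → refl
      c₀-o : dot c₀ (V o) ≡ b₀
      c₀-o = Equivalence.to (c₀-iff o) o∈copies
      F : Fin (suc n) → Subset m
      F = proj₁ (simple (copies V o) vtx)
      F⇔ : ∀ S → (KFace V n S × copies V o ⊆ S) ⇔ ∃ λ i → F i ≡ S
      F⇔ = proj₂ (proj₂ (simple (copies V o) vtx))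
      facet : ∀ p → KFace V n (F p) × copies V o ⊆ F p
      facet p = Equivalence.from (F⇔ (F p)) (p , refl)
      isFace : ∀ p → IsFace V (F p)
      isFace p = proj₁ (proj₁ (facet p))
      nrm : Fin (suc n) → Point (suc n)
      nrm p = proj₁ (isFace p)
      iff : ∀ p i → (i ∈ F p) ⇔ (dot (nrm p) (V i) ≡ proj₁ (proj₂ (isFace p)))
      iff p = proj₂ (proj₂ (proj₂ (isFace p)))
      nrm-o : ∀ p → dot (nrm p) (V o) ≡ proj₁ (proj₂ (isFace p))
      nrm-o p = Equivalence.to (iff p o) (proj₂ (facet p) o∈copies)

-- Generic functionals and the balanced count of descending edges.

module Sweep where

  open LinAlg
  open FinSets
  open Corners
  open VertexCones
  open import Data.Nat.Base as ℕ using (ℕ; zero; suc)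
  open import Data.Nat.Combinatorics using (_C_)
  open import Data.Fin.Base as Fin using (Fin; zero; suc; combine; remQuot)
  open import Data.Fin.Properties as Fin using (any?; all?; remQuot-combine)
  import Data.Fin.Induction as Fin
  open import Data.Fin.Subset using (Subset; _∈_; _⊆_; ∣_∣; ∁)
  open import Data.Fin.Subset.Properties using (_∈?_; ∣p∣≤n; ∣∁p∣≡n∸∣p∣; x∉p⇒x∈∁p; x∈∁p⇒x∉p; ⊆-antisym)
  open import Data.Vec.Functional using (_∷_)
  open import Data.Rational hiding (∣_∣)
  open import Data.Rational.Properties
  open import Induction.WellFounded using (Acc; acc)
  open import Tactic.RingSolver using (solve-∀)

  -- Induction on the coordinates: a large weight on the first coordinate settles all vectors where
  -- it is nonzero, and the remaining ones are left to φ.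
  nonvanishing-functional : ∀ {d r} (x : Fin r → Point d) → ∃ λ φ → ∀ k → NonZeroVec (x k) → dot φ (x k) ≢ 0ℚ
  nonvanishing-functional {zero}  x = (λ ()) , λ { k (() , _) }
  nonvanishing-functional {suc d} x with nonvanishing-functional (λ k → x k ∘ suc)
  -- With x the first coordinate and t the value of φ on the rest, N (-x²) - t x < 0 is -x (N x + t)
  -- < 0, so N x + t is nonzero.
  ... | φ , nv with large-multiple (λ k → - (x k zero * x k zero)) (λ k → - (dot φ (x k ∘ suc) * x k zero))
  ...   | N , _ , large = (N ∷ φ) , nv′
    where
    lem₁ : ∀ N x t → N * - (x * x) + - (t * x) ≡ - x * (N * x + t)
    lem₁ = solve-∀ ℚ-ring
    lem₂ : ∀ N t → N * 0ℚ + t ≡ t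
    lem₂ = solve-∀ ℚ-ring
    square>0 : ∀ {q} → q ≢ 0ℚ → - (q * q) < 0ℚ
    square>0 {q} q≢0 = neg-antimono-< (≤∧≢⇒< (square-≥0 q) λ z → q≢0 (*-cancel-0 q≢0 (sym z)))
    nv′ : ∀ k → NonZeroVec (x k) → N * x k zero + dot φ (x k ∘ suc) ≢ 0ℚ
    nv′ k nz with x k zero ≟ 0ℚ
    ... | no x₀≢0 = λ z → <⇒≢ (large k (square>0 x₀≢0)) (trans (lem₁ N (x k zero) (dot φ (x k ∘ suc)))
                      (trans (cong (- x k zero *_) z) (*-zeroʳ (- x k zero))))
    nv′ k (zero , x₀≢0) | yes x₀≡0 = contradiction x₀≡0 x₀≢0
    nv′ k (suc j , xj≢0) | yes x₀≡0 = λ z → nv k (j , xj≢0)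
      (trans (sym (trans (cong (λ y → N * y + dot φ (x k ∘ suc)) x₀≡0) (lem₂ N (dot φ (x k ∘ suc))))) z)

  Same : ∀ {d m} (V : Fin m → Point d) → Fin m → Fin m → Set
  Same V i k = ∀ j → V i j ≡ V k j

  -- Concludes equality of points, not of indices, since points may be repeated.
  Generic : ∀ {d m} → (Fin m → Point d) → Point d → Set
  Generic V φ = ∀ i k → dot φ (V i) ≡ dot φ (V k) → Same V i k

  generic-functional : ∀ {d m} (V : Fin m → Point d) → ∃ (Generic V)
  generic-functional {d} {m} V with nonvanishing-functional x
    where
    x : Fin (m ℕ.* m) → Point d
    x k j = V (proj₁ (remQuot m k)) j - V (proj₂ (remQuot {m} m k)) j
  ... | φ , nv = φ , λ i k eq → λ j → -≡0 {V i j} {V k j} (decidable-stable (V i j - V k j ≟ 0ℚ) λ ne →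
      nv′ i k (j , ne) (trans (dot-diff φ (V i) (V k)) (-self {dot φ (V i)} {dot φ (V k)} eq)))
    where
    nv′ : ∀ i k → NonZeroVec (λ j → V i j - V k j) → dot φ (λ j → V i j - V k j) ≢ 0ℚ
    nv′ i k = subst (λ (i , k) → NonZeroVec (λ j → V i j - V k j) → dot φ (λ j → V i j - V k j) ≢ 0ℚ)
      (remQuot-combine i k) (nv (combine i k))

  dot-neg : ∀ {n} (c x : Point n) → dot (λ j → - c j) x ≡ - dot c x
  dot-neg c x = trans (Σ-cong λ j → lem (c j) (x j)) (trans (Σ-* (- 1ℚ) (λ j → c j * x j)) (sym (lem₁ (dot c x))))
    where
    lem : ∀ c x → - c * x ≡ - 1ℚ * (c * x)
    lem = solve-∀ ℚ-ring
    lem₁ : ∀ x → - x ≡ - 1ℚ * x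
    lem₁ = solve-∀ ℚ-ring

  generic-neg : ∀ {d m} (V : Fin m → Point d) φ → Generic V φ → Generic V (λ j → - φ j)
  generic-neg V φ gen i k eq = gen i k (neg-injective (trans (sym (dot-neg φ (V i))) (trans eq (dot-neg φ (V k)))))

  module _ {d m} (V : Fin m → Point d) where

    copies-dim : ∀ k → HasDim V (copies V k) 0
    copies-dim k = ((λ _ → k) , (λ _ → ∈⟨⟩⁺ (Same? V k) λ _ → refl) ,
                    λ { a Σa _ zero → trans (sym (+-identityʳ (a zero))) Σa }) ,
      λ (f , f∈ , ind) → 1≢0 (ind (1ℚ ∷ - 1ℚ ∷ λ ()) refl
        (λ j → trans (cong₂ (λ x y → 1ℚ * x + (- 1ℚ * y + 0ℚ)) (∈⟨⟩⁻ (Same? V k) (f∈ zero) j) (∈⟨⟩⁻ (Same? V k) (f∈ (suc zero)) j))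
                     (lem (V k j))) zero)
      where
      lem : ∀ x → 1ℚ * x + (- 1ℚ * x + 0ℚ) ≡ 0ℚ
      lem = solve-∀ ℚ-ring

    module _ (φ : Point d) (gen : Generic V φ) where

      -- Perturbing a functional that exposes S by φ exposes the φ-maximal point of S.
      max-isVertex : ∀ {S} → IsFace V S → ∀ k → k ∈ S → (∀ i → i ∈ S → dot φ (V i) ≤ dot φ (V k)) → IsVertex V k
      max-isVertex {S} (c , b , c≤b , iff) k k∈S max = (c′ , b′ , (λ i → 0≤⇒≤ {dot c′ (V i)} {b′} (subst (0ℚ ≤_) (gap i) (0≤- (val≤0 i)))) , λ i → mk⇔
          (λ i∈ → trans (Σ-cong λ j → cong (c′ j *_) (∈⟨⟩⁻ (Same? V k) i∈ j)) c′-k)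
          (λ eq → ∈⟨⟩⁺ (Same? V k) (val≡0⇒ i (trans (val-gap i) (-self {dot c′ (V i)} {b′} eq))))) , copies-dim k
        where
        x y : Fin m → ℚ
        x i = dot c (V i) - b
        y i = dot φ (V i) - dot φ (V k)
        N,large = large-multiple x y
        N = proj₁ N,large
        c′ : Point d
        c′ j = N * c j + 1ℚ * φ j
        b′ : ℚ
        b′ = N * b + 1ℚ * dot φ (V k)
        lem₁ : ∀ N c b p q → N * (c - b) + (p - q) ≡ (N * c + 1ℚ * p) - (N * b + 1ℚ * q)
        lem₁ = solve-∀ ℚ-ring
        lem₂ : ∀ x y → - (x - y) ≡ y - x
        lem₂ = solve-∀ ℚ-ring
        lem₃ : ∀ N y → N * 0ℚ + y ≡ y
        lem₃ = solve-∀ ℚ-ring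
        val-gap : ∀ i → N * x i + y i ≡ dot c′ (V i) - b′
        val-gap i = trans (lem₁ N (dot c (V i)) b (dot φ (V i)) (dot φ (V k))) (cong (_- b′) (sym (dot-linˡ c φ (V i) N 1ℚ)))
        gap : ∀ i → - (N * x i + y i) ≡ b′ - dot c′ (V i)
        gap i = trans (cong -_ (val-gap i)) (lem₂ (dot c′ (V i)) b′)
        x≤0 : ∀ i → x i ≤ 0ℚ
        x≤0 i = subst (x i ≤_) (+-inverseʳ b) (+-monoˡ-≤ (- b) (c≤b i))
        x≡0⇒∈ : ∀ i → x i ≡ 0ℚ → i ∈ S
        x≡0⇒∈ i z = Equivalence.from (iff i) (-≡0 {dot c (V i)} {b} z)
        y≤0 : ∀ i → x i ≡ 0ℚ → y i ≤ 0ℚ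
        y≤0 i z = subst (y i ≤_) (+-inverseʳ (dot φ (V k))) (+-monoˡ-≤ (- dot φ (V k)) (max i (x≡0⇒∈ i z)))
        val-y : ∀ i → x i ≡ 0ℚ → N * x i + y i ≡ y i
        val-y i z = trans (cong (λ w → N * w + y i) z) (lem₃ N (y i))
        val≤0 : ∀ i → N * x i + y i ≤ 0ℚ
        val≤0 i with x i ≟ 0ℚ
        ... | no ne = <⇒≤ (proj₂ (proj₂ N,large) i (≤∧≢⇒< (x≤0 i) ne))
        ... | yes z = subst (_≤ 0ℚ) (sym (val-y i z)) (y≤0 i z)
        val≡0⇒ : ∀ i → N * x i + y i ≡ 0ℚ → Same V i k
        val≡0⇒ i v with x i ≟ 0ℚ
        ... | no ne = contradiction v (<⇒≢ (proj₂ (proj₂ N,large) i (≤∧≢⇒< (x≤0 i) ne)))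
        ... | yes z = gen i k (-≡0 {dot φ (V i)} {dot φ (V k)} (trans (sym (val-y i z)) v))
        c′-k : dot c′ (V k) ≡ b′
        c′-k = trans (dot-linˡ c φ (V k) N 1ℚ) (cong (λ w → N * w + 1ℚ * dot φ (V k)) (Equivalence.to (iff k) k∈S))

      module _ {M} (vt : Fin M → Fin m) (corner : ∀ u → Corner V (vt u))
               (rep : ∀ i → IsVertex V i → ∃ λ u → Same V (vt u) i)
               (rep-unique : ∀ u v → Same V (vt u) (vt v) → u ≡ v) where

        private
          module C u = Corner (corner u)
          h : Fin m → ℚ
          h i = dot φ (V i)

        Down? : ∀ u → Decidable (λ p → h (C.nb u p) < h (vt u))
        Down? u p = h (C.nb u p) <? h (vt u)

        Down : Fin M → Subset d
        Down u = ⟨⟩ (Down? u)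

        h-nb≢ : ∀ u p → h (C.nb u p) ≢ h (vt u)
        h-nb≢ u p eq = >⇒≢ (C.e-nb>0 u p)
          (trans (cong (λ z → C.b u p - z) (Σ-cong λ j → cong (C.c u p j *_) (gen (C.nb u p) (vt u) eq j))) (C.e-o u p))

        -- In edge coordinates at u, the drop in height to `V i` is a nonnegative combination of the
        -- drops along the edges. For i in S only edges inside S contribute, and these descend.
        max-below : ∀ u {S} → IsFace V S → vt u ∈ S → C.trace u S ⊆ Down u → ∀ {i} → i ∈ S → h i ≤ h (vt u)
        max-below u {S} isF o∈S ⊆Down {i} i∈S = 0≤⇒≤ {h i} {h (vt u)} (subst (0ℚ ≤_) (sym sum) (Σ-nonNeg term))
          where
          lem : ∀ x y → y - x ≡ - 1ℚ * (x - y)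
          lem = solve-∀ ℚ-ring
          lem₂ : ∀ k x y → - 1ℚ * (k * (x - y)) ≡ k * (y - x)
          lem₂ = solve-∀ ℚ-ring
          sum : h (vt u) - h i ≡ Σℚ (λ p → C.κ u p i * (h (vt u) - h (C.nb u p)))
          sum = trans (lem (h i) (h (vt u))) (trans (cong (- 1ℚ *_) (C.dot-coords u φ i))
            (trans (sym (Σ-* (- 1ℚ) (λ p → C.κ u p i * (h (C.nb u p) - h (vt u)))))
              (Σ-cong λ p → lem₂ (C.κ u p i) (h (C.nb u p)) (h (vt u)))))
          term : ∀ p → 0ℚ ≤ C.κ u p i * (h (vt u) - h (C.nb u p))
          term p with C.nb u p ∈? S
          ... | yes nb∈S = 0≤* (C.κ≥0 u p i) (≤⇒0≤ (<⇒≤ (∈⟨⟩⁻ (Down? u) (⊆Down (∈⟨⟩⁺ (λ p → C.nb u p ∈? S) nb∈S)))))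
          ... | no nb∉S = ≤-reflexive (sym (trans (cong (_* (h (vt u) - h (C.nb u p))) (C.κ≡0 u
              (∈⟨⟩⁻ (C.OnFace? u (C.trace u S)) (subst (i ∈_) (sym (C.face-trace u isF o∈S)) i∈S) p
                λ p∈ → nb∉S (∈⟨⟩⁻ (λ p → C.nb u p ∈? S) p∈)))) (*-zeroˡ (h (vt u) - h (C.nb u p)))))

        -- The owner is the highest point of S, a vertex by `max-isVertex`. Its edges inside S
        -- cannot ascend, nor be level by genericity.
        own : ∀ {S i} → IsFace V S → i ∈ S → ∃ λ u → vt u ∈ S × C.trace u S ⊆ Down u
        own {S} {i} isF i∈S =
          let k , k∈S , max = argmax (λ i → i ∈? S) h (i , i∈S)
              u , same = rep k (max-isVertex isF k k∈S max)
          in u , face-closed V isF same k∈S , λ {p} p∈ → ∈⟨⟩⁺ (Down? u) (≤∧≢⇒<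
               (subst (h (C.nb u p) ≤_) (Σ-cong λ j → cong (φ j *_) (sym (same j))) (max (C.nb u p) (∈⟨⟩⁻ (λ p → C.nb u p ∈? S) p∈)))
               (h-nb≢ u p))

        shelled : Shelled V
        shelled = record
          { M = M ; vt = vt ; corner = corner ; T = Down ; own = own
          ; unique = λ {S} {u} {v} isF u∈ u⊆ v∈ v⊆ → rep-unique u v (gen (vt u) (vt v)
              (≤-antisym (max-below v isF v∈ v⊆ u∈) (max-below u isF u∈ u⊆ v∈)))
          }

    -- Provides canonical representatives, so that the sweep counts each vertex once however often
    -- `V` lists it.
    first-copy : ∀ i → ∃ λ k → Same V k i × (∀ l → l Fin.< k → ¬ Same V l k)
    first-copy i = go i (Fin.<-wellFounded i)
      where
      go : ∀ i → Acc Fin._<_ i → ∃ λ k → Same V k i × (∀ l → l Fin.< k → ¬ Same V l k)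
      go i (acc rs) with any? (λ l → (l Fin.<? i) ×-dec Same? V i l)
      ... | no none = i , (λ _ → refl) , λ l l<i same → none (l , l<i , same)
      ... | yes (l , l<i , same) with go l (rs l<i)
      ...   | k , same′ , first = k , (λ j → trans (same′ j) (same j)) , first

  -- For finitely many indices a decision of an arbitrary predicate may be assumed when the goal is
  -- a negation. It is applied to being a vertex, which asks for a functional.
  ¬¬-decide : ∀ {m} (P : Fin m → Set) → ¬ ¬ (∀ i → Dec (P i))
  ¬¬-decide {zero}  P k = k λ ()
  ¬¬-decide {suc m} P k = ¬¬-decide (P ∘ suc) λ rest →
    (λ no-P₀ → k λ { zero → no no-P₀ ; (suc i) → rest i }) λ p₀ → k λ { zero → yes p₀ ; (suc i) → rest i }

  -- r u is the number of edges descending from the vertex u for a generic functional; the second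
  -- count is the one of the negative functional.
  BalancedCount : ∀ {d m} → (Fin m → Point d) → Set
  BalancedCount {d} V = ∃ λ M → ∃ λ (r : Fin M → ℕ) → (∀ u → r u ℕ.≤ d) ×
    (∀ k → HasExactly (Σℕ (λ u → r u C k)) (KFace V k) × HasExactly (Σℕ (λ u → (d ℕ.∸ r u) C k)) (KFace V k))

  module _ {d m} (V : Fin m → Point d) (φ : Point d) (gen : Generic V φ) {M} (vt : Fin M → Fin m)
           (corner : ∀ u → Corner V (vt u)) (rep : ∀ i → IsVertex V i → ∃ λ u → Same V (vt u) i)
           (rep-unique : ∀ u v → Same V (vt u) (vt v) → u ≡ v) where

    private
      -φ : Point d
      -φ j = - φ j
      gen- : Generic V -φ
      gen- = generic-neg V φ gen
      nb : Fin M → Fin d → Fin m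
      nb u = Corner.nb (corner u)
      ↓ ↑ : Fin M → Subset d
      ↓ = Down V φ gen vt corner rep rep-unique
      ↑ = Down V -φ gen- vt corner rep rep-unique
      ↓? : ∀ u → Decidable (λ p → dot φ (V (nb u p)) < dot φ (V (vt u)))
      ↓? = Down? V φ gen vt corner rep rep-unique
      ↑? : ∀ u → Decidable (λ p → dot -φ (V (nb u p)) < dot -φ (V (vt u)))
      ↑? = Down? V -φ gen- vt corner rep rep-unique

      -- No edge is level for a generic functional, so each descends for exactly one of φ and its
      -- negative.
      ↑≡∁↓ : ∀ u → ↑ u ≡ ∁ (↓ u)
      ↑≡∁↓ u = ⊆-antisym
        (λ {p} p∈ → x∉p⇒x∈∁p λ p∈₁ → <-asym (∈⟨⟩⁻ (↓? u) p∈₁)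
          (subst₂ _<_ (dbl (V (vt u))) (dbl (V (nb u p))) (neg-antimono-< (∈⟨⟩⁻ (↑? u) p∈))))
        (λ {p} p∈ → ∈⟨⟩⁺ (↑? u) (subst₂ _<_ (sym (dot-neg φ (V (nb u p)))) (sym (dot-neg φ (V (vt u))))
          (neg-antimono-< (≤∧≢⇒< (≮⇒≥ λ lt → x∈∁p⇒x∉p p∈ (∈⟨⟩⁺ (↓? u) lt))
            (h-nb≢ V φ gen vt corner rep rep-unique u p ∘ sym)))))
        where
        lem : ∀ x → - - x ≡ x
        lem = solve-∀ ℚ-ring
        dbl : ∀ x → - dot -φ x ≡ dot φ x
        dbl x = trans (cong -_ (dot-neg φ x)) (lem (dot φ x))

    balanced : BalancedCount V
    balanced = M , (λ u → ∣ ↓ u ∣) , (λ u → ∣p∣≤n (↓ u)) , λ k →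
      Shelled.count-faces (shelled V φ gen vt corner rep rep-unique) k ,
      subst (λ n → HasExactly n (KFace V k)) (Σℕ-cong λ u → cong (_C k) (trans (cong ∣_∣ (↑≡∁↓ u)) (∣∁p∣≡n∸∣p∣ (↓ u))))
        (Shelled.count-faces (shelled V -φ gen- vt corner rep rep-unique) k)

  simple⇒balanced : ∀ {n m} (V : Fin m → Point (suc n)) → IsSimpleDPolytope V → ¬ ¬ BalancedCount V
  simple⇒balanced {n} {m} V simple = λ k → ¬¬-decide (IsVertex V) λ vertex? →
    k (let φ , gen = generic-functional V in balanced V φ gen (vt vertex?) (corner vertex?) (rep vertex?) (rep-unique vertex?))
    where
    module _ (vertex? : ∀ i → Dec (IsVertex V i)) where
      Rep? : Decidable (λ i → IsVertex V i × (∀ l → l Fin.< i → ¬ Same V l i))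
      Rep? i = vertex? i ×-dec all? (λ l → (l Fin.<? i) →-dec ¬? (Same? V i l))
      R : Subset m
      R = ⟨⟩ Rep?
      vt : Fin ∣ R ∣ → Fin m
      vt = elems R
      corner : ∀ u → Corner V (vt u)
      corner u = vertex-corner V simple (vt u) (proj₁ (∈⟨⟩⁻ Rep? (elems-∈ R u)))
      copies-cong : ∀ {i k} → Same V k i → copies V i ≡ copies V k
      copies-cong {i} {k} same = ⊆-antisym
        (λ x∈ → ∈⟨⟩⁺ (Same? V k) λ j → trans (∈⟨⟩⁻ (Same? V i) x∈ j) (sym (same j)))
        (λ x∈ → ∈⟨⟩⁺ (Same? V i) λ j → trans (∈⟨⟩⁻ (Same? V k) x∈ j) (same j))
      rep : ∀ i → IsVertex V i → ∃ λ u → Same V (vt u) i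
      rep i isV =
        let k , same , first = first-copy V i
            u , eq = elems-surjective R (∈⟨⟩⁺ Rep? (subst (KFace V 0) (copies-cong same) isV , first))
        in u , λ j → trans (cong (λ z → V z j) eq) (same j)
      rep-unique : ∀ u v → Same V (vt u) (vt v) → u ≡ v
      rep-unique u v same with Fin.<-cmp (vt u) (vt v)
      ... | tri< lt _ _ = contradiction same (proj₂ (∈⟨⟩⁻ Rep? (elems-∈ R v)) (vt u) lt)
      ... | tri≈ _ eq _ = elems-injective R eq
      ... | tri> _ _ gt = contradiction (λ j → sym (same j)) (proj₂ (∈⟨⟩⁻ Rep? (elems-∈ R u)) (vt v) gt)

-- Binomial congruences modulo G, and divisibility of face numbers.

module Congruences where

  open FinSets using (Σℕ; nC0≡1)
  open import Data.Nat.Base as ℕ using (ℕ; zero; suc; s≤s; z≤n; _∸_; ⌊_/2⌋)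
  import Data.Nat.Properties as ℕ
  open import Data.Nat.Combinatorics using (_C_; nCk+nC[k+1]≡[n+1]C[k+1]; nCn≡1; k>n⇒nCk≡0)
  import Data.Nat.Divisibility as ℕ
  open import Data.Nat.GCD using (gcd; gcd[m,n]∣m; gcd[m,n]∣n)
  open import Data.Fin.Base using (Fin; zero; suc)
  open import Data.Integer.Base using (ℤ; +_; _+_; _*_; -_; _-_; 0ℤ; 1ℤ)
  open import Data.Integer.Properties
  open import Data.Integer.Divisibility.Signed
  open import Data.Integer.Tactic.RingSolver using (solve-∀)
  open import Data.List.Base using (foldr; map)

  C-mono : ∀ k {m n} → m ℕ.≤ n → m C k ℕ.≤ n C k
  C-mono k {m} {n} m≤n = go (ℕ.≤⇒≤′ m≤n)
    where
    step : ∀ n k → n C k ℕ.≤ suc n C k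
    step n zero    = ℕ.≤-reflexive (trans (nC0≡1 n) (sym (nC0≡1 (suc n))))
    step n (suc k) = ℕ.≤-trans (ℕ.m≤n+m (n C suc k) (n C k)) (ℕ.≤-reflexive (nCk+nC[k+1]≡[n+1]C[k+1] n k))
    go : ∀ {n} → m ℕ.≤′ n → m C k ℕ.≤ n C k
    go (ℕ.≤′-reflexive refl) = ℕ.≤-refl
    go (ℕ.≤′-step {n} p)     = ℕ.≤-trans (go p) (step n k)

  b : ℕ → ℕ → ℤ
  b n k = + (n C k)

  pascal : ∀ n k → b (suc n) (suc k) ≡ b n k + b n (suc k)
  pascal n k = trans (cong +_ (sym (nCk+nC[k+1]≡[n+1]C[k+1] n k))) (pos-+ (n C k) (n C suc k))

  ∣-resp : ∀ {g x y} → x ≡ y → g ∣ x → g ∣ y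
  ∣-resp {g} = subst (g ∣_)

  ∣0 : ∀ g → g ∣ 0ℤ
  ∣0 g = divides 0ℤ refl

  +∸ : ∀ {m n} → n ℕ.≤ m → + (m ∸ n) ≡ + m - + n
  +∸ {m} {n} n≤m = sym (trans (m-n≡m⊖n m n) (⊖-≥ n≤m))

  ΣZ : ∀ {M} → (Fin M → ℤ) → ℤ
  ΣZ {zero}  f = 0ℤ
  ΣZ {suc M} f = f zero + ΣZ (f ∘ suc)

  ΣZ-cong : ∀ {M} {f g : Fin M → ℤ} → (∀ u → f u ≡ g u) → ΣZ f ≡ ΣZ g
  ΣZ-cong {zero}  e = refl
  ΣZ-cong {suc M} e = cong₂ _+_ (e zero) (ΣZ-cong (e ∘ suc))

  ΣZ-lin : ∀ {M} a (f g : Fin M → ℤ) → ΣZ (λ u → f u + a * g u) ≡ ΣZ f + a * ΣZ g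
  ΣZ-lin {zero}  a f g = sym (lem a)
    where
    lem : ∀ a → 0ℤ + a * 0ℤ ≡ 0ℤ
    lem = solve-∀
  ΣZ-lin {suc M} a f g = trans (cong (λ z → f zero + a * g zero + z) (ΣZ-lin a (f ∘ suc) (g ∘ suc)))
    (lem (f zero) a (g zero) (ΣZ (f ∘ suc)) (ΣZ (g ∘ suc)))
    where
    lem : ∀ f a g F G → f + a * g + (F + a * G) ≡ f + F + a * (g + G)
    lem = solve-∀

  ΣZ-∣ : ∀ {M g} {f : Fin M → ℤ} → (∀ u → g ∣ f u) → g ∣ ΣZ f
  ΣZ-∣ {zero} {g} p = ∣0 g
  ΣZ-∣ {suc M}  p = ∣m∣n⇒∣m+n (p zero) (ΣZ-∣ (p ∘ suc))

  ΣZ-+ : ∀ {M} (f : Fin M → ℕ) → ΣZ (λ u → + f u) ≡ + Σℕ f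
  ΣZ-+ {zero}  f = refl
  ΣZ-+ {suc M} f = trans (cong (λ z → + f zero + z) (ΣZ-+ (f ∘ suc))) (sym (pos-+ (f zero) (Σℕ (f ∘ suc))))

  -- By Newton interpolation every statistic of a family bounded by d is a combination of its
  -- binomial moments.
  module _ {M} (r s : Fin M → ℕ) (moments : ∀ k → Σℕ (λ u → r u C k) ≡ Σℕ (λ u → s u C k)) where

    interpolate : ∀ D (f : ℕ → ℤ) → ∃ λ h → ΣZ (h ∘ r) ≡ ΣZ (h ∘ s) × (∀ x → x ℕ.≤ D → h x ≡ f x)
    interpolate zero f = (λ _ → f 0) , refl , λ { zero _ → refl }
    interpolate (suc D) f with interpolate D f
    ... | h , eq , agree = (λ x → h x + a * b x (suc D)) ,
        trans (ΣZ-lin a (h ∘ r) (λ u → b (r u) (suc D))) (trans (cong₂ (λ x y → x + a * y) eq moment)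
          (sym (ΣZ-lin a (h ∘ s) (λ u → b (s u) (suc D))))) , agree′
      where
      a = f (suc D) - h (suc D)
      moment : ΣZ (λ u → b (r u) (suc D)) ≡ ΣZ (λ u → b (s u) (suc D))
      moment = trans (ΣZ-+ (λ u → r u C suc D)) (trans (cong +_ (moments (suc D))) (sym (ΣZ-+ (λ u → s u C suc D))))
      lem₁ : ∀ h a → h + a * 0ℤ ≡ h
      lem₁ = solve-∀
      lem₂ : ∀ h f → h + (f - h) * 1ℤ ≡ f
      lem₂ = solve-∀
      agree′ : ∀ x → x ℕ.≤ suc D → h x + a * b x (suc D) ≡ f x
      agree′ x x≤ with ℕ.m≤n⇒m<n∨m≡n x≤
      ... | inj₁ x<sD@(s≤s x≤D) = trans (cong (λ z → h x + a * + z) (k>n⇒nCk≡0 x<sD)) (trans (lem₁ (h x) a) (agree x x≤D))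
      ... | inj₂ refl = trans (cong (λ z → h x + a * + z) (nCn≡1 x)) (lem₂ (h x) (f x))

    statistics : ∀ {d} → (∀ u → r u ℕ.≤ d) → (∀ u → s u ℕ.≤ d) → ∀ f → ΣZ (f ∘ r) ≡ ΣZ (f ∘ s)
    statistics {d} r≤ s≤ f with interpolate d f
    ... | h , eq , agree = trans (ΣZ-cong λ u → sym (agree (r u) (r≤ u))) (trans eq (ΣZ-cong λ u → agree (s u) (s≤ u)))

  -- i ↦ C(e−i,k) + s C(i,k) is a polynomial of degree at most k,
  -- so k+1 consecutive zeros modulo g force the next value to be zero as well.
  extrapolate : ∀ g k e s → k ℕ.< e → (∀ i → 1 ℕ.≤ i → i ℕ.≤ suc k → g ∣ b (e ∸ i) k + s * b i k) →
                g ∣ b e k + s * b 0 k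
  extrapolate g zero e s _ zeros = ∣-resp (cong₂ (λ x y → + x + s * + y) (trans (nC0≡1 (e ∸ 1)) (sym (nC0≡1 e))) refl)
    (zeros 1 ℕ.≤-refl ℕ.≤-refl)
  extrapolate g (suc k) (suc e) s (s≤s k<e) zeros = ∣-resp (sym h₀) (∣m∣n⇒∣m+n (zeros 1 ℕ.≤-refl (s≤s z≤n)) ih)
    where
    h h′ : ℕ → ℤ
    h  i = b (suc e ∸ i) (suc k) + s * b i (suc k)
    -- By Pascal's rule h i - h (i + 1) has the same shape as h, one degree lower and with the sign
    -- of s reversed.
    h′ i = b (e ∸ i) k + - s * b i k
    lem : ∀ x y s z w → x + y + s * z ≡ (y + s * (w + z)) + (x + - s * w)
    lem = solve-∀
    diff : ∀ i → i ℕ.≤ e → h i ≡ h (suc i) + h′ i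
    diff i i≤e = trans (cong (λ z → z + s * b i (suc k))
        (trans (cong (λ z → b z (suc k)) (ℕ.+-∸-assoc 1 i≤e)) (pascal (e ∸ i) k)))
      (trans (lem (b (e ∸ i) k) (b (e ∸ i) (suc k)) s (b i (suc k)) (b i k))
        (cong (λ z → b (e ∸ i) (suc k) + s * z + h′ i) (sym (pascal i k))))
    h₀ : h 0 ≡ h 1 + h′ 0
    h₀ = diff 0 z≤n
    ih : g ∣ h′ 0
    ih = extrapolate g k e (- s) k<e λ i 1≤i i≤ →
      ∣m+n∣m⇒∣n (∣-resp (diff i (ℕ.≤-trans i≤ k<e)) (zeros i 1≤i (ℕ.m≤n⇒m≤1+n i≤)))
                (zeros (suc i) (s≤s z≤n) (s≤s i≤))

  foldr-gcd-∣ : ∀ (f : ℕ → ℕ) n i → 1 ℕ.≤ i → i ℕ.≤ n → foldr gcd 0 (map f (oneTo n)) ℕ.∣ f i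
  foldr-gcd-∣ f zero    zero    () _
  foldr-gcd-∣ f (suc n) i 1≤i i≤ with ℕ.m≤n⇒m<n∨m≡n i≤
  ... | inj₂ refl      = gcd[m,n]∣m (f (suc n)) (foldr gcd 0 (map f (oneTo n)))
  ... | inj₁ (s≤s i≤n) = ℕ.∣-trans (gcd[m,n]∣n (f (suc n)) (foldr gcd 0 (map f (oneTo n)))) (foldr-gcd-∣ f n i 1≤i i≤n)

  module _ (d k : ℕ) (2≤d : 2 ℕ.≤ d) (k<d : k ℕ.< d) where

    private
      g = + G d k
      K = suc k

    n+n≤m⇒n≤⌊m/2⌋ : ∀ {n m} → n ℕ.+ n ℕ.≤ m → n ℕ.≤ ⌊ m /2⌋
    n+n≤m⇒n≤⌊m/2⌋ {n} p = ℕ.≤-trans (ℕ.≤-reflexive (ℕ.n≡⌊n+n/2⌋ n)) (ℕ.⌊n/2⌋-mono p)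

    G∣mik : ∀ i → 1 ℕ.≤ i → i ℕ.+ i ℕ.≤ d → g ∣ b (suc d ∸ i) K - b i K
    G∣mik i 1≤i i+i≤d = ∣-resp (+∸ (C-mono K i≤)) (∣ᵤ⇒∣ (foldr-gcd-∣ (λ i → mik d i k) ⌊ d /2⌋ i 1≤i (n+n≤m⇒n≤⌊m/2⌋ i+i≤d)))
      where
      i≤ : i ℕ.≤ suc d ∸ i
      i≤ = ℕ.m+n≤o⇒m≤o∸n i (ℕ.m≤n⇒m≤1+n i+i≤d)

    -- Exchanging i and d + 1 - i reverses the sign of the difference, so the indices in the
    -- definition of G suffice; at a fixed point the difference is 0.
    G∣antisymmetric : ∀ i → 1 ℕ.≤ i → i ℕ.≤ d → g ∣ b (suc d ∸ i) K - b i K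
    G∣antisymmetric i 1≤i i≤d with ℕ.<-cmp i (suc d ∸ i)
    ... | tri≈ _ eq _ = ∣-resp (sym (i≡j⇒i-j≡0 {b (suc d ∸ i) K} {b i K} (cong (λ z → b z K) (sym eq)))) (∣0 g)
    ... | tri< i< _ _ = G∣mik i 1≤i (ℕ.≤-pred (ℕ.≤-trans (ℕ.+-monoˡ-< i i<) (ℕ.≤-reflexive (ℕ.m∸n+n≡m (ℕ.m≤n⇒m≤1+n i≤d)))))
    ... | tri> _ _ >i = ∣-resp (trans (cong (λ z → - (b z K - b i′ K)) (ℕ.m∸[m∸n]≡n (ℕ.m≤n⇒m≤1+n i≤d))) (lem (b i K) (b i′ K)))
          (∣m⇒∣-m (G∣mik i′ (ℕ.m+n≤o⇒m≤o∸n 1 (s≤s i≤d))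
            (ℕ.≤-pred (ℕ.≤-trans (ℕ.+-monoʳ-< i′ >i) (ℕ.≤-reflexive (ℕ.m∸n+n≡m (ℕ.m≤n⇒m≤1+n i≤d)))))))
      where
      i′ = suc d ∸ i
      lem : ∀ x y → - (x - y) ≡ y - x
      lem = solve-∀

    -- For k + 2 ≤ d the indices 1, ..., k + 2 are zeros modulo G of a polynomial of degree at most
    -- k + 1, which therefore vanishes at 0 too.
    G∣m₀ : g ∣ b (suc d) K
    G∣m₀ with suc (suc k) ℕ.≤? d
    ... | yes k+2≤d = ∣-resp (lem (b (suc d) K)) (extrapolate g K (suc d) (- 1ℤ) (s≤s k<d)
          λ i 1≤i i≤ → ∣-resp (lem₁ (b (suc d ∸ i) K) (b i K)) (G∣antisymmetric i 1≤i (ℕ.≤-trans i≤ k+2≤d)))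
      where
      lem : ∀ x → x + - 1ℤ * 0ℤ ≡ x
      lem = solve-∀
      lem₁ : ∀ x y → x - y ≡ x + - 1ℤ * y
      lem₁ = solve-∀
    -- Now k + 1 = d, hence m_1 = 1 and G divides everything.
    ... | no k+2≰d = ∣-trans (∣-resp one (G∣antisymmetric 1 ℕ.≤-refl (ℕ.≤-trans (s≤s z≤n) 2≤d)))
                       (divides (b (suc d) K) (sym (*-identityʳ (b (suc d) K))))
      where
      K≡d : K ≡ d
      K≡d = ℕ.≤-antisym k<d (ℕ.≤-pred (ℕ.≰⇒> k+2≰d))
      one : b d K - b 1 K ≡ 1ℤ
      one = cong₂ (λ x y → + x - + y) (trans (cong (d C_) K≡d) (nCn≡1 d))
              (k>n⇒nCk≡0 (ℕ.≤-trans 2≤d (ℕ.≤-reflexive (sym K≡d))))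

    G∣difference : ∀ i → i ℕ.≤ suc d → g ∣ b (suc d ∸ i) K - b i K
    G∣difference zero    _ = ∣-resp (lem (b (suc d) K)) G∣m₀
      where
      lem : ∀ x → x ≡ x - 0ℤ
      lem = solve-∀
    G∣difference (suc i) i≤ with ℕ.m≤n⇒m<n∨m≡n i≤
    ... | inj₁ (s≤s i<d) = G∣antisymmetric (suc i) (s≤s z≤n) i<d
    ... | inj₂ refl      = ∣-resp (trans (lem (b (suc d) K)) (cong (λ z → b z K - b (suc d) K) (sym (ℕ.n∸n≡0 d)))) (∣m⇒∣-m G∣m₀)
      where
      lem : ∀ x → - x ≡ 0ℤ - x
      lem = solve-∀

    -- By Pascal's rule this is the difference between the values of `G∣difference` at x and at x +
    -- 1.
    G∣pair : ∀ x → x ℕ.≤ d → g ∣ b x k + b (d ∸ x) k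
    G∣pair x x≤d = ∣-resp eq (∣m∣n⇒∣m-n (G∣difference x (ℕ.m≤n⇒m≤1+n x≤d)) (G∣difference (suc x) (s≤s x≤d)))
      where
      lem : ∀ p q r s → (p + q - r) - (q - (s + r)) ≡ s + p
      lem = solve-∀
      eq : (b (suc d ∸ x) K - b x K) - (b (d ∸ x) K - b (suc x) K) ≡ b x k + b (d ∸ x) k
      eq = trans (cong₂ (λ y z → (y - b x K) - (b (d ∸ x) K - z))
                   (trans (cong (λ z → b z K) (ℕ.+-∸-assoc 1 x≤d)) (pascal (d ∸ x) k)) (pascal x k))
                 (lem (b (d ∸ x) k) (b (d ∸ x) K) (b x K) (b x k))

    -- `G∣pair` would only give twice this number; but for d = 2x, m_x itself is C(x + 1, k + 1) -
    -- C(x, k + 1) = C(x, k).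
    G∣middle : ∀ x → 1 ℕ.≤ x → x ℕ.+ x ≡ d → g ∣ b x k
    G∣middle x 1≤x refl = ∣-resp eq (G∣mik x 1≤x ℕ.≤-refl)
      where
      lem : ∀ p q → p + q - q ≡ p
      lem = solve-∀
      eq : b (suc (x ℕ.+ x) ∸ x) K - b x K ≡ b x k
      eq = trans (cong (_- b x K) (trans (cong (λ z → b z K) (trans (ℕ.+-∸-assoc 1 (ℕ.m≤m+n x x)) (cong suc (ℕ.m+n∸m≡n x x)))) (pascal x k)))
                 (lem (b x k) (b x K))

    G∣Σ : ∀ {M} (r : Fin M → ℕ) → (∀ u → r u ℕ.≤ d) →
          (∀ j → Σℕ (λ u → r u C j) ≡ Σℕ (λ u → (d ∸ r u) C j)) → G d k ℕ.∣ Σℕ (λ u → r u C k)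
    G∣Σ {M} r r≤d moments = ∣⇒∣ᵤ (∣-resp total (ΣZ-∣ λ u → term (r u) (r≤d u)))
      where
      upper : ℕ → ℤ
      upper x with d ℕ.<? x ℕ.+ x
      ... | yes _ = b x k
      ... | no _  = 0ℤ
      upper-yes : ∀ x → d ℕ.< x ℕ.+ x → upper x ≡ b x k
      upper-yes x p with d ℕ.<? x ℕ.+ x
      ... | yes _ = refl
      ... | no ¬p = contradiction p ¬p
      upper-no : ∀ x → x ℕ.+ x ℕ.≤ d → upper x ≡ 0ℤ
      upper-no x p with d ℕ.<? x ℕ.+ x
      ... | yes q = contradiction p (ℕ.<⇒≱ q)
      ... | no _  = refl
      -- Balance permits moving the contribution of r > d/2 to the mirror value d - r. So F has the
      -- same total as C(·, k), but its value is 0 above d/2, C(x, k) + C(d - x, k) below, and C(x,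
      -- k) at d/2.
      F : ℕ → ℤ
      F x = (b x k + - 1ℤ * upper x) + 1ℤ * upper (d ∸ x)
      double : ∀ x → x ℕ.≤ d → (d ∸ x ℕ.+ (d ∸ x)) ℕ.+ (x ℕ.+ x) ≡ d ℕ.+ d
      double x x≤d = trans (ℕ-lem (d ∸ x) x) (cong₂ ℕ._+_ (ℕ.m∸n+n≡m x≤d) (ℕ.m∸n+n≡m x≤d))
        where
        open import Data.Nat.Tactic.RingSolver renaming (solve-∀ to solveℕ-∀)
        ℕ-lem : ∀ y x → (y ℕ.+ y) ℕ.+ (x ℕ.+ x) ≡ (y ℕ.+ x) ℕ.+ (y ℕ.+ x)
        ℕ-lem = solveℕ-∀
      lem₁ : ∀ p → (p + - 1ℤ * p) + 1ℤ * 0ℤ ≡ 0ℤ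
      lem₁ = solve-∀
      lem₂ : ∀ p → (p + - 1ℤ * 0ℤ) + 1ℤ * 0ℤ ≡ p
      lem₂ = solve-∀
      lem₃ : ∀ p q → (p + - 1ℤ * 0ℤ) + 1ℤ * q ≡ p + q
      lem₃ = solve-∀
      F-val : ∀ {x u v} → upper x ≡ u → upper (d ∸ x) ≡ v → F x ≡ (b x k + - 1ℤ * u) + 1ℤ * v
      F-val {x} = cong₂ (λ u v → (b x k + - 1ℤ * u) + 1ℤ * v)
      term : ∀ x → x ℕ.≤ d → g ∣ F x
      term x x≤d with ℕ.<-cmp (x ℕ.+ x) d
      ... | tri< lt _ _ = ∣-resp (sym (trans (F-val {x} (upper-no x (ℕ.<⇒≤ lt))
            (upper-yes (d ∸ x) (ℕ.≰⇒> λ le → ℕ.<-irrefl (double x x≤d) (ℕ.+-mono-≤-< le lt)))) (lem₃ (b x k) (b (d ∸ x) k))))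
            (G∣pair x x≤d)
      ... | tri≈ _ eq _ = ∣-resp (sym (trans (F-val {x} (upper-no x (ℕ.≤-reflexive eq))
            (upper-no (d ∸ x) (ℕ.≤-reflexive (ℕ.+-cancelʳ-≡ d (d ∸ x ℕ.+ (d ∸ x)) d
              (trans (cong ((d ∸ x ℕ.+ (d ∸ x)) ℕ.+_) (sym eq)) (double x x≤d)))))) (lem₂ (b x k))))
            (G∣middle x (pos x eq) eq)
        where
        pos : ∀ x → x ℕ.+ x ≡ d → 1 ℕ.≤ x
        pos zero    refl = contradiction 2≤d λ ()
        pos (suc x) _    = s≤s z≤n
      ... | tri> _ _ gt = ∣-resp (sym (trans (F-val {x} (upper-yes x gt)
            (upper-no (d ∸ x) (ℕ.≮⇒≥ λ lt → ℕ.<-irrefl (sym (double x x≤d)) (ℕ.+-mono-< lt gt)))) (lem₁ (b x k)))) (∣0 g)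
      lem₄ : ∀ s u → (s + - 1ℤ * u) + 1ℤ * u ≡ s
      lem₄ = solve-∀
      total : ΣZ (λ u → F (r u)) ≡ + Σℕ (λ u → r u C k)
      total = trans (ΣZ-lin 1ℤ (λ u → b (r u) k + - 1ℤ * upper (r u)) (λ u → upper (d ∸ r u)))
        (trans (cong₂ (λ p q → p + 1ℤ * q) (ΣZ-lin (- 1ℤ) (λ u → b (r u) k) (λ u → upper (r u)))
                 (sym (statistics r (λ u → d ∸ r u) moments r≤d (λ u → ℕ.m∸n≤m d (r u)) upper)))
          (trans (lem₄ (ΣZ (λ u → b (r u) k)) (ΣZ (λ u → upper (r u)))) (ΣZ-+ (λ u → r u C k))))

-- Numerical semigroups, and face counts of products of simplices.

module Semigroup where

  open FinSets using (Σℕ; Σℕ-cong)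
  open Congruences using (C-mono; ∣-resp; +∸)
  open import Data.Nat.Base
  open import Data.Nat.Properties
  open import Data.Nat.Combinatorics using (_C_; nCk+nC[k+1]≡[n+1]C[k+1]; k>n⇒nCk≡0)
  open import Data.Nat.Divisibility using (_∣_; divides; ∣m∣n⇒∣m+n; ∣-trans; ∣-refl)
  open import Data.Nat.DivMod using (_%_; _/_; m≡m%n+[m/n]*n; m%n<n)
  open import Data.Nat.GCD using (gcd; gcd[m,n]∣m; gcd[m,n]∣n; gcd-identityʳ; gcd-GCD; gcd[m,n]≢0; module Bézout)
  open import Data.Nat.Tactic.RingSolver using (solve-∀)
  open import Data.Fin.Base as Fin using (Fin; toℕ)
  import Data.Integer.Base as ℤ
  import Data.Integer.Properties as ℤ
  import Data.Integer.Divisibility.Signed as ℤ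
  import Data.Integer.Tactic.RingSolver as ℤ-Solver
  open import Data.List.Base using (foldr; map)

  private
    +* : ∀ m n p → ℤ.+ (m + n * p) ≡ ℤ.+ m ℤ.+ ℤ.+ n ℤ.* ℤ.+ p
    +* m n p = trans (ℤ.pos-+ m (n * p)) (cong (ℤ._+_ (ℤ.+ m)) (ℤ.pos-* n p))

  -- Solvability of y m ≡ n modulo g by Bézout. The bound y < g keeps the threshold in
  -- `eventually-gcd` independent of the number to be represented.
  congruent-multiple : ∀ m g .{{_ : NonZero g}} n → gcd m g ∣ n →
                       ∃ λ y → y < g × ℤ.+ g ℤ.∣ ℤ.+ n ℤ.- ℤ.+ y ℤ.* ℤ.+ m
  congruent-multiple m g n (divides q refl) = let y₀ , y₀-ok = raw in
      y₀ % g , m%n<n y₀ g , ∣-resp (reduce y₀) (ℤ.∣m∣n⇒∣m+n y₀-ok (ℤ.∣n⇒∣m*n (ℤ.+ (y₀ / g) ℤ.* ℤ.+ m) ℤ.∣-refl))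
    where
    D = gcd m g
    lem : ∀ n r w m g → (n ℤ.- (r ℤ.+ w ℤ.* g) ℤ.* m) ℤ.+ (w ℤ.* m) ℤ.* g ≡ n ℤ.- r ℤ.* m
    lem = ℤ-Solver.solve-∀
    reduce : ∀ y₀ → (ℤ.+ (q * D) ℤ.- ℤ.+ y₀ ℤ.* ℤ.+ m) ℤ.+ (ℤ.+ (y₀ / g) ℤ.* ℤ.+ m) ℤ.* ℤ.+ g
                  ≡ ℤ.+ (q * D) ℤ.- ℤ.+ (y₀ % g) ℤ.* ℤ.+ m
    reduce y₀ = trans (cong (λ z → (ℤ.+ (q * D) ℤ.- z ℤ.* ℤ.+ m) ℤ.+ (ℤ.+ (y₀ / g) ℤ.* ℤ.+ m) ℤ.* ℤ.+ g)
        (trans (cong ℤ.+_ (m≡m%n+[m/n]*n y₀ g)) (+* (y₀ % g) (y₀ / g) g)))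
      (lem (ℤ.+ (q * D)) (ℤ.+ (y₀ % g)) (ℤ.+ (y₀ / g)) (ℤ.+ m) (ℤ.+ g))
    raw : ∃ λ y₀ → ℤ.+ g ℤ.∣ ℤ.+ (q * D) ℤ.- ℤ.+ y₀ ℤ.* ℤ.+ m
    raw with Bézout.identity (gcd-GCD m g)
    ... | Bézout.+- x y eq = q * x , ℤ.divides (ℤ.- (ℤ.+ q ℤ.* ℤ.+ y)) (trans
        (cong₂ (λ u v → u ℤ.- v ℤ.* ℤ.+ m) (ℤ.pos-* q D) (ℤ.pos-* q x))
        (trans (lem₁ (ℤ.+ q) (ℤ.+ D) (ℤ.+ x) (ℤ.+ m) (ℤ.+ y) (ℤ.+ g))
          (trans (cong (λ z → ℤ.+ q ℤ.* (z ℤ.- ℤ.+ x ℤ.* ℤ.+ m) ℤ.+ ℤ.- (ℤ.+ q ℤ.* ℤ.+ y) ℤ.* ℤ.+ g)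
                   (trans (sym (+* D y g)) (trans (cong ℤ.+_ eq) (ℤ.pos-* x m))))
            (lem₂ (ℤ.+ q) (ℤ.+ x ℤ.* ℤ.+ m) (ℤ.- (ℤ.+ q ℤ.* ℤ.+ y) ℤ.* ℤ.+ g)))))
      where
      lem₁ : ∀ q D x m y g → q ℤ.* D ℤ.- q ℤ.* x ℤ.* m ≡ q ℤ.* ((D ℤ.+ y ℤ.* g) ℤ.- x ℤ.* m) ℤ.+ ℤ.- (q ℤ.* y) ℤ.* g
      lem₁ = ℤ-Solver.solve-∀
      lem₂ : ∀ q z w → q ℤ.* (z ℤ.- z) ℤ.+ w ≡ w
      lem₂ = ℤ-Solver.solve-∀
    -- Here D + x m = y g, so the coefficient wanted is -x; the factor g - 1 serves as -1 modulo g.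
    ... | Bézout.-+ x y eq = q * x * pred g , ℤ.divides (ℤ.+ q ℤ.* ℤ.+ y ℤ.- ℤ.+ q ℤ.* ℤ.+ x ℤ.* ℤ.+ m) (trans
        (cong₂ (λ u v → u ℤ.- v ℤ.* ℤ.+ m) (ℤ.pos-* q D)
          (trans (ℤ.pos-* (q * x) (pred g)) (cong₂ ℤ._*_ (ℤ.pos-* q x) pred-g)))
        (trans (lem₁ (ℤ.+ q) (ℤ.+ D) (ℤ.+ x) (ℤ.+ m) (ℤ.+ y) (ℤ.+ g))
          (trans (cong (λ z → ℤ.+ q ℤ.* (z ℤ.- ℤ.+ y ℤ.* ℤ.+ g) ℤ.+ (ℤ.+ q ℤ.* ℤ.+ y ℤ.- ℤ.+ q ℤ.* ℤ.+ x ℤ.* ℤ.+ m) ℤ.* ℤ.+ g)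
                   (trans (sym (+* D x m)) (trans (cong ℤ.+_ eq) (ℤ.pos-* y g))))
            (lem₂ (ℤ.+ q) (ℤ.+ y ℤ.* ℤ.+ g) ((ℤ.+ q ℤ.* ℤ.+ y ℤ.- ℤ.+ q ℤ.* ℤ.+ x ℤ.* ℤ.+ m) ℤ.* ℤ.+ g)))))
      where
      pred-g : ℤ.+ pred g ≡ ℤ.+ g ℤ.- ℤ.1ℤ
      pred-g = trans (cong ℤ.+_ (sym (pred≡∸1 g))) (+∸ (>-nonZero⁻¹ g))
        where
        pred≡∸1 : ∀ g → g ∸ 1 ≡ pred g
        pred≡∸1 zero    = refl
        pred≡∸1 (suc g) = refl
      lem₁ : ∀ q D x m y g → q ℤ.* D ℤ.- q ℤ.* x ℤ.* (g ℤ.- ℤ.1ℤ) ℤ.* m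
           ≡ q ℤ.* ((D ℤ.+ x ℤ.* m) ℤ.- y ℤ.* g) ℤ.+ (q ℤ.* y ℤ.- q ℤ.* x ℤ.* m) ℤ.* g
      lem₁ = ℤ-Solver.solve-∀
      lem₂ : ∀ q z w → q ℤ.* (z ℤ.- z) ℤ.+ w ≡ w
      lem₂ = ℤ-Solver.solve-∀

  module _ (P : ℕ → Set) where

    -- Increments are tracked instead of values, because increments valid at every starting point
    -- can be added.
    Shift : ℕ → Set
    Shift s = ∀ n → P n → P (n + s)

    Shift-+ : ∀ {s t} → Shift s → Shift t → Shift (s + t)
    Shift-+ {s} {t} σ τ n p = subst P (+-assoc n s t) (τ (n + s) (σ n p))

    Shift-* : ∀ q {s} → Shift s → Shift (q * s)
    Shift-* zero    σ n p = subst P (sym (+-identityʳ n)) p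
    Shift-* (suc q) σ = Shift-+ σ (Shift-* q σ)

    Eventually : ℕ → Set
    Eventually g = ∃ λ N → ∀ s → N ≤ s → g ∣ s → Shift s

    eventually-self : ∀ {g} → Shift g → Eventually g
    eventually-self σ = 0 , λ { s _ (divides q refl) → Shift-* q σ }

    -- Modulo g the increment c + m is m. Fewer than g copies of it reach the right residue; what
    -- remains is a multiple of g, and at least N thanks to the summand g a of the threshold.
    eventually-gcd : ∀ {g m c} → g ≢ 0 → Eventually g → g ∣ c → Shift (c + m) → Eventually (gcd m g)
    eventually-gcd {g} {m} {c} g≢0 (N , ev) (divides w refl) σ = N + g * a , λ s N≤s D∣s →
        let y , y<g , g∣ = congruent-multiple m g {{≢-nonZero g≢0}} s D∣s
            ya≤ : y * a ≤ g * a
            ya≤ = *-monoˡ-≤ a (<⇒≤ y<g)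
            ya≤s : y * a ≤ s
            ya≤s = ≤-trans ya≤ (≤-trans (m≤n+m (g * a) N) N≤s)
            rest : Shift (s ∸ y * a)
            rest = ev (s ∸ y * a) (m+n≤o⇒m≤o∸n N (≤-trans (+-monoʳ-≤ N ya≤) N≤s))
                     (ℤ.∣⇒∣ᵤ (∣-resp (sym (trans (+∸ ya≤s) (cong (λ z → ℤ.+ s ℤ.- z) (ya y))))
                       (∣-resp (lem (ℤ.+ s) (ℤ.+ y) (ℤ.+ m) (ℤ.+ w) (ℤ.+ g))
                         (ℤ.∣m∣n⇒∣m+n g∣ (ℤ.∣n⇒∣m*n (ℤ.- (ℤ.+ y ℤ.* ℤ.+ w)) ℤ.∣-refl)))))
        in subst Shift (m∸n+n≡m ya≤s) (Shift-+ rest (Shift-* y σ))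
      where
      a = w * g + m
      ya : ∀ y → ℤ.+ (y * a) ≡ ℤ.+ y ℤ.* (ℤ.+ w ℤ.* ℤ.+ g ℤ.+ ℤ.+ m)
      ya y = trans (ℤ.pos-* y a) (cong (ℤ._*_ (ℤ.+ y)) (trans (ℤ.pos-+ (w * g) m) (cong (ℤ._+ ℤ.+ m) (ℤ.pos-* w g))))
      lem : ∀ s y m w g → (s ℤ.- y ℤ.* m) ℤ.+ ℤ.- (y ℤ.* w) ℤ.* g ≡ s ℤ.- y ℤ.* (w ℤ.* g ℤ.+ m)
      lem = ℤ-Solver.solve-∀

    module _ (f : ℕ → ℕ) (Δ : ℕ → ℕ) (f₁≢0 : f 1 ≢ 0) (Δ₀ : Δ 0 ≡ f 1) (Δ-suc : ∀ i → Δ (suc i) ≡ Δ i + f (suc i)) where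

      private
        H : ℕ → ℕ
        H n = foldr gcd 0 (map f (oneTo n))

        H₁ : H 1 ≡ f 1
        H₁ = gcd-identityʳ (f 1)

        H≢0 : ∀ n → H (suc n) ≢ 0
        H≢0 zero    = subst (_≢ 0) (sym H₁) f₁≢0
        H≢0 (suc n) = gcd[m,n]≢0 (f (suc (suc n))) (H (suc n)) (inj₂ (H≢0 n))

        H∣Δ : ∀ n → H (suc n) ∣ Δ (suc n)
        H∣Δ zero    = subst₂ _∣_ (sym H₁) (sym (trans (Δ-suc 0) (cong (_+ f 1) Δ₀))) (∣m∣n⇒∣m+n ∣-refl ∣-refl)
        H∣Δ (suc n) = subst (H (suc (suc n)) ∣_) (sym (Δ-suc (suc n)))
          (∣m∣n⇒∣m+n (∣-trans (gcd[m,n]∣n (f (suc (suc n))) (H (suc n))) (H∣Δ n)) (gcd[m,n]∣m (f (suc (suc n))) (H (suc n))))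

      -- The gcd of the earlier f divides the preceding Δ, so the next Δ is congruent to the next f
      -- modulo it and adjoins that f to the gcd. The induction starts from Δ 0 = f 1.
      eventually-all : ∀ n → (∀ i → i ≤ suc n → Shift (Δ i)) → Eventually (H (suc n))
      eventually-all zero    σ = subst Eventually (sym H₁) (eventually-self (subst Shift Δ₀ (σ 0 z≤n)))
      eventually-all (suc n) σ = eventually-gcd (H≢0 n) (eventually-all n λ i i≤ → σ i (m≤n⇒m≤1+n i≤)) (H∣Δ n)
        (subst Shift (Δ-suc (suc n)) (σ (suc (suc n)) ≤-refl))

  Σℕ-+ : ∀ {n} (f g : Fin n → ℕ) → Σℕ (λ i → f i + g i) ≡ Σℕ f + Σℕ g
  Σℕ-+ {zero}  f g = refl
  Σℕ-+ {suc n} f g = trans (cong (f Fin.zero + g Fin.zero +_) (Σℕ-+ (f ∘ Fin.suc) (g ∘ Fin.suc)))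
    (lem (f Fin.zero) (g Fin.zero) (Σℕ (f ∘ Fin.suc)) (Σℕ (g ∘ Fin.suc)))
    where
    lem : ∀ a b c d → a + b + (c + d) ≡ a + c + (b + d)
    lem = solve-∀

  Σℕ-snoc : ∀ n (f : ℕ → ℕ) → Σℕ {suc n} (f ∘ toℕ) ≡ Σℕ {n} (f ∘ toℕ) + f n
  Σℕ-snoc zero    f = +-identityʳ (f 0)
  Σℕ-snoc (suc n) f = trans (cong (f 0 +_) (Σℕ-snoc n (f ∘ suc))) (sym (+-assoc (f 0) (Σℕ {n} (f ∘ suc ∘ toℕ)) (f (suc n))))

  module _ (k : ℕ) where

    hockey-stick : ∀ s n → Σℕ {n} (λ t → (s + toℕ t) C k) + s C suc k ≡ (s + n) C suc k
    hockey-stick s zero    = cong (_C suc k) (sym (+-identityʳ s))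
    hockey-stick s (suc n) = begin
      Σℕ {suc n} (λ t → (s + toℕ t) C k) + s C suc k         ≡⟨ cong (_+ s C suc k) (Σℕ-snoc n (λ t → (s + t) C k)) ⟩
      Σℕ {n} (λ t → (s + toℕ t) C k) + (s + n) C k + s C suc k ≡⟨ lem (Σℕ {n} (λ t → (s + toℕ t) C k)) ((s + n) C k) (s C suc k) ⟩
      (s + n) C k + (Σℕ {n} (λ t → (s + toℕ t) C k) + s C suc k) ≡⟨ cong ((s + n) C k +_) (hockey-stick s n) ⟩
      (s + n) C k + (s + n) C suc k                          ≡⟨ nCk+nC[k+1]≡[n+1]C[k+1] (s + n) k ⟩
      suc (s + n) C suc k                                    ≡⟨ cong (_C suc k) (+-suc s n) ⟨
      (s + suc n) C suc k                                    ∎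
      where
      open ≡-Reasoning
      lem : ∀ a b c → a + b + c ≡ b + (a + c)
      lem = solve-∀

    -- The number of k-faces of a product of simplices of dimensions α and β.
    W : ℕ → ℕ → ℕ
    W α β = Σℕ {suc α} (λ s → Σℕ {suc β} (λ t → (toℕ s + toℕ t) C k))

    -- Both sides extend the same rectangle, one by a row and the other by a column. By the
    -- hockey-stick identity the row with C(α + 1, k + 1) and the column with C(β + 1, k + 1) both
    -- make C(α + β + 2, k + 1).
    W-shift : ∀ α β → W (suc α) β + suc α C suc k ≡ W α (suc β) + suc β C suc k
    W-shift α β = +-cancelʳ-≡ c (W (suc α) β + suc α C suc k) (W α (suc β) + suc β C suc k) (begin
      W (suc α) β + suc α C suc k + c
        ≡⟨ cong (λ z → z + suc α C suc k + c) (Σℕ-snoc (suc α) (λ s → Σℕ {suc β} (λ t → (s + toℕ t) C k))) ⟩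
      W α β + row + suc α C suc k + c
        ≡⟨ lem₁ (W α β) row (suc α C suc k) c ⟩
      W α β + c + (row + suc α C suc k)
        ≡⟨ cong₂ _+_ split (trans (hockey-stick (suc α) (suc β)) (sym (trans (hockey-stick (suc β) (suc α)) (cong (_C suc k) (+-comm (suc β) (suc α)))))) ⟩
      W α (suc β) + (c + suc β C suc k)
        ≡⟨ lem₂ (W α (suc β)) c (suc β C suc k) ⟩
      W α (suc β) + suc β C suc k + c ∎)
      where
      open ≡-Reasoning
      row = Σℕ {suc β} (λ t → (suc α + toℕ t) C k)
      c = Σℕ {suc α} (λ s → (suc β + toℕ s) C k)
      lem₁ : ∀ w r p c → w + r + p + c ≡ w + c + (r + p)
      lem₁ = solve-∀
      lem₂ : ∀ w c p → w + (c + p) ≡ w + p + c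
      lem₂ = solve-∀
      split : W α β + c ≡ W α (suc β)
      split = trans (sym (Σℕ-+ {suc α} (λ s → Σℕ {suc β} (λ t → (toℕ s + toℕ t) C k)) (λ s → (suc β + toℕ s) C k)))
        (Σℕ-cong {suc α} λ s → trans (cong (λ z → Σℕ {suc β} (λ t → (toℕ s + toℕ t) C k) + z C k) (+-comm (suc β) (toℕ s)))
          (sym (Σℕ-snoc (suc β) (λ t → (toℕ s + t) C k))))

    -- The gain in k-faces from one gluing. The value at 0 belongs to the truncation of a vertex,
    -- and the step to 1 adds m_1 a second time.
    Δ : ℕ → ℕ → ℕ
    Δ d zero    = mik d 1 k
    Δ d (suc α) = Δ d α + mik d (suc α) k

    simplex-count : ∀ d → Σℕ {suc d} (λ s → toℕ s C k) ≡ suc d C suc k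
    simplex-count d = trans (sym (+-identityʳ (Σℕ {suc d} (λ s → toℕ s C k))))
      (trans (cong (Σℕ {suc d} (λ s → toℕ s C k) +_) (sym (k>n⇒nCk≡0 {0} {suc k} (s≤s z≤n)))) (hockey-stick 0 (suc d)))

    -- Induction on α at fixed d: by `W-shift`, raising the first factor to dimension α at the
    -- expense of the second changes W by m_α. The bound α ≤ β + 1 makes the truncated differences
    -- exact, and the two binomials on the left account for the two vertices lost in gluing.
    Δ-W : ∀ d α β → 1 ≤ d → α ≤ suc β → α + β ≡ d → Δ d α + (0 C k + d C k) ≡ W α β
    Δ-W d zero β 1≤d _ refl = begin
      (d C suc k ∸ 1 C suc k) + (0 C k + d C k)
        ≡⟨ cong (λ z → (d C suc k ∸ z) + (0 C k + d C k)) (trans (sym (nCk+nC[k+1]≡[n+1]C[k+1] 0 k))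
             (trans (cong (0 C k +_) (k>n⇒nCk≡0 {0} {suc k} (s≤s z≤n))) (+-identityʳ (0 C k)))) ⟩
      (d C suc k ∸ 0 C k) + (0 C k + d C k)
        ≡⟨ +-assoc (d C suc k ∸ 0 C k) (0 C k) (d C k) ⟨
      (d C suc k ∸ 0 C k) + 0 C k + d C k
        ≡⟨ cong (_+ d C k) (m∸n+n≡m 0Ck≤) ⟩
      d C suc k + d C k
        ≡⟨ +-comm (d C suc k) (d C k) ⟩
      d C k + d C suc k
        ≡⟨ nCk+nC[k+1]≡[n+1]C[k+1] d k ⟩
      suc d C suc k
        ≡⟨ simplex-count d ⟨
      Σℕ {suc d} (λ s → toℕ s C k)
        ≡⟨ +-identityʳ (Σℕ {suc d} (λ s → toℕ s C k)) ⟨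
      W 0 d ∎
      where
      open ≡-Reasoning
      0Ck≤ : 0 C k ≤ d C suc k
      0Ck≤ = ≤-trans (≤-reflexive (trans (sym (trans (cong (0 C k +_) (k>n⇒nCk≡0 {0} {suc k} (s≤s z≤n))) (+-identityʳ (0 C k))))
               (nCk+nC[k+1]≡[n+1]C[k+1] 0 k))) (C-mono (suc k) 1≤d)
    Δ-W d (suc α) β 1≤d (s≤s α≤β) refl = +-cancelʳ-≡ p (Δ d (suc α) + (0 C k + d C k)) (W (suc α) β) (begin
      Δ d α + mik d (suc α) k + (0 C k + d C k) + p
        ≡⟨ lem (Δ d α) (mik d (suc α) k) (0 C k + d C k) p ⟩
      Δ d α + (0 C k + d C k) + (mik d (suc α) k + p)
        ≡⟨ cong₂ _+_ (Δ-W d α (suc β) 1≤d (m≤n⇒m≤1+n (m≤n⇒m≤1+n α≤β)) (+-suc α β))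
             (trans (m∸n+n≡m p≤) (cong (_C suc k) d∸α)) ⟩
      W α (suc β) + suc β C suc k
        ≡⟨ W-shift α β ⟨
      W (suc α) β + p ∎)
      where
      open ≡-Reasoning
      p = suc α C suc k
      d∸α : suc (α + β) ∸ α ≡ suc β
      d∸α = trans (cong (_∸ α) (sym (+-suc α β))) (m+n∸m≡n α (suc β))
      p≤ : p ≤ (suc (α + β) ∸ α) C suc k
      p≤ = C-mono (suc k) (≤-trans (s≤s α≤β) (≤-reflexive (sym d∸α)))
      lem : ∀ a b c p → a + b + c + p ≡ a + c + (b + p)
      lem = solve-∀

-- Certified simple polytopes, and the simplex.

module Certificates where

  open LinAlg
  open FinSets
  open Corners
  open import Data.Nat.Base as ℕ using (ℕ; zero; suc; s≤s; z≤n)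
  import Data.Nat.Properties as ℕ
  open import Data.Fin.Base as Fin using (Fin; zero; suc; punchIn; punchOut; toℕ)
  open import Data.Fin.Properties as Fin using (any?; punchIn-punchOut; punchInᵢ≢i; punchIn-injective)
  open import Data.Fin.Subset using (Subset; _∈_; _∉_; _⊆_; ∣_∣; ⊤; ⊥; ∁; ⁅_⁆; inside)
  open import Data.Fin.Subset.Properties using (_∈?_; ∈⊤; ∉⊥; ∣⊤∣≡n; ∣⊥∣≡0; ⊆⊤; ⊆-antisym; p⊂q⇒∣p∣<∣q∣; ∣∁p∣≡n∸∣p∣; ∣⁅x⁆∣≡1; x∈⁅x⁆; x∈⁅y⁆⇒x≡y; x∉p⇒x∈∁p; x∈∁p⇒x∉p; x∉∁p⇒x∈p; drop-there)
  open import Data.Vec.Base using (_∷_; here; there)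
  open import Data.Rational hiding (∣_∣)
  open import Data.Rational.Properties

  Aff : ℕ → Set
  Aff d = Point d × ℚ

  ev : ∀ {d} → Aff d → Point d → ℚ
  ev f x = proj₂ f - dot (proj₁ f) x

  -- A simple polytope with vertices V u, facet inequalities 0 ≤ ev (ℓ j), and I u the d facets
  -- through V u.  The sets of facets with a common point are partitioned into the intervals
  -- [ I u ∖ T u , I u ], as in a shelling of the dual simplicial sphere.
  record Cert (X : Set) (N d : ℕ) : Set where
    field
      I : X → Fin d → Fin N

    infix 4 _∈ᴵ_
    _∈ᴵ_ : Fin N → X → Set
    j ∈ᴵ u = ∃ λ p → I u p ≡ j

    field
      distinct : ∀ {u w} → (∀ p → I u p ∈ᴵ w) → u ≡ w
      adjacent : ∀ u p → ∃ λ w → (∀ q → q ≢ p → I u q ∈ᴵ w) × ¬ (I u p ∈ᴵ w)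
      T        : X → Subset d

    Within : Subset N → X → Set
    Within Y w = ∀ {j} → j ∈ Y → j ∈ᴵ w

    Owns : Subset N → X → Set
    Owns Y w = Within Y w × (∀ p → p ∉ T w → I w p ∈ Y)

    field
      own    : ∀ Y u → Within Y u → ∃ (Owns Y)
      unique : ∀ {Y u w} → Owns Y u → Owns Y w → u ≡ w
      V      : X → Point d
      ℓ      : Fin N → Aff d
      on     : ∀ u p → ev (ℓ (I u p)) (V u) ≡ 0ℚ
      off    : ∀ u j → ¬ (j ∈ᴵ u) → 0ℚ < ev (ℓ j) (V u)

    _∈ᴵ?_ : ∀ j u → Dec (j ∈ᴵ u)
    j ∈ᴵ? u = any? (λ p → I u p Fin.≟ j)

    on′ : ∀ {u j} → j ∈ᴵ u → ev (ℓ j) (V u) ≡ 0ℚ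
    on′ {u} (p , refl) = on u p

    ev≥0 : ∀ j u → 0ℚ ≤ ev (ℓ j) (V u)
    ev≥0 j u with j ∈ᴵ? u
    ... | yes j∈ = ≤-reflexive (sym (on′ j∈))
    ... | no j∉  = <⇒≤ (off u j j∉)

    ev≡0⇒∈ᴵ : ∀ {j u} → ev (ℓ j) (V u) ≡ 0ℚ → j ∈ᴵ u
    ev≡0⇒∈ᴵ {j} {u} z = decidable-stable (j ∈ᴵ? u) λ j∉ → >⇒≢ (off u j j∉) z

    I-injective : ∀ u {p q} → I u p ≡ I u q → p ≡ q
    I-injective u {p} {q} eq with p Fin.≟ q
    ... | yes p≡q = p≡q
    ... | no p≢q  = let w , keep , lose = adjacent u q in contradiction (subst (_∈ᴵ w) eq (keep p p≢q)) lose

    separated : ∀ {u w} → u ≢ w → ∃ λ p → ¬ (I u p ∈ᴵ w)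
    separated {u} {w} u≢w with any? (λ p → ¬? (I u p ∈ᴵ? w))
    ... | yes found = found
    ... | no none   = contradiction (distinct λ p → decidable-stable (I u p ∈ᴵ? w) λ ne → none (p , ne)) u≢w

    -- The owner of the empty set of facets, that is, of the whole polytope. Gluing takes place at
    -- this vertex.
    full-vertex : X → ∃ λ u → ∀ p → p ∈ T u
    full-vertex x = let u , _ , ⊇ = own ⊥ x (λ j∈ → contradiction j∈ ∉⊥) in
      u , λ p → decidable-stable (p ∈? T u) λ p∉ → ∉⊥ (⊇ p p∉)

  reindex : ∀ {X Y N d} (f : Y → X) (g : X → Y) → (∀ x → f (g x) ≡ x) → (∀ y → g (f y) ≡ y) →
            Cert X N d → Cert Y N d
  reindex {X} {Y} {N} {d} f g fg gf K = record
    { I        = I ∘ f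
    ; distinct = λ {u} {w} h → trans (sym (gf u)) (trans (cong g (distinct h)) (gf w))
    ; adjacent = λ u p → let w , keep , lose = adjacent (f u) p in g w ,
        subst (λ w → (∀ q → q ≢ p → I (f u) q ∈ᴵ w) × ¬ (I (f u) p ∈ᴵ w)) (sym (fg w)) (keep , lose)
    ; T        = T ∘ f
    ; own      = λ Y u within → let w , owns = own Y (f u) within in g w , subst (Owns Y) (sym (fg w)) owns
    ; unique   = λ {Y} {u} {w} o₁ o₂ → trans (sym (gf u)) (trans (cong g (unique {Y} o₁ o₂)) (gf w))
    ; V        = V ∘ f
    ; ℓ        = ℓ
    ; on       = on ∘ f
    ; off      = off ∘ f
    }
    where open Cert K

  module _ {m N d} (K : Cert (Fin m) N d) where
    open Cert K

    cert-corner : ∀ u → Corner V u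
    cert-corner u = record
      { c      = λ p → proj₁ (ℓ (I u p))
      ; b      = λ p → proj₂ (ℓ (I u p))
      ; nb     = λ p → proj₁ (adjacent u p)
      ; e≥0    = λ p i → ev≥0 (I u p) i
      ; e-o    = λ p → on u p
      ; e-nb   = λ p q q≢p → on′ (proj₁ (proj₂ (adjacent u p)) q q≢p)
      ; e-nb>0 = λ p → off (proj₁ (adjacent u p)) (I u p) (proj₂ (proj₂ (adjacent u p)))
      }

    private
      module C u = Corner (cert-corner u)

    -- The facets containing the face S, computed at its vertex u.
    module _ {S : Subset m} (isF : IsFace V S) (u : Fin m) (u∈S : u ∈ S) where

      Containing? : Decidable (λ j → ∃ λ p → p ∉ C.trace u S × I u p ≡ j)
      Containing? j = any? (λ p → ¬? (p ∈? C.trace u S) ×-dec (I u p Fin.≟ j))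

      containing : Subset N
      containing = ⟨⟩ Containing?

      ∈S⇒within : ∀ {w} → w ∈ S → Within containing w
      ∈S⇒within {w} w∈S j∈ with ∈⟨⟩⁻ Containing? j∈
      ... | p , p∉ , refl = ev≡0⇒∈ᴵ (∈⟨⟩⁻ (C.OnFace? u (C.trace u S))
                              (subst (w ∈_) (sym (C.face-trace u isF u∈S)) w∈S) p p∉)

      within⇒∈S : ∀ {w} → Within containing w → w ∈ S
      within⇒∈S {w} within = subst (w ∈_) (C.face-trace u isF u∈S) (∈⟨⟩⁺ (C.OnFace? u (C.trace u S))
        λ p p∉ → on′ (within (∈⟨⟩⁺ Containing? (p , p∉ , refl))))

      -- For w in S, the neighbour across the facet `I w p` lies in S exactly when that facet does
      -- not contain S. This translates intervals of facets into conditions on edges.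
      owns⇒ : ∀ {w} → Owns containing w → w ∈ S × C.trace w S ⊆ T w
      owns⇒ {w} (within , ⊇) = within⇒∈S within , λ {p} p∈ → decidable-stable (p ∈? T w) λ p∉ →
        proj₂ (proj₂ (adjacent w p)) (∈S⇒within (∈⟨⟩⁻ (λ p → C.nb w p ∈? S) p∈) (⊇ p p∉))

      ⇒owns : ∀ {w} → w ∈ S → C.trace w S ⊆ T w → Owns containing w
      ⇒owns {w} w∈S ⊆T = ∈S⇒within w∈S , λ p p∉T → decidable-stable (I w p ∈? containing) λ Iwp∉ →
        p∉T (⊆T (∈⟨⟩⁺ (λ p → C.nb w p ∈? S) (within⇒∈S λ {j} j∈ → keep p Iwp∉ j∈)))
        where
        keep : ∀ p → I w p ∉ containing → ∀ {j} → j ∈ containing → j ∈ᴵ proj₁ (adjacent w p)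
        keep p Iwp∉ j∈ with ∈S⇒within w∈S j∈
        ... | q , refl = proj₁ (proj₂ (adjacent w p)) q λ { refl → Iwp∉ j∈ }

    cert-shelled : Shelled V
    cert-shelled = record
      { M = m ; vt = λ u → u ; corner = cert-corner ; T = T
      ; own    = λ {S} {i} isF i∈S → let w , owns = own (containing isF i i∈S) i (∈S⇒within isF i i∈S i∈S) in
                   w , owns⇒ isF i i∈S owns
      ; unique = λ {S} {u} {v} isF u∈ u⊆ v∈ v⊆ → unique {containing isF u u∈} (⇒owns isF u u∈ u∈ u⊆) (⇒owns isF u u∈ v∈ v⊆)
      }

  ⊆∧∣≡∣⇒≡ : ∀ {n} {p q : Subset n} → p ⊆ q → ∣ p ∣ ≡ ∣ q ∣ → p ≡ q
  ⊆∧∣≡∣⇒≡ {p = p} {q} p⊆q eq = ⊆-antisym p⊆q λ {x} x∈q → decidable-stable (x ∈? p) λ x∉p →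
    ℕ.<-irrefl eq (p⊂q⇒∣p∣<∣q∣ (p⊆q , x , x∈q , x∉p))

  -- The facets through a corner are spanned by all edges but one, so they are indexed by the
  -- omitted edge.
  corners⇒simple : ∀ {n m} (V : Fin m → Point (suc n)) → Fin m → (∀ i → Corner V i) → IsSimpleDPolytope V
  corners⇒simple {n} {m} V i₀ corner = polytope , simple
    where
    module C i = Corner (corner i)
    polytope : HasDim V ⊤ (suc n)
    polytope = subst₂ (HasDim V) (⊆-antisym ⊆⊤ λ {x} _ → ∈⟨⟩⁺ (C.OnFace? i₀ ⊤) λ p p∉ → contradiction ∈⊤ p∉)
      (∣⊤∣≡n (suc n)) (C.face-dim i₀ ⊤)
    ∣∁⁅p⁆∣ : ∀ (p : Fin (suc n)) → ∣ ∁ ⁅ p ⁆ ∣ ≡ n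
    ∣∁⁅p⁆∣ p = trans (∣∁p∣≡n∸∣p∣ ⁅ p ⁆) (cong (suc n ℕ.∸_) (∣⁅x⁆∣≡1 p))
    simple : ∀ v → KFace V 0 v → HasExactly (suc n) (λ F → KFace V n F × v ⊆ F)
    simple v kf@(isF , dim) = at (proj₁ nonempty) (proj₂ nonempty)
      where
      nonempty = HasDim-nonempty {V = V} dim
      at : ∀ o → o ∈ v → HasExactly (suc n) (λ F → KFace V n F × v ⊆ F)
      at o o∈v = F , F-injective , λ S → mk⇔ (λ (kfS , v⊆S) → fwd kfS (v⊆S o∈v))
                   λ { (p , refl) → subst (λ k → KFace V k (F p)) (∣∁⁅p⁆∣ p) (C.face-KFace o (∁ ⁅ p ⁆)) , v⊆ p }
        where
        F : Fin (suc n) → Subset m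
        F p = C.face o (∁ ⁅ p ⁆)
        F-injective : ∀ {p q} → F p ≡ F q → p ≡ q
        F-injective {p} {q} eq = x∈⁅y⁆⇒x≡y q (x∉∁p⇒x∈p λ p∈ → x∈∁p⇒x∉p
          (subst (p ∈_) (trans (sym (C.trace-face o (∁ ⁅ q ⁆))) (trans (cong (C.trace o) (sym eq)) (C.trace-face o (∁ ⁅ p ⁆)))) p∈) (x∈⁅x⁆ p))
        v⊆ : ∀ p → v ⊆ F p
        v⊆ p {i} i∈v = ∈⟨⟩⁺ (C.OnFace? o (∁ ⁅ p ⁆)) λ q _ → ∈⟨⟩⁻ (C.OnFace? o (C.trace o v))
          (subst (i ∈_) (sym (C.face-trace o isF o∈v)) i∈v) q λ q∈ → ∉⊥ (subst (q ∈_)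
            (sym (⊆∧∣≡∣⇒≡ {p = ⊥} (λ x∈ → contradiction x∈ ∉⊥) (trans (∣⊥∣≡0 (suc n)) (sym (C.dim-trace o kf o∈v))))) q∈)
        fwd : ∀ {S} → KFace V n S → o ∈ S → ∃ λ p → F p ≡ S
        fwd {S} kfS o∈S with any? (λ p → ¬? (p ∈? C.trace o S))
        ... | yes (p , p∉) = p , trans (cong (C.face o) (sym (⊆∧∣≡∣⇒≡
                (λ {x} x∈ → x∉p⇒x∈∁p λ x∈⁅p⁆ → p∉ (subst (_∈ C.trace o S) (x∈⁅y⁆⇒x≡y p x∈⁅p⁆) x∈))
                (trans (C.dim-trace o kfS o∈S) (sym (∣∁⁅p⁆∣ p)))))) (C.face-trace o (proj₁ kfS) o∈S)
        ... | no none = contradiction (trans (sym (C.dim-trace o kfS o∈S)) (trans (cong ∣_∣ full) (∣⊤∣≡n (suc n)))) (ℕ.<⇒≢ ℕ.≤-refl)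
          where
          full : C.trace o S ≡ ⊤
          full = ⊆-antisym ⊆⊤ λ {x} _ → decidable-stable (x ∈? C.trace o S) λ x∉ → none (x , x∉)

  -- The positions p with punchIn s p < s.
  below : ∀ {n} → Fin (suc n) → Subset n
  below zero            = ⊥
  below {suc n} (suc s) = inside ∷ below s

  ∣below∣ : ∀ {n} (s : Fin (suc n)) → ∣ below s ∣ ≡ toℕ s
  ∣below∣ {n} zero        = ∣⊥∣≡0 n
  ∣below∣ {suc n} (suc s) = cong suc (∣below∣ s)

  ∉below⁻ : ∀ {n} (s : Fin (suc n)) {p} → p ∉ below s → s Fin.< punchIn s p
  ∉below⁻ zero                    p∉ = s≤s z≤n
  ∉below⁻ {suc n} (suc s) {zero}  p∉ = contradiction here p∉
  ∉below⁻ {suc n} (suc s) {suc p} p∉ = s≤s (∉below⁻ s (p∉ ∘ there))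

  -- Vertex s of a simplex lies on all facets except the one labelled s, so a set of labels is given
  -- to its last missing label as owner; all later labels then belong to the set.
  last-missing : ∀ {n} {P : Fin n → Set} → Decidable P → (∃ λ i → ¬ P i) →
                 ∃ λ s → ¬ P s × (∀ i → s Fin.< i → P i)
  last-missing {suc n} {P} P? (i , ¬Pi) with any? (λ i → ¬? (P? (suc i)))
  ... | yes some = let s , ¬Ps , above = last-missing (P? ∘ suc) some in
        suc s , ¬Ps , λ { (suc i) (s≤s lt) → above i lt }
  ... | no none = zero , ¬P₀ i ¬Pi , λ { (suc i) _ → decidable-stable (P? (suc i)) λ ¬p → none (i , ¬p) }
    where
    ¬P₀ : ∀ i → ¬ P i → ¬ P zero
    ¬P₀ zero    ¬p = ¬p
    ¬P₀ (suc i) ¬p = contradiction (i , ¬p) none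

  last-missing-unique : ∀ {n} {P : Fin n → Set} {s t} → ¬ P s → (∀ i → s Fin.< i → P i) →
                        ¬ P t → (∀ i → t Fin.< i → P i) → s ≡ t
  last-missing-unique {s = s} {t} ¬Ps Ps ¬Pt Pt with Fin.<-cmp s t
  ... | tri< lt _ _ = contradiction (Ps t lt) ¬Pt
  ... | tri≈ _ eq _ = eq
  ... | tri> _ _ gt = contradiction (Pt s gt) ¬Ps

  >⇒punchIn-∉below : ∀ {n} (s : Fin (suc n)) {i} → s Fin.< i → ∃ λ p → punchIn s p ≡ i × p ∉ below s
  >⇒punchIn-∉below zero {suc i} _ = i , refl , ∉⊥
  >⇒punchIn-∉below {suc n} (suc s) {suc i} (s≤s lt) = let p , eq , p∉ = >⇒punchIn-∉below s lt in
    suc p , cong suc eq , p∉ ∘ drop-there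

  module Simplex (d : ℕ) where

    δ : Fin d → Fin d → ℚ
    δ i j with i Fin.≟ j
    ... | yes _ = 1ℚ
    ... | no _  = 0ℚ

    δ-same : ∀ i → δ i i ≡ 1ℚ
    δ-same i with i Fin.≟ i
    ... | yes _  = refl
    ... | no i≢i = contradiction refl i≢i

    δ-diff : ∀ {i j} → i ≢ j → δ i j ≡ 0ℚ
    δ-diff {i} {j} i≢j with i Fin.≟ j
    ... | yes i≡j = contradiction i≡j i≢j
    ... | no _    = refl

    point : Fin (suc d) → Point d
    point zero    j = 0ℚ
    point (suc i) j = δ i j

    functional : Fin (suc d) → Aff d
    functional zero    = (λ _ → 1ℚ) , 1ℚ
    functional (suc i) = (λ j → - δ i j) , 0ℚ

    dot-δ : ∀ (c : Point d) i → dot c (δ i) ≡ c i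
    dot-δ c i = trans (Σ-single i λ j j≢i → trans (cong (c j *_) (δ-diff (j≢i ∘ sym))) (*-zeroʳ (c j)))
                      (trans (cong (c i *_) (δ-same i)) (*-identityʳ (c i)))

    value : ∀ j u → j ≢ u → ev (functional j) (point u) ≡ 0ℚ
    value zero    zero    ne = contradiction refl ne
    value zero    (suc i) ne = cong (λ z → 1ℚ - z) (dot-δ (λ _ → 1ℚ) i)
    value (suc j) zero    ne = cong (λ z → 0ℚ - z) (dot-0ʳ (λ l → - δ j l))
    value (suc j) (suc i) ne = cong (λ z → 0ℚ - z) (trans (dot-δ (λ l → - δ j l) i) (cong -_ (δ-diff λ e → ne (cong suc e))))

    value-same : ∀ u → ev (functional u) (point u) ≡ 1ℚ
    value-same zero    = cong (λ z → 1ℚ - z) (dot-0ʳ {d} (λ _ → 1ℚ))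
    value-same (suc i) = cong (λ z → 0ℚ - z) (trans (dot-δ (λ l → - δ i l) i) (cong -_ (δ-same i)))

    ≢⇒∈ : ∀ {u j : Fin (suc d)} → u ≢ j → ∃ λ p → punchIn u p ≡ j
    ≢⇒∈ u≢j = punchOut u≢j , punchIn-punchOut u≢j

    cert : Cert (Fin (suc d)) (suc d) d
    cert = record
      { I        = punchIn
      ; distinct = λ {u} {w} h → decidable-stable (u Fin.≟ w) λ u≢w →
          let p , eq = ≢⇒∈ u≢w ; q , eq′ = h p in punchInᵢ≢i w q (trans eq′ eq)
      ; adjacent = λ u p → punchIn u p ,
          (λ q q≢p → ≢⇒∈ λ eq → q≢p (sym (punchIn-injective u p q eq))) ,
          λ (q , eq) → punchInᵢ≢i (punchIn u p) q eq
      ; T        = below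
      ; own      = λ Y u within →
          let s , s∉ , above = last-missing (_∈? Y) (u , λ u∈ → punchInᵢ≢i u (proj₁ (within u∈)) (proj₂ (within u∈))) in
          s , (λ {j} j∈ → ≢⇒∈ λ { refl → s∉ j∈ }) , λ p p∉ → above (punchIn s p) (∉below⁻ s p∉)
      ; unique   = λ {Y} {u} {w} (within , ⊇) (within′ , ⊇′) → last-missing-unique {P = _∈ Y}
          (λ u∈ → punchInᵢ≢i u (proj₁ (within u∈)) (proj₂ (within u∈)))
          (λ i u<i → let p , eq , p∉ = >⇒punchIn-∉below u u<i in subst (_∈ Y) eq (⊇ p p∉))
          (λ w∈ → punchInᵢ≢i w (proj₁ (within′ w∈)) (proj₂ (within′ w∈)))
          (λ i w<i → let p , eq , p∉ = >⇒punchIn-∉below w w<i in subst (_∈ Y) eq (⊇′ p p∉))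
      ; V        = point
      ; ℓ        = functional
      ; on       = λ u p → value (punchIn u p) u (punchInᵢ≢i u p)
      ; off      = λ u j j∉ → subst (0ℚ <_) (sym (trans (cong (λ z → ev (functional z) (point u))
                     (decidable-stable (j Fin.≟ u) λ j≢u → j∉ (≢⇒∈ (j≢u ∘ sym)))) (value-same u))) (positive⁻¹ 1ℚ)
      }

-- Points and cutting hyperplanes near a vertex.

module CutPoints where

  open LinAlg
  open Corners using (dot-diff)
  open Certificates
  open import Data.Nat.Base using (suc)
  open import Data.Fin.Base using (Fin; zero; suc)
  open import Data.Rational hiding (∣_∣)
  open import Data.Rational.Properties
  open import Tactic.RingSolver using (solve-∀)

  module _ {m N d} (K : Cert (Fin m) N d) (v : Fin m) where
    open Cert K

    neighbour : Fin d → Fin m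
    neighbour p = proj₁ (adjacent v p)

    E : Fin d → Point d → ℚ
    E p = ev (ℓ (I v p))

    height : Fin d → ℚ
    height p = E p (V (neighbour p))

    height>0 : ∀ p → 0ℚ < height p
    height>0 p = off (neighbour p) (I v p) (proj₂ (proj₂ (adjacent v p)))

    E-neighbour : ∀ p q → q ≢ p → E q (V (neighbour p)) ≡ 0ℚ
    E-neighbour p q q≢p = on′ (proj₁ (proj₂ (adjacent v p)) q q≢p)

    χ : (Fin d → ℚ) → Fin d → ℚ
    χ z p = z p * inv (height p)

    -- The point with coordinates z in the frame of the facet inequalities at V v.
    pt : (Fin d → ℚ) → Point d
    pt z j = V v j + Σℚ (λ p → χ z p * (V (neighbour p) j - V v j))

    -- `pt z` is the affine combination with weight χ z p at the p-th neighbour and the remaining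
    -- weight at `V v`.
    ev-pt : ∀ f z → ev f (pt z) ≡ (1ℚ - Σℚ (χ z)) * ev f (V v) + Σℚ (λ p → χ z p * ev f (V (neighbour p)))
    ev-pt f@(c , b) z = begin
      b - dot c (pt z)
        ≡⟨ cong (λ x → b - x) (trans (Σ-cong λ j → cong (c j *_) (lem₁ (V v j) (D j))) (dot-linʳ c (V v) D 1ℚ 1ℚ)) ⟩
      b - (1ℚ * dot c (V v) + 1ℚ * dot c D)
        ≡⟨ cong (λ x → b - (1ℚ * dot c (V v) + 1ℚ * x)) (dot-Σʳ c (χ z) (λ p j → V (neighbour p) j - V v j)) ⟩
      b - (1ℚ * dot c (V v) + 1ℚ * Σℚ (λ p → χ z p * dot c (λ j → V (neighbour p) j - V v j)))
        ≡⟨ cong (λ x → b - (1ℚ * dot c (V v) + 1ℚ * x)) (trans (Σ-cong λ p → trans (cong (χ z p *_) (dot-diff c (V (neighbour p)) (V v)))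
             (lem₂ (χ z p) b (dot c (V (neighbour p))) (dot c (V v))))
             (trans (Σ-+ (λ p → - 1ℚ * (χ z p * ev f (V (neighbour p)))) (λ p → ev f (V v) * χ z p))
               (cong₂ _+_ (Σ-* (- 1ℚ) (λ p → χ z p * ev f (V (neighbour p)))) (Σ-* (ev f (V v)) (χ z))))) ⟩
      b - (1ℚ * dot c (V v) + 1ℚ * (- 1ℚ * S + ev f (V v) * Σℚ (χ z)))
        ≡⟨ lem₃ b (dot c (V v)) S (Σℚ (χ z)) ⟩
      (1ℚ - Σℚ (χ z)) * ev f (V v) + S ∎
      where
      open ≡-Reasoning
      D : Point d
      D j = Σℚ (λ p → χ z p * (V (neighbour p) j - V v j))
      S = Σℚ (λ p → χ z p * ev f (V (neighbour p)))
      lem₁ : ∀ x y → x + y ≡ 1ℚ * x + 1ℚ * y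
      lem₁ = solve-∀ ℚ-ring
      lem₂ : ∀ k b x y → k * (x - y) ≡ - 1ℚ * (k * (b - x)) + (b - y) * k
      lem₂ = solve-∀ ℚ-ring
      lem₃ : ∀ b y S X → b - (1ℚ * y + 1ℚ * (- 1ℚ * S + (b - y) * X)) ≡ (1ℚ - X) * (b - y) + S
      lem₃ = solve-∀ ℚ-ring

    E-pt : ∀ z p → E p (pt z) ≡ z p
    E-pt z p = begin
      E p (pt z)
        ≡⟨ ev-pt (ℓ (I v p)) z ⟩
      (1ℚ - Σℚ (χ z)) * E p (V v) + Σℚ (λ q → χ z q * E p (V (neighbour q)))
        ≡⟨ cong₂ (λ x y → (1ℚ - Σℚ (χ z)) * x + y) (on v p) (Σ-single p λ q q≢p →
             trans (cong (χ z q *_) (E-neighbour q p (q≢p ∘ sym))) (*-zeroʳ (χ z q))) ⟩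
      (1ℚ - Σℚ (χ z)) * 0ℚ + z p * inv (height p) * height p
        ≡⟨ lem (1ℚ - Σℚ (χ z)) (z p) (inv (height p)) (height p) ⟩
      z p * (height p * inv (height p))
        ≡⟨ cong (z p *_) (*-inv (>⇒≢ (height>0 p))) ⟩
      z p * 1ℚ
        ≡⟨ *-identityʳ (z p) ⟩
      z p ∎
      where
      open ≡-Reasoning
      lem : ∀ a z i h → a * 0ℚ + z * i * h ≡ z * (h * i)
      lem = solve-∀ ℚ-ring

    -- Facets that avoid v stay strict as long as `V v` keeps positive weight.
    pt-off : ∀ z → (∀ p → 0ℚ ≤ z p) → Σℚ (χ z) < 1ℚ → ∀ j → ¬ (j ∈ᴵ v) → 0ℚ < ev (ℓ j) (pt z)
    pt-off z z≥0 Σχ<1 j j∉ = subst (0ℚ <_) (sym (ev-pt (ℓ j) z)) (0<+ (0<* (<⇒0< Σχ<1) (off v j j∉))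
      (Σ-nonNeg λ p → 0≤* (0≤* (z≥0 p) (<⇒≤ (0<inv (height>0 p)))) (ev≥0 j (neighbour p))))

    comb : (Fin d → ℚ) → ℚ → Aff d
    comb ω ε = (λ j → Σℚ (λ p → ω p * proj₁ (ℓ (I v p)) j)) , Σℚ (λ p → ω p * proj₂ (ℓ (I v p))) - ε

    ev-comb : ∀ ω ε x → ev (comb ω ε) x ≡ Σℚ (λ p → ω p * E p x) - ε
    ev-comb ω ε x = sym (begin
      Σℚ (λ p → ω p * E p x) - ε
        ≡⟨ cong (_- ε) (trans (Σ-cong λ p → lem₁ (ω p) (B p) (D p))
             (trans (Σ-+ (λ p → ω p * B p) (λ p → - 1ℚ * (ω p * D p))) (cong (Σℚ (λ p → ω p * B p) +_) (Σ-* (- 1ℚ) (λ p → ω p * D p))))) ⟩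
      Σℚ (λ p → ω p * B p) + - 1ℚ * Σℚ (λ p → ω p * D p) - ε
        ≡⟨ lem₂ (Σℚ (λ p → ω p * B p)) (Σℚ (λ p → ω p * D p)) ε ⟩
      Σℚ (λ p → ω p * B p) - ε - Σℚ (λ p → ω p * D p)
        ≡⟨ cong (λ y → Σℚ (λ p → ω p * B p) - ε - y) (dot-Σˡ ω (λ p → proj₁ (ℓ (I v p))) x) ⟨
      ev (comb ω ε) x ∎)
      where
      open ≡-Reasoning
      B D : Fin d → ℚ
      B p = proj₂ (ℓ (I v p))
      D p = dot (proj₁ (ℓ (I v p))) x
      lem₁ : ∀ w b x → w * (b - x) ≡ w * b + - 1ℚ * (w * x)
      lem₁ = solve-∀ ℚ-ring
      lem₂ : ∀ a s e → a + - 1ℚ * s - e ≡ a - e - s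
      lem₂ = solve-∀ ℚ-ring

    -- Two demands on the depth of the cut: all other vertices stay strictly on the kept side, and
    -- points with frame coordinates in [0 , ε] give `V v` positive weight.
    Small : ℚ → Set
    Small ε = 0ℚ < ε × (∀ w → w ≢ v → ε < Σℚ (λ p → E p (V w))) ×
              (∀ z → (∀ p → 0ℚ ≤ z p) → (∀ p → z p ≤ ε) → Σℚ (χ z) < 1ℚ)

    -- In terms of n = 1/ε the demands read n S w > 1 for the other vertices w, and n > R with R the
    -- sum of the inverse heights; one `large-multiple` meets them all.
    small-exists : ∃ Small
    small-exists = let n , 0<n , large = large-multiple a b in inv n , 0<inv 0<n ,
        (λ w w≢v → cut n 0<n (S w) (large (suc w) (neg-antimono-< (S>0 w w≢v)))) ,
        λ z z≥0 z≤ → bound n 0<n (large zero (neg-antimono-< (positive⁻¹ 1ℚ))) z z≤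
      where
      S : Fin m → ℚ
      S w = Σℚ (λ p → E p (V w))
      R : ℚ
      R = Σℚ (λ p → inv (height p))
      a b : Fin (suc m) → ℚ
      a zero    = - 1ℚ
      a (suc w) = - S w
      b zero    = R
      b (suc w) = 1ℚ
      S>0 : ∀ w → w ≢ v → 0ℚ < S w
      S>0 w w≢v = let p , p∉ = separated {v} {w} (w≢v ∘ sym) in
        0<Σ (λ p → ev≥0 (I v p) w) p (off w (I v p) p∉)
      lem₁ : ∀ s n i → s - i ≡ i * (0ℚ - (n * - s + 1ℚ)) - s * (n * i - 1ℚ)
      lem₁ = solve-∀ ℚ-ring
      drop : ∀ x s → x - s * (1ℚ - 1ℚ) ≡ x
      drop = solve-∀ ℚ-ring
      cut : ∀ n → 0ℚ < n → ∀ s → n * - s + 1ℚ < 0ℚ → inv n < s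
      cut n 0<n s lt = 0<⇒< (subst (0ℚ <_) (sym (trans (lem₁ s n (inv n))
        (trans (cong (λ y → inv n * (0ℚ - (n * - s + 1ℚ)) - s * (y - 1ℚ)) (*-inv (>⇒≢ 0<n)))
               (drop (inv n * (0ℚ - (n * - s + 1ℚ))) s))))
        (0<* (0<inv 0<n) (<⇒0< lt)))
      lem₂ : ∀ n r i → 1ℚ - i * r ≡ i * (0ℚ - (n * - 1ℚ + r)) - 1ℚ * (n * i - 1ℚ)
      lem₂ = solve-∀ ℚ-ring
      bound : ∀ n → 0ℚ < n → n * - 1ℚ + R < 0ℚ → ∀ z → (∀ p → z p ≤ inv n) → Σℚ (χ z) < 1ℚ
      bound n 0<n lt z z≤ = ≤-<-trans χ≤ (0<⇒< (subst (0ℚ <_) (sym (trans (lem₂ n R (inv n))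
          (trans (cong (λ y → inv n * (0ℚ - (n * - 1ℚ + R)) - 1ℚ * (y - 1ℚ)) (*-inv (>⇒≢ 0<n)))
                 (drop (inv n * (0ℚ - (n * - 1ℚ + R))) 1ℚ))))
          (0<* (0<inv 0<n) (<⇒0< lt))))
        where
        lem₃ : ∀ i h z → (i - z) * h ≡ i * h + - 1ℚ * (z * h)
        lem₃ = solve-∀ ℚ-ring
        lem₄ : ∀ a b → a + - 1ℚ * b ≡ a - b
        lem₄ = solve-∀ ℚ-ring
        χ≤ : Σℚ (χ z) ≤ inv n * R
        χ≤ = 0≤⇒≤ (subst (0ℚ ≤_) (trans (Σ-cong λ p → lem₃ (inv n) (inv (height p)) (z p))
          (trans (Σ-+ (λ p → inv n * inv (height p)) (λ p → - 1ℚ * χ z p))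
            (trans (cong₂ _+_ (Σ-* (inv n) (λ p → inv (height p))) (Σ-* (- 1ℚ) (χ z))) (lem₄ (inv n * R) (Σℚ (χ z))))))
          (Σ-nonNeg λ p → 0≤* (≤⇒0≤ (z≤ p)) (<⇒≤ (0<inv (height>0 p)))))

-- Combinatorics of a product of two simplices.

module ProductLabels where

  open FinSets using (Σℕ; Σℕ-cong)
  open Certificates using (below; ∣below∣; ∉below⁻; >⇒punchIn-∉below)
  open import Data.Bool.Base using (true; false)
  open import Data.Nat.Base as ℕ using (ℕ; zero; suc; _+_; _*_)
  import Data.Nat.Properties as ℕ
  open import Data.Fin.Base as Fin using (Fin; zero; suc; punchIn; punchOut; toℕ; splitAt; join; _↑ˡ_; _↑ʳ_; combine; remQuot)
  open import Data.Fin.Properties as Fin using (punchIn-punchOut; punchInᵢ≢i; punchIn-injective; remQuot-combine; combine-remQuot; suc-injective)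
  open import Data.Fin.Subset using (Subset; _∈_; _∉_; ∣_∣)
  open import Data.Vec.Base using ([]; _∷_; _++_; here; there)
  open import Data.Sum.Properties using (inj₁-injective; inj₂-injective)

  ∣++∣ : ∀ {m n} (p : Subset m) (q : Subset n) → ∣ p ++ q ∣ ≡ ∣ p ∣ + ∣ q ∣
  ∣++∣ []          q = refl
  ∣++∣ (true ∷ p)  q = cong suc (∣++∣ p q)
  ∣++∣ (false ∷ p) q = ∣++∣ p q

  ∈-++ˡ : ∀ {m n} (p : Subset m) (q : Subset n) {i} → i ∈ p → i ↑ˡ n ∈ p ++ q
  ∈-++ˡ (_ ∷ p) q here      = here
  ∈-++ˡ (_ ∷ p) q (there x) = there (∈-++ˡ p q x)

  ∈-++ʳ : ∀ {m n} (p : Subset m) (q : Subset n) {i} → i ∈ q → m ↑ʳ i ∈ p ++ q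
  ∈-++ʳ []      q x = x
  ∈-++ʳ (_ ∷ p) q x = there (∈-++ʳ p q x)

  ∈-++ˡ⁻ : ∀ {m n} (p : Subset m) (q : Subset n) {i} → i ↑ˡ n ∈ p ++ q → i ∈ p
  ∈-++ˡ⁻ (_ ∷ p) q {zero}  here      = here
  ∈-++ˡ⁻ (_ ∷ p) q {suc i} (there x) = there (∈-++ˡ⁻ p q x)

  ∈-++ʳ⁻ : ∀ {m n} (p : Subset m) (q : Subset n) {i} → m ↑ʳ i ∈ p ++ q → i ∈ q
  ∈-++ʳ⁻ []      q x         = x
  ∈-++ʳ⁻ (_ ∷ p) q (there x) = ∈-++ʳ⁻ p q x

  Σℕ-⊎ : ∀ m {n} (f : Fin m ⊎ Fin n → ℕ) → Σℕ (f ∘ splitAt m) ≡ Σℕ (f ∘ inj₁) + Σℕ (f ∘ inj₂)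
  Σℕ-⊎ zero    f = refl
  Σℕ-⊎ (suc m) f = trans (cong (f (inj₁ zero) +_) (trans (Σℕ-cong (λ x → lem (splitAt m x))) (Σℕ-⊎ m (f ∘ Sum.map₁ suc))))
                         (sym (ℕ.+-assoc (f (inj₁ zero)) (Σℕ (f ∘ inj₁ ∘ suc)) (Σℕ (f ∘ inj₂))))
    where
    lem : ∀ x → f (Sum.map suc (λ y → y) x) ≡ f (Sum.map₁ suc x)
    lem x = refl

  Σℕ-remQuot : ∀ m n (f : Fin m × Fin n → ℕ) → Σℕ (f ∘ remQuot {m} n) ≡ Σℕ (λ s → Σℕ (λ t → f (s , t)))
  Σℕ-remQuot zero    n f = refl
  Σℕ-remQuot (suc m) n f = trans (Σℕ-cong step)
    (trans (Σℕ-⊎ n h) (cong (Σℕ (λ t → f (zero , t)) +_) (Σℕ-remQuot m n (λ (s , t) → f (suc s , t)))))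
    where
    h : Fin n ⊎ Fin (m * n) → ℕ
    h (inj₁ t) = f (zero , t)
    h (inj₂ x) = f (suc (proj₁ (remQuot {m} n x)) , proj₂ (remQuot {m} n x))
    step : ∀ x → f (remQuot {suc m} n x) ≡ h (splitAt n x)
    step x with splitAt n x
    ... | inj₁ t = refl
    ... | inj₂ y = refl

  -- The vertices of a product of simplices of dimensions α and β are the pairs (s , t); its facets
  -- are Lab, and (s , t) lies on all of them but inj₁ s and inj₂ t.
  module _ (α β : ℕ) where

    Pair Lab Pos : Set
    Pair = Fin (suc α) × Fin (suc β)
    Lab  = Fin (suc α) ⊎ Fin (suc β)
    Pos  = Fin α ⊎ Fin β

  module _ {α β : ℕ} where

    Miss : Pair α β → Lab α β → Set
    Miss (s , t) (inj₁ x) = x ≡ s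
    Miss (s , t) (inj₂ x) = x ≡ t

    Miss? : ∀ st x → Dec (Miss st x)
    Miss? (s , t) (inj₁ x) = x Fin.≟ s
    Miss? (s , t) (inj₂ x) = x Fin.≟ t

    punch : Pair α β → Pos α β → Lab α β
    punch (s , t) (inj₁ i) = inj₁ (punchIn s i)
    punch (s , t) (inj₂ l) = inj₂ (punchIn t l)

    punch-¬Miss : ∀ st y → ¬ Miss st (punch st y)
    punch-¬Miss (s , t) (inj₁ i) = punchInᵢ≢i s i
    punch-¬Miss (s , t) (inj₂ l) = punchInᵢ≢i t l

    unpunch : ∀ st x → ¬ Miss st x → ∃ λ y → punch st y ≡ x
    unpunch (s , t) (inj₁ x) ne = inj₁ (punchOut (ne ∘ sym)) , cong inj₁ (punchIn-punchOut (ne ∘ sym))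
    unpunch (s , t) (inj₂ x) ne = inj₂ (punchOut (ne ∘ sym)) , cong inj₂ (punchIn-punchOut (ne ∘ sym))

    -- The other end of the edge at the vertex that leaves the facet `punch st y`.
    swap : Pair α β → Pos α β → Pair α β
    swap (s , t) (inj₁ i) = punchIn s i , t
    swap (s , t) (inj₂ l) = s , punchIn t l

    swap-Miss : ∀ st y → Miss (swap st y) (punch st y)
    swap-Miss (s , t) (inj₁ i) = refl
    swap-Miss (s , t) (inj₂ l) = refl

    swap-¬Miss : ∀ st y y′ → y′ ≢ y → ¬ Miss (swap st y) (punch st y′)
    swap-¬Miss (s , t) (inj₁ i) (inj₁ i′) ne eq = ne (cong inj₁ (punchIn-injective s i′ i eq))
    swap-¬Miss (s , t) (inj₁ i) (inj₂ l′) ne    = punchInᵢ≢i t l′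
    swap-¬Miss (s , t) (inj₂ l) (inj₁ i′) ne    = punchInᵢ≢i s i′
    swap-¬Miss (s , t) (inj₂ l) (inj₂ l′) ne eq = ne (cong inj₂ (punchIn-injective t l′ l eq))

    origin : Pair α β
    origin = zero , zero

    inc : Pos α β → Lab α β
    inc (inj₁ i) = inj₁ (suc i)
    inc (inj₂ l) = inj₂ (suc l)

    corner : Pos α β → Pair α β
    corner (inj₁ i) = suc i , zero
    corner (inj₂ l) = zero , suc l

    corner≢origin : ∀ y → corner y ≢ origin
    corner≢origin (inj₁ i) ()
    corner≢origin (inj₂ l) ()

    corner-¬Miss : ∀ y y′ → y′ ≢ y → ¬ Miss (corner y) (inc y′)
    corner-¬Miss (inj₁ i) (inj₁ i′) ne eq = ne (cong inj₁ (suc-injective eq))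
    corner-¬Miss (inj₁ i) (inj₂ l′) ne ()
    corner-¬Miss (inj₂ l) (inj₁ i′) ne ()
    corner-¬Miss (inj₂ l) (inj₂ l′) ne eq = ne (cong inj₂ (suc-injective eq))

    -- These are `inj₁ zero` and `inj₂ zero`, the facets avoiding the origin. The labels `inc y`
    -- will be identified with the facets at v.
    IsNew : Lab α β → Set
    IsNew x = ∀ y → x ≢ inc y

    -- Such a vertex is `corner y₀`. After the origin is removed, its edge towards the origin
    -- continues to the old neighbour of v off the facet y₀.
    swap-origin : ∀ st y → swap st y ≡ origin → ∃ λ y₀ → IsNew (punch st y) ×
                  (∀ y′ → y′ ≢ y → ∃ λ y″ → punch st y′ ≡ inc y″ × y″ ≢ y₀)
    swap-origin (zero , t) (inj₁ i) eq = contradiction (cong proj₁ eq) λ ()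
    swap-origin (suc s , suc t) (inj₁ i) eq = contradiction (cong proj₂ eq) λ ()
    swap-origin (suc s , zero) (inj₁ i) eq = inj₁ s , new , others
      where
      i≡0 : punchIn (suc s) i ≡ zero
      i≡0 = cong proj₁ eq
      new : IsNew (inj₁ (punchIn (suc s) i))
      new (inj₁ _) e = contradiction (trans (sym i≡0) (inj₁-injective e)) λ ()
      new (inj₂ _) ()
      others : ∀ y′ → y′ ≢ inj₁ i → ∃ λ y″ → punch (suc s , zero) y′ ≡ inc y″ × y″ ≢ inj₁ s
      others (inj₁ i′) ne with punchIn (suc s) i′ in eq′
      ... | zero  = contradiction (cong inj₁ (punchIn-injective (suc s) i′ i (trans eq′ (sym i≡0)))) ne
      ... | suc x = inj₁ x , refl , λ { refl → punchInᵢ≢i (suc s) i′ eq′ }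
      others (inj₂ l′) ne = inj₂ l′ , refl , λ ()
    swap-origin (s , zero) (inj₂ l) eq = contradiction (cong proj₂ eq) λ ()
    swap-origin (suc s , suc t) (inj₂ l) eq = contradiction (cong proj₁ eq) λ ()
    swap-origin (zero , suc t) (inj₂ l) eq = inj₂ t , new , others
      where
      l≡0 : punchIn (suc t) l ≡ zero
      l≡0 = cong proj₂ eq
      new : IsNew (inj₂ (punchIn (suc t) l))
      new (inj₂ _) e = contradiction (trans (sym l≡0) (inj₂-injective e)) λ ()
      new (inj₁ _) ()
      others : ∀ y′ → y′ ≢ inj₂ l → ∃ λ y″ → punch (zero , suc t) y′ ≡ inc y″ × y″ ≢ inj₂ t
      others (inj₂ l′) ne with punchIn (suc t) l′ in eq′
      ... | zero  = contradiction (cong inj₂ (punchIn-injective (suc t) l′ l (trans eq′ (sym l≡0)))) ne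
      ... | suc x = inj₂ x , refl , λ { refl → punchInᵢ≢i (suc t) l′ eq′ }
      others (inj₁ i′) ne = inj₁ i′ , refl , λ ()

    ≢origin⇒new : ∀ st → st ≢ origin → ∃ λ x → IsNew x × ¬ Miss st x
    ≢origin⇒new (suc s , t)     _  = inj₁ zero , (λ { (inj₁ _) () ; (inj₂ _) () }) , λ ()
    ≢origin⇒new (zero , suc t)  _  = inj₂ zero , (λ { (inj₁ _) () ; (inj₂ _) () }) , λ ()
    ≢origin⇒new (zero , zero)   ne = contradiction refl ne

    Miss-unique : ∀ st st′ → (∀ x → Miss st′ x → Miss st x) → st ≡ st′
    Miss-unique (s , t) (s′ , t′) h = cong₂ _,_ (sym (h (inj₁ s′) refl)) (sym (h (inj₂ t′) refl))

    After : Pair α β → Lab α β → Set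
    After (s , t) (inj₁ x) = s Fin.< x
    After (s , t) (inj₂ x) = t Fin.< x

    -- The product of two simplex shellings: the interval of (s , t) requires the labels after s in
    -- one factor and those after t in the other.
    Tnew : Pair α β → Subset (α + β)
    Tnew (s , t) = below s ++ below t

    ∣Tnew∣ : ∀ st → ∣ Tnew st ∣ ≡ toℕ (proj₁ st) + toℕ (proj₂ st)
    ∣Tnew∣ (s , t) = trans (∣++∣ (below s) (below t)) (cong₂ _+_ (∣below∣ s) (∣below∣ t))

    ∉Tnew⇒After : ∀ st y → join α β y ∉ Tnew st → After st (punch st y)
    ∉Tnew⇒After (s , t) (inj₁ i) i∉ = ∉below⁻ s (i∉ ∘ ∈-++ˡ (below s) (below t))
    ∉Tnew⇒After (s , t) (inj₂ l) l∉ = ∉below⁻ t (l∉ ∘ ∈-++ʳ (below s) (below t))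

    After⇒∉Tnew : ∀ st x → After st x → ∃ λ y → punch st y ≡ x × join α β y ∉ Tnew st
    After⇒∉Tnew (s , t) (inj₁ x) lt = let i , eq , i∉ = >⇒punchIn-∉below s lt in
      inj₁ i , cong inj₁ eq , i∉ ∘ ∈-++ˡ⁻ (below s) (below t)
    After⇒∉Tnew (s , t) (inj₂ x) lt = let l , eq , l∉ = >⇒punchIn-∉below t lt in
      inj₂ l , cong inj₂ eq , l∉ ∘ ∈-++ʳ⁻ (below s) (below t)

    -- The nonzero indices of Fin (suc α * suc β) enumerate the pairs other than the origin.
    pair : Fin (β + α * suc β) → Pair α β
    pair q = remQuot (suc β) (suc q)

    pair≢origin : ∀ q → pair q ≢ origin
    pair≢origin q eq with trans (sym (combine-remQuot {suc α} (suc β) (suc q))) (cong (λ (s , t) → combine s t) eq)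
    ... | ()

    pair-injective : ∀ {q q′} → pair q ≡ pair q′ → q ≡ q′
    pair-injective {q} {q′} eq = suc-injective (trans (sym (combine-remQuot {suc α} (suc β) (suc q)))
      (trans (cong (λ (s , t) → combine s t) eq) (combine-remQuot {suc α} (suc β) (suc q′))))

    pair-surjective : ∀ st → st ≢ origin → ∃ λ q → pair q ≡ st
    pair-surjective (s , t) ne with combine s t in eq
    ... | zero  = contradiction (trans (sym (remQuot-combine {suc α} s t)) (cong (remQuot (suc β)) eq)) ne
    ... | suc q = q , trans (cong (remQuot (suc β)) (sym eq)) (remQuot-combine {suc α} s t)

-- Replacing a vertex by a product of simplices.

module Gluing where

  open LinAlg
  open FinSets
  open Certificates
  open CutPoints
  open ProductLabels
  open import Data.Nat.Base as ℕ using (ℕ; zero; suc)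
  import Data.Nat.Properties as ℕ
  import Data.Integer.Base as ℤ
  open import Data.Fin.Base as Fin using (Fin; zero; suc; punchIn; punchOut; splitAt; join; _↑ˡ_; _↑ʳ_)
  open import Data.Fin.Properties as Fin using (punchIn-punchOut; punchInᵢ≢i; punchIn-injective; splitAt-join; join-splitAt; suc-injective)
  open import Data.Fin.Subset using (Subset; _∈_; _∉_)
  open import Data.Fin.Subset.Properties using (_∈?_; drop-there)
  open import Data.Vec.Base using (_∷_; there)
  open import Data.Rational hiding (∣_∣)
  open import Data.Rational.Properties
  open import Tactic.RingSolver using (solve-∀)

  Σ-⊎ : ∀ m {n} (f : Fin m ⊎ Fin n → ℚ) → Σℚ (f ∘ splitAt m) ≡ Σℚ (f ∘ inj₁) + Σℚ (f ∘ inj₂)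
  Σ-⊎ zero    f = sym (+-identityˡ (Σℚ (f ∘ inj₂)))
  Σ-⊎ (suc m) f = trans (cong (f (inj₁ zero) +_) (Σ-⊎ m (f ∘ Sum.map₁ suc)))
                        (sym (+-assoc (f (inj₁ zero)) (Σℚ (f ∘ inj₁ ∘ suc)) (Σℚ (f ∘ inj₂))))

  third two : ℚ
  third = ℤ.+ 1 / 3
  two   = 1ℚ + 1ℚ

  -- Vertex v is replaced by the product of simplices with the vertex origin removed: in the frame of
  -- the facets at v, two new facets 2 σ_A + σ_B ≥ ε and σ_A + 2 σ_B ≥ ε are introduced, where
  -- σ_A and σ_B are the sums of the first α and of the last β coordinates.
  module Glue {m N α β} (K : Cert (Fin (suc m)) N (α ℕ.+ β)) (v : Fin (suc m)) (full : ∀ p → p ∈ Cert.T K v) where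
    open Cert K

    private
      d : ℕ
      d = α ℕ.+ β

    X′ : Set
    X′ = Fin m ⊎ Fin (β ℕ.+ α ℕ.* suc β)

    old : Fin m → Fin (suc m)
    old = punchIn v

    old-surjective : ∀ {w} → w ≢ v → ∃ λ o → old o ≡ w
    old-surjective w≢v = punchOut (w≢v ∘ sym) , punchIn-punchOut (w≢v ∘ sym)

    -- Indices 0 and 1 are the new facets, old ones are shifted by two, and the facets through the
    -- origin become those through v. For α = 0 no vertex lies on index 0, and v is truncated by
    -- index 1.
    lab : Lab α β → Fin (suc (suc N))
    lab (inj₁ zero)    = zero
    lab (inj₁ (suc i)) = suc (suc (I v (i ↑ˡ β)))
    lab (inj₂ zero)    = suc zero
    lab (inj₂ (suc l)) = suc (suc (I v (α ↑ʳ l)))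

    lab-inc : ∀ y → lab (inc y) ≡ suc (suc (I v (join α β y)))
    lab-inc (inj₁ i) = refl
    lab-inc (inj₂ l) = refl

    lab-old : ∀ x {j} → lab x ≡ suc (suc j) → ∃ λ y → x ≡ inc y × I v (join α β y) ≡ j
    lab-old (inj₁ (suc i)) refl = inj₁ i , refl , refl
    lab-old (inj₂ (suc l)) refl = inj₂ l , refl , refl

    join-injective : ∀ {y y′ : Pos α β} → join α β y ≡ join α β y′ → y ≡ y′
    join-injective {y} {y′} eq = trans (sym (splitAt-join α β y)) (trans (cong (splitAt α) eq) (splitAt-join α β y′))

    I-join-injective : ∀ {y y′ : Pos α β} → I v (join α β y) ≡ I v (join α β y′) → y ≡ y′
    I-join-injective = join-injective ∘ I-injective v

    lab-injective : ∀ x x′ → lab x ≡ lab x′ → x ≡ x′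
    lab-injective (inj₁ zero)    (inj₁ zero)    eq = refl
    lab-injective (inj₂ zero)    (inj₂ zero)    eq = refl
    lab-injective (inj₁ (suc i)) x′ eq = let y , x′≡ , e = lab-old x′ (sym eq) in
      trans (cong inc (sym (I-join-injective {y} {inj₁ i} e))) (sym x′≡)
    lab-injective (inj₂ (suc l)) x′ eq = let y , x′≡ , e = lab-old x′ (sym eq) in
      trans (cong inc (sym (I-join-injective {y} {inj₂ l} e))) (sym x′≡)
    lab-injective (inj₁ zero)    (inj₁ (suc _)) ()
    lab-injective (inj₁ zero)    (inj₂ zero)    ()
    lab-injective (inj₁ zero)    (inj₂ (suc _)) ()
    lab-injective (inj₂ zero)    (inj₁ zero)    ()
    lab-injective (inj₂ zero)    (inj₁ (suc _)) ()
    lab-injective (inj₂ zero)    (inj₂ (suc _)) ()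

    Inew : Pair α β → Fin d → Fin (suc (suc N))
    Inew st p = lab (punch st (splitAt α p))

    _∈new_ : Fin (suc (suc N)) → Pair α β → Set
    j ∈new st = ∃ λ p → Inew st p ≡ j

    Inew-join : ∀ st y → Inew st (join α β y) ≡ lab (punch st y)
    Inew-join st y = cong (lab ∘ punch st) (splitAt-join α β y)

    ∈new⁺ : ∀ {st x} → ¬ Miss st x → lab x ∈new st
    ∈new⁺ {st} {x} ¬miss = let y , eq = unpunch st x ¬miss in join α β y , trans (Inew-join st y) (cong lab eq)

    ∈new⁻ : ∀ {st j} → j ∈new st → ∃ λ x → ¬ Miss st x × lab x ≡ j
    ∈new⁻ {st} (p , eq) = punch st (splitAt α p) , punch-¬Miss st (splitAt α p) , eq

    ∉new : ∀ {st} x → Miss st x → ¬ (lab x ∈new st)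
    ∉new {st} x miss j∈ = let x′ , ¬miss , eq = ∈new⁻ j∈ in ¬miss (subst (Miss st) (lab-injective x x′ (sym eq)) miss)

    ∉new⇒Miss : ∀ {st} x → ¬ (lab x ∈new st) → Miss st x
    ∉new⇒Miss {st} x ∉ = decidable-stable (Miss? st x) λ ¬miss → ∉ (∈new⁺ ¬miss)

    old∈new⇒∈v : ∀ {st j} → suc (suc j) ∈new st → j ∈ᴵ v
    old∈new⇒∈v j∈ = let x , _ , eq = ∈new⁻ j∈ ; y , _ , e = lab-old x eq in join α β y , e

    I′ : X′ → Fin d → Fin (suc (suc N))
    I′ (inj₁ o) p = suc (suc (I (old o) p))
    I′ (inj₂ q) p = Inew (pair q) p

    _∈′_ : Fin (suc (suc N)) → X′ → Set
    j ∈′ u = ∃ λ p → I′ u p ≡ j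

    ∈old⁺ : ∀ {o j} → j ∈ᴵ old o → suc (suc j) ∈′ inj₁ o
    ∈old⁺ (p , eq) = p , cong (λ j → Fin.suc (Fin.suc j)) eq

    ∈old⁻ : ∀ {o j} → suc (suc j) ∈′ inj₁ o → j ∈ᴵ old o
    ∈old⁻ (p , eq) = p , suc-injective (suc-injective eq)

    new∉old : ∀ x → IsNew x → ∀ {o} → ¬ (lab x ∈′ inj₁ o)
    new∉old x new (p , eq) = let y , x≡ , _ = lab-old x (sym eq) in new y x≡

    distinct′ : ∀ {u w} → (∀ p → I′ u p ∈′ w) → u ≡ w
    distinct′ {inj₁ o} {inj₁ o′} h = cong inj₁ (punchIn-injective v o o′ (distinct λ p → ∈old⁻ (h p)))
    distinct′ {inj₁ o} {inj₂ q}  h = contradiction (distinct λ p → old∈new⇒∈v (h p)) (punchInᵢ≢i v o)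
    distinct′ {inj₂ q} {inj₁ o}  h =
      let x , new , ¬miss = ≢origin⇒new (pair q) (pair≢origin q)
          p , eq = ∈new⁺ ¬miss
      in contradiction (subst (_∈′ inj₁ o) eq (h p)) (new∉old x new)
    distinct′ {inj₂ q} {inj₂ q′} h = cong inj₂ (pair-injective (Miss-unique (pair q) (pair q′) λ x miss →
      ∉new⇒Miss x λ (p , eq) → ∉new x miss (subst (_∈new pair q′) eq (h p))))

    Adjacent : X′ → Fin d → Set
    Adjacent u p = ∃ λ w → (∀ q → q ≢ p → I′ u q ∈′ w) × ¬ (I′ u p ∈′ w)

    splitAt-≢ : ∀ {p q : Fin d} → q ≢ p → splitAt α q ≢ splitAt α p
    splitAt-≢ {p} {q} ne eq = ne (trans (sym (join-splitAt α β q)) (trans (cong (join α β) eq) (join-splitAt α β p)))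

    adjacent-away : ∀ st p → swap st (splitAt α p) ≢ origin → ∃ λ w → (∀ q → q ≢ p → Inew st q ∈′ w) × ¬ (Inew st p ∈′ w)
    adjacent-away st p ne = let q₁ , eq = pair-surjective (swap st (splitAt α p)) ne in inj₂ q₁ ,
      (λ q q≢p → subst (Inew st q ∈new_) (sym eq) (∈new⁺ (swap-¬Miss st (splitAt α p) (splitAt α q) (splitAt-≢ q≢p)))) ,
      λ j∈ → ∉new (punch st (splitAt α p)) (swap-Miss st (splitAt α p)) (subst (Inew st p ∈new_) eq j∈)

    adjacent-new : ∀ st p → ∃ λ w → (∀ q → q ≢ p → Inew st q ∈′ w) × ¬ (Inew st p ∈′ w)
    adjacent-new st p with proj₁ (swap st (splitAt α p)) Fin.≟ zero | proj₂ (swap st (splitAt α p)) Fin.≟ zero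
    ... | yes e₁ | yes e₂ =
      let y₀ , new , others = swap-origin st (splitAt α p) (cong₂ _,_ e₁ e₂)
          w , keep , lose = adjacent v (join α β y₀)
          o , o≡w = old-surjective {w} λ w≡v → lose (subst (I v (join α β y₀) ∈ᴵ_) (sym w≡v) (join α β y₀ , refl))
      in inj₁ o , (λ q q≢p →
           let y″ , eq , y″≢ = others (splitAt α q) (splitAt-≢ q≢p) in
           subst (_∈′ inj₁ o) (sym (trans (cong lab eq) (lab-inc y″)))
             (∈old⁺ (subst (I v (join α β y″) ∈ᴵ_) (sym o≡w) (keep (join α β y″) (y″≢ ∘ join-injective))))) ,
         new∉old (punch st (splitAt α p)) new
    ... | no ne | _     = adjacent-away st p (ne ∘ cong proj₁)
    ... | yes _ | no ne = adjacent-away st p (ne ∘ cong proj₂)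

    adjacent-old : ∀ o p → Adjacent (inj₁ o) p
    adjacent-old o p = helper (adjacent (old o) p)
      where
      helper : (∃ λ w → (∀ q → q ≢ p → I (old o) q ∈ᴵ w) × ¬ (I (old o) p ∈ᴵ w)) → Adjacent (inj₁ o) p
      helper (w , keep , lose) with w Fin.≟ v
      ... | no w≢v = let o′ , eq = old-surjective w≢v in inj₁ o′ ,
            (λ q q≢p → ∈old⁺ (subst (I (old o) q ∈ᴵ_) (sym eq) (keep q q≢p))) ,
            λ j∈ → lose (subst (I (old o) p ∈ᴵ_) eq (∈old⁻ j∈))
      -- The edge from `old o` used to end at v, leaving the facet r of v at its other end. It now
      -- ends at the neighbour of the origin that misses r.
      ... | yes refl =
            let r , r∉ = separated {v} {old o} (punchInᵢ≢i v o ∘ sym)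
                y = splitAt α r
                q₁ , eq = pair-surjective (corner y) (corner≢origin y)
            in inj₂ q₁ ,
            (λ q q≢p → let r′ , e = keep q q≢p
                           y′ = splitAt α r′
                       in subst₂ _∈new_ (trans (lab-inc y′) (cong (λ j → Fin.suc (Fin.suc j)) (trans (cong (I v) (join-splitAt α β r′)) e))) (sym eq)
                            (∈new⁺ (corner-¬Miss y y′ (splitAt-≢ λ r′≡r → r∉ (q , sym (trans (cong (I v) (sym r′≡r)) e)))))) ,
            λ j∈ → lose (old∈new⇒∈v j∈)

    adjacent′ : ∀ u p → Adjacent u p
    adjacent′ (inj₁ o) = adjacent-old o
    adjacent′ (inj₂ q) = adjacent-new (pair q)

    T′ : X′ → Subset d
    T′ (inj₁ o) = T (old o)
    T′ (inj₂ q) = Tnew {α} {β} (pair q)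

    Owns′ : Subset (suc (suc N)) → X′ → Set
    Owns′ Y u = (∀ {j} → j ∈ Y → j ∈′ u) × (∀ p → p ∉ T′ u → I′ u p ∈ Y)

    OwnsNew : Subset (suc (suc N)) → Pair α β → Set
    OwnsNew Y st = (∀ {j} → j ∈ Y → j ∈new st) × (∀ p → p ∉ Tnew st → Inew st p ∈ Y)

    -- The simplex rule applies in each factor. The origin would be chosen only for the set of all
    -- old facets at v, which stands for the removed vertex; the last hypothesis excludes it.
    own-new : ∀ Y → (∀ {j} → j ∈ Y → ∃ λ x → lab x ≡ j) → (∃ λ s → lab (inj₁ s) ∉ Y) → (∃ λ t → lab (inj₂ t) ∉ Y) →
              ¬ (∀ y → lab (inc y) ∈ Y) → ∃ (Owns′ Y)
    own-new Y labels missA missB not-all =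
      let s , s∉ , above-s = last-missing (λ s → lab (inj₁ s) ∈? Y) missA
          t , t∉ , above-t = last-missing (λ t → lab (inj₂ t) ∈? Y) missB
          q , eq = pair-surjective (s , t) (not-origin s t above-s above-t)
      in inj₂ q , subst (OwnsNew Y) (sym eq) (owns s t s∉ above-s t∉ above-t)
      where
      not-origin : ∀ s t → (∀ i → s Fin.< i → lab (inj₁ i) ∈ Y) → (∀ i → t Fin.< i → lab (inj₂ i) ∈ Y) → (s , t) ≢ origin
      not-origin s t as at refl = not-all λ { (inj₁ i) → as (suc i) (ℕ.s≤s ℕ.z≤n) ; (inj₂ l) → at (suc l) (ℕ.s≤s ℕ.z≤n) }
      owns : ∀ s t → lab (inj₁ s) ∉ Y → (∀ i → s Fin.< i → lab (inj₁ i) ∈ Y) →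
             lab (inj₂ t) ∉ Y → (∀ i → t Fin.< i → lab (inj₂ i) ∈ Y) → OwnsNew Y (s , t)
      owns s t s∉ as t∉ at = (λ j∈ → let x , eq = labels j∈ in
            subst (_∈new (s , t)) eq (∈new⁺ λ miss → missing x miss (subst (_∈ Y) (sym eq) j∈))) ,
          λ p p∉ → after (punch (s , t) (splitAt α p))
            (∉Tnew⇒After (s , t) (splitAt α p) (subst (_∉ Tnew (s , t)) (sym (join-splitAt α β p)) p∉))
        where
        missing : ∀ x → Miss (s , t) x → lab x ∉ Y
        missing (inj₁ x) refl = s∉
        missing (inj₂ x) refl = t∉
        after : ∀ x → After (s , t) x → lab x ∈ Y
        after (inj₁ x) = as x
        after (inj₂ x) = at x

    own′ : ∀ Y u → (∀ {j} → j ∈ Y → j ∈′ u) → ∃ (Owns′ Y)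
    own′ Y (inj₂ q) within = own-new Y (λ j∈ → let x , _ , eq = ∈new⁻ (within j∈) in x , eq)
        (proj₁ (pair q) , λ j∈ → ∉new (inj₁ (proj₁ (pair q))) refl (within j∈))
        (proj₂ (pair q) , λ j∈ → ∉new (inj₂ (proj₂ (pair q))) refl (within j∈))
        λ all → pair≢origin q (is-origin (pair q) (λ j∈ → within j∈) all)
      where
      is-origin : ∀ st → (∀ {j} → j ∈ Y → j ∈new st) → (∀ y → lab (inc y) ∈ Y) → st ≡ origin
      is-origin (zero , zero)  within all = refl
      is-origin (suc s , t)    within all = contradiction (within (all (inj₁ s))) (∉new (inj₁ (suc s)) refl)
      is-origin (zero , suc t) within all = contradiction (within (all (inj₂ t))) (∉new (inj₂ (suc t)) refl)
    own′ Y′@(a ∷ b ∷ Y) (inj₁ o) within = helper (own Y (old o) λ j∈ → ∈old⁻ (within (there (there j∈))))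
      where
      fresh : ∀ x → IsNew x → lab x ∉ Y′
      fresh x new j∈ = new∉old x new (within j∈)
      is-old : ∀ {j} → j ∈ Y′ → ∃ λ j₀ → j ≡ suc (suc j₀) × j₀ ∈ Y
      is-old j∈ with within j∈
      ... | p , refl = I (old o) p , refl , drop-there (drop-there j∈)
      helper : ∃ (Owns Y) → ∃ (Owns′ Y′)
      helper (w , w-within , w-⊇) with w Fin.≟ v
      ... | no w≢v = let o′ , eq = old-surjective w≢v in inj₁ o′ ,
            (λ j∈ → let j₀ , e , j₀∈ = is-old j∈ in
               subst (_∈′ inj₁ o′) (sym e) (∈old⁺ (subst (j₀ ∈ᴵ_) (sym eq) (w-within j₀∈)))) ,
            subst (λ w → ∀ p → p ∉ T w → suc (suc (I w p)) ∈ Y′) (sym eq) λ p p∉ → there (there (w-⊇ p p∉))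
      -- A set formerly owned by v passes to a new vertex. It cannot contain all facets at v,
      -- because it also lies within the facets of `old o`.
      ... | yes refl = own-new Y′
            (λ j∈ → let j₀ , e , j₀∈ = is-old j∈ ; p , e′ = w-within j₀∈ in
               inc (splitAt α p) , trans (lab-inc (splitAt α p)) (trans (cong (λ p → suc (suc (I v p))) (join-splitAt α β p)) (trans (cong (λ j → Fin.suc (Fin.suc j)) e′) (sym e))))
            (zero , fresh (inj₁ zero) λ { (inj₁ _) () ; (inj₂ _) () })
            (zero , fresh (inj₂ zero) λ { (inj₁ _) () ; (inj₂ _) () })
            λ all → punchInᵢ≢i v o (sym (distinct λ p → ∈old⁻ (within
              (subst (_∈ Y′) (trans (lab-inc (splitAt α p)) (cong (λ p → suc (suc (I v p))) (join-splitAt α β p))) (all (splitAt α p))))))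

    after∈ : ∀ {Y st} → OwnsNew Y st → ∀ x → After st x → lab x ∈ Y
    after∈ {Y} {st} (_ , ⊇) x after = let y , eq , y∉ = After⇒∉Tnew st x after in
      subst (_∈ Y) (trans (Inew-join st y) (cong lab eq)) (⊇ (join α β y) y∉)

    unique-new : ∀ {Y} st st′ → OwnsNew Y st → OwnsNew Y st′ → st ≡ st′
    unique-new {Y} (s , t) (s′ , t′) O O′ = cong₂ _,_
      (last-missing-unique {P = λ s → lab (inj₁ s) ∈ Y}
        (λ j∈ → ∉new (inj₁ s) refl (proj₁ O j∈)) (λ i → after∈ O (inj₁ i))
        (λ j∈ → ∉new (inj₁ s′) refl (proj₁ O′ j∈)) (λ i → after∈ O′ (inj₁ i)))
      (last-missing-unique {P = λ t → lab (inj₂ t) ∈ Y}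
        (λ j∈ → ∉new (inj₂ t) refl (proj₁ O j∈)) (λ i → after∈ O (inj₂ i))
        (λ j∈ → ∉new (inj₂ t′) refl (proj₁ O′ j∈)) (λ i → after∈ O′ (inj₂ i)))

    -- The old labels of a set owned by a new vertex are facets at v. Since T v is everything, v
    -- would own them too, against uniqueness in K; this is why v must be a full vertex.
    unique-old-new : ∀ {Y o q} → Owns′ Y (inj₁ o) → ¬ Owns′ Y (inj₂ q)
    unique-old-new {a ∷ b ∷ Y} {o} (within , ⊇) (within′ , _) = punchInᵢ≢i v o (unique {Y}
      ((λ j∈ → ∈old⁻ (within (there (there j∈)))) , λ p p∉ → drop-there (drop-there (⊇ p p∉)))
      ((λ j∈ → old∈new⇒∈v (within′ (there (there j∈)))) , λ p p∉ → contradiction (full p) p∉))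

    unique′ : ∀ {Y u w} → Owns′ Y u → Owns′ Y w → u ≡ w
    unique′ {a ∷ b ∷ Y} {inj₁ o} {inj₁ o′} (within , ⊇) (within′ , ⊇′) = cong inj₁ (punchIn-injective v o o′ (unique {Y}
      ((λ j∈ → ∈old⁻ (within (there (there j∈)))) , λ p p∉ → drop-there (drop-there (⊇ p p∉)))
      ((λ j∈ → ∈old⁻ (within′ (there (there j∈)))) , λ p p∉ → drop-there (drop-there (⊇′ p p∉)))))
    unique′ {Y} {inj₁ o} {inj₂ q}  O O′ = contradiction O′ (unique-old-new {Y} O)
    unique′ {Y} {inj₂ q} {inj₁ o}  O O′ = contradiction O (unique-old-new {Y} O′)
    unique′ {Y} {inj₂ q} {inj₂ q′} O O′ = cong inj₂ (pair-injective (unique-new (pair q) (pair q′) O O′))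

    module _ (ε : ℚ) (small : Small K v ε) where

      private
        0<ε : 0ℚ < ε
        0<ε = proj₁ small

      -- If only one index is nonzero, the corresponding sum σ is ε and one cut is tight. If both
      -- are, σ_A = σ_B = ε/3 solves σ_A + 2 σ_B = ε = 2 σ_A + σ_B.
      κ : ∀ {n} → Fin (suc n) → ℚ
      κ zero    = ε
      κ (suc _) = third * ε

      κ>0 : ∀ {n} (s : Fin (suc n)) → 0ℚ < κ s
      κ>0 zero    = 0<ε
      κ>0 (suc _) = 0<* (positive⁻¹ third) 0<ε

      κ≤ε : ∀ {n} (s : Fin (suc n)) → κ s ≤ ε
      κ≤ε zero    = ≤-refl
      κ≤ε (suc _) = subst (third * ε ≤_) (*-identityˡ ε)
        (*-monoʳ-≤-nonNeg ε {{nonNegative (<⇒≤ 0<ε)}} (≤ᵇ⇒≤ {third} {1ℚ} _))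

      at : ∀ {n} → ℚ → Fin (suc n) → Fin n → ℚ
      at x zero    i = 0ℚ
      at x (suc s) i with s Fin.≟ i
      ... | yes _ = x
      ... | no _  = 0ℚ

      at-same : ∀ {n} x (i : Fin n) → at x (suc i) i ≡ x
      at-same x i with i Fin.≟ i
      ... | yes _  = refl
      ... | no i≢i = contradiction refl i≢i

      at-diff : ∀ {n} x s (i : Fin n) → suc i ≢ s → at x s i ≡ 0ℚ
      at-diff x zero    i ne = refl
      at-diff x (suc s) i ne with s Fin.≟ i
      ... | yes refl = contradiction refl ne
      ... | no _     = refl

      at-bounds : ∀ {n} x → 0ℚ ≤ x → x ≤ ε → ∀ s (i : Fin n) → 0ℚ ≤ at x s i × at x s i ≤ ε
      at-bounds x 0≤x x≤ε zero    i = ≤-refl , <⇒≤ 0<ε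
      at-bounds x 0≤x x≤ε (suc s) i with s Fin.≟ i
      ... | yes _ = 0≤x , x≤ε
      ... | no _  = ≤-refl , <⇒≤ 0<ε

      coord : Pair α β → Pos α β → ℚ
      coord (s , t) (inj₁ i) = at (κ t) s i
      coord (s , t) (inj₂ l) = at (κ s) t l

      z : Pair α β → Fin d → ℚ
      z st p = coord st (splitAt α p)

      coord-bounds : ∀ st y → 0ℚ ≤ coord st y × coord st y ≤ ε
      coord-bounds (s , t) (inj₁ i) = at-bounds (κ t) (<⇒≤ (κ>0 t)) (κ≤ε t) s i
      coord-bounds (s , t) (inj₂ l) = at-bounds (κ s) (<⇒≤ (κ>0 s)) (κ≤ε s) t l

      coord-Miss : ∀ st y → Miss st (inc y) → 0ℚ < coord st y
      coord-Miss (.(suc i) , t) (inj₁ i) refl = subst (0ℚ <_) (sym (at-same (κ t) i)) (κ>0 t)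
      coord-Miss (s , .(suc l)) (inj₂ l) refl = subst (0ℚ <_) (sym (at-same (κ s) l)) (κ>0 s)

      coord-¬Miss : ∀ st y → ¬ Miss st (inc y) → coord st y ≡ 0ℚ
      coord-¬Miss (s , t) (inj₁ i) = at-diff (κ t) s i
      coord-¬Miss (s , t) (inj₂ l) = at-diff (κ s) t l

      ω : ℚ → ℚ → Pos α β → ℚ
      ω a b (inj₁ _) = a
      ω a b (inj₂ _) = b

      ℓ′ : Fin (suc (suc N)) → Aff d
      -- The label `inj₁ zero` is missed exactly for s = 0. The weight two on the second factor
      -- leaves 2 ε - ε > 0 there, and weight one gives ε - ε = 0 at the pairs (s , zero).
      ℓ′ zero          = comb K v (ω 1ℚ two ∘ splitAt α) ε
      ℓ′ (suc zero)    = comb K v (ω two 1ℚ ∘ splitAt α) ε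
      ℓ′ (suc (suc j)) = ℓ j

      point : Pair α β → Point d
      point st = pt K v (z st)

      V′ : X′ → Point d
      V′ (inj₁ o) = V (old o)
      V′ (inj₂ q) = point (pair q)

      Σat : ∀ {n} x (s : Fin (suc n)) → ℚ
      Σat x zero    = 0ℚ
      Σat x (suc _) = x

      Σ-at : ∀ {n} a x (s : Fin (suc n)) → Σℚ {n} (λ i → a * at x s i) ≡ a * Σat x s
      Σ-at {n} a x zero    = trans (Σ-0 {n} λ _ → *-zeroʳ a) (sym (*-zeroʳ a))
      Σ-at {n} a x (suc s) = trans (Σ-single s λ i i≢s → trans (cong (a *_) (at-diff x (suc s) i (i≢s ∘ suc-injective))) (*-zeroʳ a))
                                   (cong (a *_) (at-same x s))

      ev-new : ∀ a b s t → ev (comb K v (ω a b ∘ splitAt α) ε) (point (s , t)) ≡ a * Σat (κ t) s + b * Σat (κ s) t - ε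
      ev-new a b s t = trans (ev-comb K v (ω a b ∘ splitAt α) ε (point (s , t))) (cong (_- ε) (trans
        (Σ-cong λ p → cong (ω a b (splitAt α p) *_) (E-pt K v (z (s , t)) p))
        (trans (Σ-⊎ α (λ y → ω a b y * coord (s , t) y)) (cong₂ _+_ (Σ-at a (κ t) s) (Σ-at b (κ s) t)))))

      lem-10 : ∀ ε → 1ℚ * ε + (1ℚ + 1ℚ) * 0ℚ - ε ≡ 0ℚ
      lem-10 = solve-∀ ℚ-ring
      lem-01 : ∀ ε → (1ℚ + 1ℚ) * 0ℚ + 1ℚ * ε - ε ≡ 0ℚ
      lem-01 = solve-∀ ℚ-ring
      lem-20 : ∀ ε → (1ℚ + 1ℚ) * ε + 1ℚ * 0ℚ - ε ≡ ε
      lem-20 = solve-∀ ℚ-ring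
      lem-02 : ∀ ε → 1ℚ * 0ℚ + (1ℚ + 1ℚ) * ε - ε ≡ ε
      lem-02 = solve-∀ ℚ-ring
      lem-both : ∀ a b c ε → a * (c * ε) + b * (c * ε) - ε ≡ (a * c + b * c - 1ℚ) * ε
      lem-both = solve-∀ ℚ-ring

      on-lab : ∀ st x → st ≢ origin → ¬ Miss st x → ev (ℓ′ (lab x)) (point st) ≡ 0ℚ
      on-lab (zero , t)      (inj₁ zero) st≢ ¬miss = contradiction refl ¬miss
      on-lab (suc s , zero)  (inj₁ zero) st≢ ¬miss = trans (ev-new 1ℚ two (suc s) zero) (lem-10 ε)
      on-lab (suc s , suc t) (inj₁ zero) st≢ ¬miss = trans (ev-new 1ℚ two (suc s) (suc t)) (trans (lem-both 1ℚ two third ε) (*-zeroˡ ε))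
      on-lab (s , zero)      (inj₂ zero) st≢ ¬miss = contradiction refl ¬miss
      on-lab (zero , suc t)  (inj₂ zero) st≢ ¬miss = trans (ev-new two 1ℚ zero (suc t)) (lem-01 ε)
      on-lab (suc s , suc t) (inj₂ zero) st≢ ¬miss = trans (ev-new two 1ℚ (suc s) (suc t)) (trans (lem-both two 1ℚ third ε) (*-zeroˡ ε))
      on-lab st (inj₁ (suc i)) st≢ ¬miss = trans (E-pt K v (z st) (i ↑ˡ β))
        (trans (cong (coord st) (splitAt-join α β (inj₁ i))) (coord-¬Miss st (inj₁ i) ¬miss))
      on-lab st (inj₂ (suc l)) st≢ ¬miss = trans (E-pt K v (z st) (α ↑ʳ l))
        (trans (cong (coord st) (splitAt-join α β (inj₂ l))) (coord-¬Miss st (inj₂ l) ¬miss))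

      off-lab : ∀ st x → st ≢ origin → Miss st x → 0ℚ < ev (ℓ′ (lab x)) (point st)
      off-lab (zero , zero)  (inj₁ zero) st≢ miss = contradiction refl st≢
      off-lab (zero , suc t) (inj₁ zero) st≢ miss = subst (0ℚ <_) (sym (trans (ev-new 1ℚ two zero (suc t)) (lem-02 ε))) 0<ε
      off-lab (zero , zero)  (inj₂ zero) st≢ miss = contradiction refl st≢
      off-lab (suc s , zero) (inj₂ zero) st≢ miss = subst (0ℚ <_) (sym (trans (ev-new two 1ℚ (suc s) zero) (lem-20 ε))) 0<ε
      off-lab st (inj₁ (suc i)) st≢ miss = subst (0ℚ <_) (sym (trans (E-pt K v (z st) (i ↑ˡ β))
        (cong (coord st) (splitAt-join α β (inj₁ i))))) (coord-Miss st (inj₁ i) miss)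
      off-lab st (inj₂ (suc l)) st≢ miss = subst (0ℚ <_) (sym (trans (E-pt K v (z st) (α ↑ʳ l))
        (cong (coord st) (splitAt-join α β (inj₂ l))))) (coord-Miss st (inj₂ l) miss)

      on-V′ : ∀ u p → ev (ℓ′ (I′ u p)) (V′ u) ≡ 0ℚ
      on-V′ (inj₁ o) p = on (old o) p
      on-V′ (inj₂ q) p = on-lab (pair q) (punch (pair q) (splitAt α p)) (pair≢origin q) (punch-¬Miss (pair q) (splitAt α p))

      off-new : ∀ st → st ≢ origin → ∀ j → ¬ (j ∈new st) → 0ℚ < ev (ℓ′ j) (point st)
      off-new st st≢ zero          j∉ = off-lab st (inj₁ zero) st≢ (∉new⇒Miss (inj₁ zero) j∉)
      off-new st st≢ (suc zero)    j∉ = off-lab st (inj₂ zero) st≢ (∉new⇒Miss (inj₂ zero) j∉)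
      off-new st st≢ (suc (suc j)) j∉ with j ∈ᴵ? v
      ... | no j∉v = pt-off K v (z st) (λ p → proj₁ (coord-bounds st (splitAt α p)))
              (proj₂ (proj₂ small) (z st) (λ p → proj₁ (coord-bounds st (splitAt α p))) (λ p → proj₂ (coord-bounds st (splitAt α p)))) j j∉v
      ... | yes (p , refl) = subst (λ j → 0ℚ < ev (ℓ′ j) (point st)) eq
              (off-lab st (inc (splitAt α p)) st≢ (∉new⇒Miss (inc (splitAt α p)) (subst (λ j → ¬ (j ∈new st)) (sym eq) j∉)))
        where
        eq : lab (inc (splitAt α p)) ≡ suc (suc (I v p))
        eq = trans (lab-inc (splitAt α p)) (cong (λ p → suc (suc (I v p))) (join-splitAt α β p))

      -- Weights of at least 1 can only increase the sum of the slacks, which exceeds ε by `Small`.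
      comb-off : ∀ a b → 1ℚ ≤ a → 1ℚ ≤ b → ∀ o → 0ℚ < ev (comb K v (ω a b ∘ splitAt α) ε) (V (old o))
      comb-off a b 1≤a 1≤b o = subst (0ℚ <_) (sym (ev-comb K v (ω a b ∘ splitAt α) ε (V (old o))))
        (<⇒0< (<-≤-trans (proj₁ (proj₂ small) (old o) (punchInᵢ≢i v o)) weighted))
        where
        1≤ω : ∀ y → 1ℚ ≤ ω a b y
        1≤ω (inj₁ _) = 1≤a
        1≤ω (inj₂ _) = 1≤b
        Σ-≤ : ∀ {n} {f g : Fin n → ℚ} → (∀ i → f i ≤ g i) → Σℚ f ≤ Σℚ g
        Σ-≤ {zero}  h = ≤-refl
        Σ-≤ {suc n} h = +-mono-≤ (h zero) (Σ-≤ (h ∘ suc))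
        weighted : Σℚ (λ p → E K v p (V (old o))) ≤ Σℚ (λ p → ω a b (splitAt α p) * E K v p (V (old o)))
        weighted = Σ-≤ λ p → subst (_≤ ω a b (splitAt α p) * E K v p (V (old o))) (*-identityˡ (E K v p (V (old o))))
          (*-monoʳ-≤-nonNeg (E K v p (V (old o))) {{nonNegative (ev≥0 (I v p) (old o))}} (1≤ω (splitAt α p)))

      off-V′ : ∀ u j → ¬ (j ∈′ u) → 0ℚ < ev (ℓ′ j) (V′ u)
      off-V′ (inj₁ o) zero          j∉ = comb-off 1ℚ two ≤-refl (≤ᵇ⇒≤ {1ℚ} {two} _) o
      off-V′ (inj₁ o) (suc zero)    j∉ = comb-off two 1ℚ (≤ᵇ⇒≤ {1ℚ} {two} _) ≤-refl o
      off-V′ (inj₁ o) (suc (suc j)) j∉ = off (old o) j (j∉ ∘ ∈old⁺)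
      off-V′ (inj₂ q) j j∉ = off-new (pair q) (pair≢origin q) j j∉

      glued : Cert X′ (suc (suc N)) d
      glued = record
        { I = I′ ; distinct = distinct′ ; adjacent = adjacent′ ; T = T′ ; own = own′
        ; unique = λ {Y} {u} {w} → unique′ {Y} {u} {w} ; V = V′ ; ℓ = ℓ′ ; on = on-V′ ; off = off-V′ }

    glue : Cert (Fin (m ℕ.+ (β ℕ.+ α ℕ.* suc β))) (suc (suc N)) d
    glue = let ε , small = small-exists K v in
      reindex (splitAt m) (join m (β ℕ.+ α ℕ.* suc β)) (splitAt-join m (β ℕ.+ α ℕ.* suc β)) (join-splitAt m (β ℕ.+ α ℕ.* suc β)) (glued ε small)

-- Assembly of both implications.

open FinSets
open Corners
open Sweep
open Congruences
open Semigroup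
open Certificates
open ProductLabels
open Gluing
open import Data.Nat using (ℕ; _≤_; _<_; zero; suc; _+_; _*_; _∸_; z≤n; s≤s; ⌊_/2⌋)
open import Data.Nat.Properties
open import Data.Nat.Combinatorics using (_C_; nCn≡1; nC1≡n; k>n⇒nCk≡0)
open import Data.Nat.Divisibility using (_∣_; _∣?_; ∣m+n∣m⇒∣n)
import Data.Integer.Divisibility.Signed as ℤ
open import Data.Fin using (Fin; toℕ; punchIn; splitAt; join)
open import Data.Fin.Subset using (∣_∣)
open import Data.Fin.Subset.Properties using (∣⊤∣≡n; ⊆⊤; ⊆-antisym)

-- Decidability of divisibility removes the double negation; counting with both functionals in every
-- dimension j yields the equal moments that `G∣Σ` expects.
simple⇒divisible : ∀ {d k n} → 2 ≤ d → k < d → SimpleWithKFaces d k n → G d k ∣ n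
simple⇒divisible {suc d} {k} {n} 2≤d k<d (m , V , simple , exact) = decidable-stable (G (suc d) k ∣? n) λ ¬div →
  simple⇒balanced V simple λ (M , r , r≤d , counts) → ¬div (subst (G (suc d) k ∣_)
    (HasExactly-functional (proj₁ (counts k)) exact)
    (G∣Σ (suc d) k 2≤d k<d r r≤d λ j → HasExactly-functional (proj₁ (counts j)) (proj₂ (counts j))))

Σℕ-punchIn : ∀ {n} i (f : Fin (suc n) → ℕ) → Σℕ f ≡ f i + Σℕ (f ∘ punchIn i)
Σℕ-punchIn Fin.zero f = refl
Σℕ-punchIn {suc n} (Fin.suc i) f = trans (cong (f Fin.zero +_) (Σℕ-punchIn i (f ∘ Fin.suc)))
  (x+[y+z]≡y+[x+z] (f Fin.zero) (f (Fin.suc i)) (Σℕ (f ∘ Fin.suc ∘ punchIn i)))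
  where
  open import Data.Nat.Tactic.RingSolver using (solve-∀)
  x+[y+z]≡y+[x+z] : ∀ x y z → x + (y + z) ≡ y + (x + z)
  x+[y+z]≡y+[x+z] = solve-∀

module _ (k : ℕ) where

  faces : ∀ {m N d} → Cert (Fin m) N d → ℕ
  faces K = Σℕ (λ u → ∣ Cert.T K u ∣ C k)

  -- The index `suc m` guarantees a vertex, from which `full-vertex` finds the place of the next
  -- gluing.
  Reached : ℕ → ℕ → Set
  Reached d n = ∃ λ m → ∃ λ N → ∃ λ (K : Cert (Fin (suc m)) N d) → faces K ≡ n

  reached⇒simple : ∀ {d n} → Reached (suc d) n → SimpleWithKFaces (suc d) k n
  reached⇒simple (m , N , K , refl) = suc m , Cert.V K ,
    corners⇒simple (Cert.V K) Fin.zero (cert-corner K) , Shelled.count-faces (cert-shelled K) k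

  reached-simplex : ∀ d → Reached d (suc d C suc k)
  reached-simplex d = d , suc d , Simplex.cert d ,
    trans (Σℕ-cong {suc d} λ s → cong (_C k) (∣below∣ s)) (simplex-count k d)

  reached-nonempty : ∀ {d m N} (K : Cert (Fin m) N d) → Fin m → Reached d (faces K)
  reached-nonempty {m = suc m} K _ = m , _ , K , refl

  -- The removed vertex has |T v| = d and the omitted origin has |Tnew| = 0, so the count changes by
  -- W minus C(d, k) and C(0, k). The element of Fin (α + β) yields a pair other than the origin,
  -- hence a vertex of the result.
  reached-glue : ∀ α β {n} → Fin (α + β) → α ≤ suc β → Reached (α + β) n → Reached (α + β) (n + Δ k (α + β) α)
  reached-glue α β p α≤ (m , N , K , refl) =
    let v , full = Cert.full-vertex K Fin.zero
        q , _ = pair-surjective {α} {β} (corner (splitAt α p)) (corner≢origin (splitAt α p))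
    in subst (Reached (α + β)) (count v full)
         (reached-nonempty (Glue.glue {α = α} {β} K v full) (join m (β + α * suc β) (inj₂ q)))
    where
    open Cert K using (T)
    open ≡-Reasoning
    open import Data.Nat.Tactic.RingSolver using (solve-∀)
    d = α + β
    h : Fin (suc α) × Fin (suc β) → ℕ
    h (s , t) = (toℕ s + toℕ t) C k
    B = Σℕ (λ q → h (pair {α} {β} q))
    W-split : W k α β ≡ 0 C k + B
    W-split = sym (Σℕ-remQuot (suc α) (suc β) h)
    1≤d : ∀ {n} → Fin n → 1 ≤ n
    1≤d {suc n} _ = s≤s z≤n
    lem₁ : ∀ a b c e → a + b + (c + e) ≡ e + a + (c + b)
    lem₁ = solve-∀
    lem₂ : ∀ f Δ c → f + (Δ + c) ≡ f + Δ + c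
    lem₂ = solve-∀
    count : ∀ v full → faces (Glue.glue {α = α} {β} K v full) ≡ faces K + Δ k d α
    count v full = +-cancelʳ-≡ (0 C k + d C k) (faces (Glue.glue {α = α} {β} K v full)) (faces K + Δ k d α) (begin
      faces (Glue.glue {α = α} {β} K v full) + (0 C k + d C k)
        ≡⟨ cong (_+ (0 C k + d C k)) (trans (Σℕ-⊎ m (λ x → ∣ Glue.T′ {α = α} {β} K v full x ∣ C k))
             (cong (A +_) (Σℕ-cong λ q → cong (_C k) (∣Tnew∣ {α} {β} (pair q))))) ⟩
      A + B + (0 C k + d C k)
        ≡⟨ lem₁ A B (0 C k) (d C k) ⟩
      d C k + A + (0 C k + B)
        ≡⟨ cong₂ _+_ (trans (cong (λ z → z C k + A) (sym ∣Tv∣)) (sym (Σℕ-punchIn v (λ u → ∣ T u ∣ C k)))) (sym W-split) ⟩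
      faces K + W k α β
        ≡⟨ cong (faces K +_) (Δ-W k d α β (1≤d p) α≤ refl) ⟨
      faces K + (Δ k d α + (0 C k + d C k))
        ≡⟨ lem₂ (faces K) (Δ k d α) (0 C k + d C k) ⟩
      faces K + Δ k d α + (0 C k + d C k) ∎)
      where
      A = Σℕ (λ o → ∣ T (punchIn v o) ∣ C k)
      ∣Tv∣ : ∣ T v ∣ ≡ d
      ∣Tv∣ = trans (cong ∣_∣ (⊆-antisym ⊆⊤ λ {p} _ → full p)) (∣⊤∣≡n d)

  reached-shift : ∀ d α → α ≤ ⌊ suc d /2⌋ → Shift (Reached (suc d)) (Δ k (suc d) α)
  reached-shift d α α≤ n = subst (λ e → Fin e → Reached e n → Reached e (n + Δ k e α)) (m+[n∸m]≡n α≤d)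
      (λ p → reached-glue α (suc d ∸ α) p α≤β) Fin.zero
    where
    α+α≤d : α + α ≤ suc d
    α+α≤d = ≤-trans (+-mono-≤ α≤ (≤-trans α≤ (⌊n/2⌋≤⌈n/2⌉ (suc d)))) (≤-reflexive (⌊n/2⌋+⌈n/2⌉≡n (suc d)))
    α≤d : α ≤ suc d
    α≤d = ≤-trans (m≤m+n α α) α+α≤d
    α≤β : α ≤ suc (suc d ∸ α)
    α≤β = m≤n⇒m≤1+n (m+n≤o⇒m≤o∸n α α+α≤d)

-- Keeps the partial gcds nonzero, as reduction modulo them requires.
m₁≢0 : ∀ d k → 2 ≤ d → k < d → mik d 1 k ≢ 0
m₁≢0 (suc d) k 2≤d k<d = m>n⇒m∸n≢0 (lt k k<d)
  where
  lt : ∀ k → k < suc d → 1 C suc k < suc d C suc k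
  lt zero    _   = ≤-trans 2≤d (≤-reflexive (sym (nC1≡n (suc d))))
  lt (suc k) k<d = subst (_< suc d C suc (suc k)) (sym (k>n⇒nCk≡0 {1} {suc (suc k)} (s≤s (s≤s z≤n))))
    (≤-trans (≤-reflexive (sym (nCn≡1 (suc (suc k))))) (C-mono (suc (suc k)) k<d))

reached-all : ∀ d k → 2 ≤ suc d → k < suc d → Eventually (Reached k (suc d)) (G (suc d) k)
reached-all d k 2≤d k<d with ⌊ suc d /2⌋ in eq | ⌊n/2⌋-mono 2≤d
... | suc n | s≤s _ = eventually-all (Reached k (suc d)) (λ i → mik (suc d) i k) (Δ k (suc d)) (m₁≢0 (suc d) k 2≤d k<d)
  refl (λ _ → refl) n λ i i≤ → reached-shift k d i (≤-trans i≤ (≤-reflexive (sym eq)))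

-- The simplex is the starting point; its count m₀ is itself a multiple of G by `G∣m₀`, so n - m₀ is
-- a multiple too, and an admissible increment once it is at least N.
divisible⇒simple : ∀ d k → 2 ≤ d → k < d → ∃ λ N → ∀ n → N < n → G d k ∣ n → SimpleWithKFaces d k n
divisible⇒simple (suc d) k 2≤d k<d = N + m₀ , λ n N<n G∣n →
  let m₀≤n = ≤-trans (m≤n+m m₀ N) (<⇒≤ N<n)
      n≡ = m+[n∸m]≡n m₀≤n
  in reached⇒simple k (subst (Reached k (suc d)) n≡ (shift (n ∸ m₀) (m+n≤o⇒m≤o∸n N (<⇒≤ N<n))
       (∣m+n∣m⇒∣n (subst (G (suc d) k ∣_) (sym n≡) G∣n) (ℤ.∣⇒∣ᵤ (G∣m₀ (suc d) k 2≤d k<d))) m₀ (reached-simplex k (suc d))))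
  where
  m₀ = suc (suc d) C suc k
  N = proj₁ (reached-all d k 2≤d k<d)
  shift = proj₂ (reached-all d k 2≤d k<d)

theorem4p1 : (d k : ℕ) → 2 ≤ d → k < d →
    Σ ℕ (λ N → (n : ℕ) → N < n → (SimpleWithKFaces d k n ⇔ (G d k ∣ n)))
theorem4p1 d k 2≤d k<d = let N , enough = divisible⇒simple d k 2≤d k<d in
  N , λ n N<n → mk⇔ (simple⇒divisible 2≤d k<d) (enough n N<n)
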